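{- Let $p$ be a prime and let $X\subseteq\mathbb{Z}/p\mathbb{Z}$ with $0\in X$, $|X|\ge 4$ and $\kappa_5(X)\le |X|+1$. Suppose $p>|X|+42$. Then (i) every $4$-atom of $X$ has cardinality $4$; (ii) if $|X|=4$, then every $5$-atom of $X$ has cardinality $5$.
   Context: For $X\subseteq\mathbb{Z}/p\mathbb{Z}$ and a positive integer $k$, the $k$-th isoperimetric number of $X$ is $$\kappa_k(X)=\min\{|S+X|-|S| : S\subseteq\mathbb{Z}/p\mathbb{Z},\ |S|\ge k,\ |S+X|\le p-k\},$$ with the convention $\min\emptyset=p$. A set $S$ attaining this minimum (with $|S|\ge k$ and $|S+X|\le p-k$) is a $k$-fragment of $X$; a $k$-fragment of minimal cardinality is a $k$-atom of $X$. -}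

module Defs where

open import Data.Nat using (ℕ; zero; suc; _+_; _∸_; _≤_; _⊓_; NonZero)
open import Data.Nat.DivMod using (_mod_)
open import Data.Fin using (Fin; toℕ)
open import Data.Fin.Subset using (Subset; ∣_∣; _∈_; inside; outside)
open import Data.Fin.Subset.Properties using (_∈?_)
open import Data.Bool using (Bool; true; false; if_then_else_)
open import Data.List using (List; []; _∷_; map; _++_; foldr)
open import Data.Bool.ListAction using (any)
open import Data.Vec using (Vec; []; _∷_; tabulate)
open import Data.Fin using (Fin)
open import Data.List.Base using (allFin)
open import Relation.Nullary.Decidable using (⌊_⌋)

_+ₚ_ : ∀ {p} .{{_ : NonZero p}} → Fin p → Fin p → Fin p
_+ₚ_ {p} a b = (toℕ a + toℕ b) mod p

_⊕_ : ∀ {p} .{{_ : NonZero p}} → Subset p → Subset p → Subset p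
_⊕_ {p} S X = tabulate λ i →
  any (λ s → any (λ x → ⌊ s ∈? S ⌋ Data.Bool.∧ (⌊ x ∈? X ⌋ Data.Bool.∧ ⌊ (s +ₚ x) Data.Fin.≟ i ⌋)) (allFin p)) (allFin p)

allSubsets : ∀ n → List (Subset n)
allSubsets zero = [] ∷ []
allSubsets (suc n) = map (inside ∷_) (allSubsets n) ++ map (outside ∷_) (allSubsets n)

Admissible : ∀ {p} .{{_ : NonZero p}} → ℕ → Subset p → Subset p → Set
Admissible {p} k X S = (k ≤ ∣ S ∣) Data.Product.× (∣ S ⊕ X ∣ ≤ p ∸ k)
  where import Data.Product

admissible? : ∀ {p} .{{_ : NonZero p}} → ℕ → Subset p → Subset p → Bool
admissible? {p} k X S = ⌊ k Data.Nat.≤? ∣ S ∣ ⌋ Data.Bool.∧ ⌊ ∣ S ⊕ X ∣ Data.Nat.≤? p ∸ k ⌋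

-- κ_k(X) = min { |S+X| - |S| : S admissible }, with min ∅ = p.
κ : ∀ {p} .{{_ : NonZero p}} → ℕ → Subset p → ℕ
κ {p} k X = foldr (λ S m → if admissible? k X S then (∣ S ⊕ X ∣ ∸ ∣ S ∣) ⊓ m else m) p (allSubsets p)

IsFragment : ∀ {p} .{{_ : NonZero p}} → ℕ → Subset p → Subset p → Set
IsFragment k X S = Admissible k X S Data.Product.× (∣ S ⊕ X ∣ ∸ ∣ S ∣ ≡ κ k X)
  where import Data.Product
        open import Relation.Binary.PropositionalEquality using (_≡_)

IsAtom : ∀ {p} .{{_ : NonZero p}} → ℕ → Subset p → Subset p → Set
IsAtom k X S = IsFragment k X S Data.Product.× (∀ T → IsFragment k X T → ∣ S ∣ ≤ ∣ T ∣)
  where import Data.Product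

0ₚ : ∀ {p} .{{_ : NonZero p}} → Fin p
0ₚ {p} = Data.Fin.fromℕ< {0} (Data.Nat.>-nonZero⁻¹ p)

{-# OPTIONS --safe #-}

-- Let A be a 4-atom of X with |A| ≥ 5. Minimality of A implies that every
-- element of A + X has a representation a + x with a different from any given
-- element of A, and that |A ∩ (A + g)| ≤ 3 for g ≠ 0. Call x ∈ S a g-end of S
-- if x + g ∉ S. A g-end of A + X is represented only by g-ends of A and of X,
-- and A + X has at least as many g-ends as A, so the double covering forces X to
-- have at least three g-ends, for every g ≠ 0. A count of additive coincidences
-- shows that the 2-atoms of A are pairs {x, x + g}, whence A has at most three
-- g-ends. Submodularity of S ↦ |S + X| then leaves only |A + X| = |A| + |X| + 1,
-- with as many g-ends in A as in A + X and exactly three in X. The double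
-- covering determines the barycentre of the g-ends of A + X from those of A and
-- X. Comparing with the (-g)-ends, where for every S the two sums of ends differ
-- by (|S| - #ends) g, gives a contradiction modulo p. The barycentre argument
-- fails only if the ends of A form an affine copy of {0, 1, 3} or {0, 1, 2};
-- there the sets A + {0, g, …, i g} keep three g-ends, so the gaps of A are long,
-- and a finite check on slopes excludes the case. If |X| = 4, a 5-atom with more
-- than five elements makes X a Sidon set, submodularity bounds |A ∩ (A + g)| by 2,
-- and this contradicts the same count of coincidences.

module Submission where

open import Defs
open import Data.Nat using (ℕ; zero; suc; _+_; _*_; _∸_; _≤_; _<_; z≤n; s≤s; _≤?_; _≤ᵇ_; _<ᵇ_; _⊓_; NonZero; nonTrivial⇒n>1)
open import Data.Nat.Properties
open import Data.Nat.Primality using (Prime; prime⇒nonTrivial; prime⇒nonZero; euclidsLemma)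
import Data.Nat.DivMod as ℕD
import Data.Nat.Divisibility as ℕDiv
import Data.Nat.Tactic.RingSolver as ℕR
open import Data.Integer.Base as ℤ using (ℤ; +_; -[1+_]) renaming (_+_ to _+ᶻ_; _*_ to _*ᶻ_; _-_ to _-ᶻ_; -_ to -ᶻ_)
import Data.Integer.DivMod as ℤD
open import Data.Integer.Divisibility.Signed using (divides; ∣⇒∣ᵤ; ∣ᵤ⇒∣) renaming (_∣_ to _∣ᶻ_; _∣?_ to _∣?ᶻ_)
import Data.Integer.Properties as ℤP
import Data.Integer.Tactic.RingSolver as ℤR
open import Data.Bool using (Bool; true; false; _∧_; _∨_; not; T; if_then_else_)
import Data.Bool.ListAction as LA
open import Data.Empty using (⊥; ⊥-elim)
open import Data.Fin.Base as Fin using (Fin; toℕ; fromℕ<)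
import Data.Fin.Properties as FinP
import Data.Fin.Subset as Sub
open import Data.Fin.Subset using (Subset; ∣_∣)
import Data.Fin.Subset.Properties as SubP
open import Data.List.Base using (List; []; _∷_; allFin; foldr; map)
import Data.List.Membership.Propositional as LM
import Data.List.Membership.Propositional.Properties as LMP
open import Data.List.Relation.Unary.Any using (Any; here; there)
open import Data.Product using (∃; _×_; _,_; proj₁; proj₂)
open import Data.Sum using (_⊎_; inj₁; inj₂)
open import Data.Vec.Base as Vec using (lookup; tabulate)
import Data.Vec.Properties as VecP
open import Function using (_∘_)
open import Relation.Nullary using (¬_; Dec; yes; no)
open import Relation.Nullary.Decidable using (⌊_⌋; from-no)
open import Relation.Binary.PropositionalEquality hiding (resp)

-- Finite sums of functions on ℤ over 0, …, n - 1

-- The obstacle is that submodularity produces the set A ∩ (A + g), which has at most three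
-- elements, so that minimality of a 4-atom says nothing about it. Its expansion has to come from
-- the ends of X instead. The upper bounds come from exchanging roles: {x, x + g} + A has |A| plus
-- the number of g-ends of A elements, and when such a pair is a 2-atom of A, the set X competes
-- with it, its excess being at most |A| + 1. A then has at most six elements. The barycentre
-- relation alone involves unknown sums. It becomes useful because it holds for g and for -g, and
-- subtracting leaves only known multiples of g. The slack 42 serves two purposes. The largest
-- competitor, A + {0, g, ..., 10 g}, has a sumset of at most |X| + 37 elements, which must leave
-- room for four more. And with |X| ≥ 4 it gives p > 46, so that all nonzero integers of absolute
-- value at most 46 are invertible modulo p, as the finite check requires.

sum : ℕ → (ℤ → ℕ) → ℕ
sum zero    f = 0
sum (suc n) f = f (+ n) + sum n f

sum-cong : ∀ n {f g : ℤ → ℕ} → (∀ x → f x ≡ g x) → sum n f ≡ sum n g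
sum-cong zero    h = refl
sum-cong (suc n) h = cong₂ _+_ (h _) (sum-cong n h)

sum-mono : ∀ n {f g : ℤ → ℕ} → (∀ x → f x ≤ g x) → sum n f ≤ sum n g
sum-mono zero    h = z≤n
sum-mono (suc n) h = +-mono-≤ (h _) (sum-mono n h)

interchange : ∀ a b c d → (a + b) + (c + d) ≡ (a + c) + (b + d)
interchange = ℕR.solve-∀

sum-+ : ∀ n (f g : ℤ → ℕ) → sum n (λ x → f x + g x) ≡ sum n f + sum n g
sum-+ zero    f g = refl
sum-+ (suc n) f g = trans (cong₂ _+_ refl (sum-+ n f g))
                          (interchange (f (+ n)) (g (+ n)) (sum n f) (sum n g))

sum-* : ∀ n c (f : ℤ → ℕ) → sum n (λ x → c * f x) ≡ c * sum n f
sum-* zero    c f = sym (*-zeroʳ c)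
sum-* (suc n) c f = trans (cong₂ _+_ refl (sum-* n c f))
                          (sym (*-distribˡ-+ c (f (+ n)) (sum n f)))

sum-*ʳ : ∀ n c (f : ℤ → ℕ) → sum n (λ x → f x * c) ≡ sum n f * c
sum-*ʳ n c f = trans (sum-cong n (λ x → *-comm (f x) c)) (trans (sum-* n c f) (*-comm c _))

sum-0 : ∀ n → sum n (λ _ → 0) ≡ 0
sum-0 zero    = refl
sum-0 (suc n) = sum-0 n

sum-1 : ∀ n → sum n (λ _ → 1) ≡ n
sum-1 zero    = refl
sum-1 (suc n) = cong suc (sum-1 n)

sum-swap : ∀ m n (f : ℤ → ℤ → ℕ) →
           sum m (λ x → sum n (f x)) ≡ sum n (λ y → sum m (λ x → f x y))
sum-swap zero    n f = sym (sum-0 n)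
sum-swap (suc m) n f = trans (cong₂ _+_ refl (sum-swap m n f))
                             (sym (sum-+ n (f (+ m)) (λ y → sum m (λ x → f x y))))

sum-step : ∀ n (f : ℤ → ℕ) →
           sum n (λ x → f (x +ᶻ + 1)) + f (+ 0) ≡ sum n f + f (+ n)
sum-step zero    f = refl
sum-step (suc n) f = begin
  f (+ (n + 1)) + s' + f (+ 0)   ≡⟨ +-assoc (f (+ (n + 1))) s' (f (+ 0)) ⟩
  f (+ (n + 1)) + (s' + f (+ 0)) ≡⟨ cong₂ (λ k r → f (+ k) + r) (+-comm n 1) (sum-step n f) ⟩
  f (+ suc n) + (sum n f + f (+ n)) ≡⟨ rot (f (+ suc n)) (sum n f) (f (+ n)) ⟩
  f (+ n) + sum n f + f (+ suc n) ∎
  where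
  open ≡-Reasoning
  s' = sum n (λ x → f (x +ᶻ + 1))
  rot : ∀ a b c → a + (b + c) ≡ c + b + a
  rot = ℕR.solve-∀

-- Linear inequalities are refuted by exhibiting lhs = rhs + positive.

abstract
  absurd-≤ : ∀ {l r} k → l ≤ r → l ≡ suc k + r → ⊥
  absurd-≤ {r = r} k l≤r refl = <-irrefl refl (≤-trans (s≤s (m≤n+m r k)) l≤r)

  ≤-shift : ∀ {l r x y} w → l ≤ r → l ≡ x + w → r ≡ y + w → x ≤ y
  ≤-shift w h refl refl = +-cancelʳ-≤ w _ _ h

infixl 6 _⊞≤_
_⊞≤_ : ∀ {a b c d} → a ≤ b → c ≤ d → a + c ≤ b + d
_⊞≤_ = +-mono-≤

ind : Bool → ℕ
ind true  = 1
ind false = 0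

module Residues (p : ℕ) (prime : Prime p) where

  -- Congruence modulo p

  infix 4 _≈_ _≉_ _≈?_

  -- A record rather than a synonym, so that `x` and `y` can be inferred from the type; `_∈_` and
  -- `_∉_` use the same device.
  record _≈_ (x y : ℤ) : Set where
    constructor mod
    field witness : + p ∣ᶻ (x -ᶻ y)

  _≉_ : ℤ → ℤ → Set
  x ≉ y = ¬ (x ≈ y)

  ≈-by : ∀ {x y} q → x -ᶻ y ≡ q *ᶻ + p → x ≈ y
  ≈-by q eq = mod (divides q eq)

  _≈?_ : ∀ x y → Dec (x ≈ y)
  x ≈? y with + p ∣?ᶻ (x -ᶻ y)
  ... | yes d = yes (mod d)
  ... | no ¬d = no λ { (mod d) → ¬d d }

  -- All later congruences are certified in this way: the difference of the two sides is written as
  -- a ℤ-linear combination of the differences in the hypotheses, an identity left to the ring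
  -- solver.
  combine₁ : ∀ {x y a b} c → a ≈ b → x -ᶻ y ≡ c *ᶻ (a -ᶻ b) → x ≈ y
  combine₁ c (mod (divides q eq)) e =
    ≈-by (c *ᶻ q) (trans e (trans (cong (c *ᶻ_) eq) (sym (ℤP.*-assoc c q (+ p)))))

  combine₂ : ∀ {x y a b a′ b′} c c′ → a ≈ b → a′ ≈ b′ →
             x -ᶻ y ≡ c *ᶻ (a -ᶻ b) +ᶻ c′ *ᶻ (a′ -ᶻ b′) → x ≈ y
  combine₂ c c′ (mod (divides q eq)) (mod (divides q′ eq′)) e =
    ≈-by (c *ᶻ q +ᶻ c′ *ᶻ q′)
         (trans e (trans (cong₂ (λ u v → c *ᶻ u +ᶻ c′ *ᶻ v) eq eq′) (lem c c′ q q′ (+ p))))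
    where
    lem : ∀ c c′ q q′ r → c *ᶻ (q *ᶻ r) +ᶻ c′ *ᶻ (q′ *ᶻ r) ≡ (c *ᶻ q +ᶻ c′ *ᶻ q′) *ᶻ r
    lem = ℤR.solve-∀

  combine₃ : ∀ {x y a b a′ b′ a″ b″} c c′ c″ → a ≈ b → a′ ≈ b′ → a″ ≈ b″ →
             x -ᶻ y ≡ c *ᶻ (a -ᶻ b) +ᶻ c′ *ᶻ (a′ -ᶻ b′) +ᶻ c″ *ᶻ (a″ -ᶻ b″) → x ≈ y
  combine₃ c c′ c″ (mod (divides q eq)) (mod (divides q′ eq′)) (mod (divides q″ eq″)) e =
    ≈-by (c *ᶻ q +ᶻ c′ *ᶻ q′ +ᶻ c″ *ᶻ q″)
         (trans e (trans (cong₃ (λ u v w → c *ᶻ u +ᶻ c′ *ᶻ v +ᶻ c″ *ᶻ w) eq eq′ eq″) (lem c c′ c″ q q′ q″ (+ p))))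
    where
    cong₃ : ∀ (f : ℤ → ℤ → ℤ → ℤ) {a b c a′ b′ c′} → a ≡ a′ → b ≡ b′ → c ≡ c′ → f a b c ≡ f a′ b′ c′
    cong₃ f refl refl refl = refl
    lem : ∀ c c′ c″ q q′ q″ r → c *ᶻ (q *ᶻ r) +ᶻ c′ *ᶻ (q′ *ᶻ r) +ᶻ c″ *ᶻ (q″ *ᶻ r) ≡ (c *ᶻ q +ᶻ c′ *ᶻ q′ +ᶻ c″ *ᶻ q″) *ᶻ r
    lem = ℤR.solve-∀

  ≈-refl : ∀ {x} → x ≈ x
  ≈-refl {x} = ≈-by (+ 0) (ℤP.+-inverseʳ x)

  ≡⇒≈ : ∀ {x y} → x ≡ y → x ≈ y
  ≡⇒≈ refl = ≈-refl

  ≈-sym : ∀ {x y} → x ≈ y → y ≈ x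
  ≈-sym {x} {y} h = combine₁ ℤ.-1ℤ h (lem x y)
    where lem : ∀ x y → y -ᶻ x ≡ ℤ.-1ℤ *ᶻ (x -ᶻ y)
          lem = ℤR.solve-∀

  ≈-trans : ∀ {x y z} → x ≈ y → y ≈ z → x ≈ z
  ≈-trans {x} {y} {z} h k = combine₂ (+ 1) (+ 1) h k (lem x y z)
    where lem : ∀ x y z → x -ᶻ z ≡ + 1 *ᶻ (x -ᶻ y) +ᶻ + 1 *ᶻ (y -ᶻ z)
          lem = ℤR.solve-∀

  +-cong≈ : ∀ {x y x′ y′} → x ≈ y → x′ ≈ y′ → x +ᶻ x′ ≈ y +ᶻ y′
  +-cong≈ {x} {y} {x′} {y′} h k = combine₂ (+ 1) (+ 1) h k (lem x y x′ y′)
    where lem : ∀ x y x′ y′ → (x +ᶻ x′) -ᶻ (y +ᶻ y′) ≡ + 1 *ᶻ (x -ᶻ y) +ᶻ + 1 *ᶻ (x′ -ᶻ y′)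
          lem = ℤR.solve-∀

  -‿cong≈ : ∀ {x y x′ y′} → x ≈ y → x′ ≈ y′ → x -ᶻ x′ ≈ y -ᶻ y′
  -‿cong≈ {x} {y} {x′} {y′} h k = combine₂ (+ 1) ℤ.-1ℤ h k (lem x y x′ y′)
    where lem : ∀ x y x′ y′ → (x -ᶻ x′) -ᶻ (y -ᶻ y′) ≡ + 1 *ᶻ (x -ᶻ y) +ᶻ ℤ.-1ℤ *ᶻ (x′ -ᶻ y′)
          lem = ℤR.solve-∀

  *-congˡ≈ : ∀ c {x y} → x ≈ y → c *ᶻ x ≈ c *ᶻ y
  *-congˡ≈ c {x} {y} h = combine₁ c h (lem c x y)
    where lem : ∀ c x y → (c *ᶻ x) -ᶻ (c *ᶻ y) ≡ c *ᶻ (x -ᶻ y)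
          lem = ℤR.solve-∀

  +p≈ : ∀ x → x +ᶻ + p ≈ x
  +p≈ x = ≈-by (+ 1) (lem x (+ p))
    where lem : ∀ x q → (x +ᶻ q) -ᶻ x ≡ + 1 *ᶻ q
          lem = ℤR.solve-∀

  instance
    p-nonZero : NonZero p
    p-nonZero = prime⇒nonZero prime

  1<p : 1 < p
  1<p = nonTrivial⇒n>1 p {{prime⇒nonTrivial prime}}

  representative : ∀ x → ∃ λ i → i < p × x ≈ + i
  representative x = x ℤD.%ℕ p , ℤD.n%ℕd<d x p ,
    ≈-by (x ℤD./ℕ p) (trans (cong (_-ᶻ + (x ℤD.%ℕ p)) (ℤD.a≡a%ℕn+[a/ℕn]*n x p)) (lem (+ (x ℤD.%ℕ p)) _))
    where lem : ∀ r m → (r +ᶻ m) -ᶻ r ≡ m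
          lem = ℤR.solve-∀

  small≉0 : ∀ {i} → 0 < i → i < p → + i ≉ + 0
  small≉0 {suc i} _ i<p (mod d) = ℕDiv.>⇒∤ i<p (subst (p ℕDiv.∣_) lem (∣⇒∣ᵤ d))
    where lem : ℤ.∣ + suc i -ᶻ + 0 ∣ ≡ suc i
          lem = cong ℤ.∣_∣ (ℤP.+-identityʳ (+ suc i))

  -- Euclid's lemma, the only use of primality beyond excluding p ≤ 1.
  ≈0-product : ∀ m x → + m *ᶻ x ≈ + 0 → p ℕDiv.∣ m ⊎ x ≈ + 0
  ≈0-product m x (mod d) with euclidsLemma m ℤ.∣ x ∣ prime (subst (p ℕDiv.∣_) lem (∣⇒∣ᵤ d))
    where lem : ℤ.∣ + m *ᶻ x -ᶻ + 0 ∣ ≡ m * ℤ.∣ x ∣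
          lem = trans (cong ℤ.∣_∣ (ℤP.+-identityʳ (+ m *ᶻ x))) (ℤP.∣i*j∣≡∣i∣*∣j∣ (+ m) x)
  ... | inj₁ h = inj₁ h
  ... | inj₂ h = inj₂ (mod (subst (+ p ∣ᶻ_) (sym (ℤP.+-identityʳ x)) (∣ᵤ⇒∣ h)))

  cancel≈ : ∀ m {x} → 0 < m → m < p → + m *ᶻ x ≈ + 0 → x ≈ + 0
  cancel≈ (suc m) {x} _ m<p h with ≈0-product (suc m) x h
  ... | inj₁ d = ⊥-elim (ℕDiv.>⇒∤ m<p d)
  ... | inj₂ h′ = h′

  -- Sums of periodic functions

  Periodic : (ℤ → ℕ) → Set
  Periodic f = ∀ {x y} → x ≈ y → f x ≡ f y

  sum-shift-suc : ∀ {f} → Periodic f → sum p (λ x → f (x +ᶻ + 1)) ≡ sum p f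
  sum-shift-suc {f} per = +-cancelʳ-≡ (f (+ 0)) _ _
    (trans (sum-step p f) (cong₂ _+_ refl (per (+p≈ (+ 0)))))

  shift-periodic : ∀ {f} → Periodic f → ∀ g → Periodic (λ x → f (x +ᶻ g))
  shift-periodic per g h = per (+-cong≈ h (≈-refl {g}))

  sum-shift⁺ : ∀ {f} → Periodic f → ∀ k → sum p (λ x → f (x +ᶻ + k)) ≡ sum p f
  sum-shift⁺ {f} per zero = sum-cong p (λ x → cong f (ℤP.+-identityʳ x))
  sum-shift⁺ {f} per (suc k) = trans
    (sum-cong p (λ x → cong f (sym (ℤP.+-assoc x (+ 1) (+ k)))))
    (trans (sum-shift-suc (shift-periodic per (+ k))) (sum-shift⁺ per k))

  sum-shift : ∀ {f} → Periodic f → ∀ g → sum p (λ x → f (x +ᶻ g)) ≡ sum p f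
  sum-shift per (+ k) = sum-shift⁺ per k
  sum-shift {f} per -[1+ k ] = trans
    (sym (sum-shift⁺ (shift-periodic per -[1+ k ]) (suc k)))
    (sum-cong p (λ x → cong f (lem x (+ suc k))))
    where lem : ∀ x y → (x +ᶻ y) +ᶻ (-ᶻ y) ≡ x
          lem = ℤR.solve-∀

  -- Subsets of ℤ/p are encoded as p-periodic Boolean functions on ℤ, so that
  -- translations need no reduction modulo p.

  record PSet : Set where
    field
      χ    : ℤ → Bool
      resp : ∀ {x y} → x ≈ y → χ x ≡ χ y
  open PSet public

  infix 4 _∈_ _∉_ _⊆_

  record _∈_ (x : ℤ) (S : PSet) : Set where
    constructor mem
    field holds : χ S x ≡ true
  open _∈_ public

  record _∉_ (x : ℤ) (S : PSet) : Set where
    constructor nonmem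
    field fails : χ S x ≡ false
  open _∉_ public

  _⊆_ : PSet → PSet → Set
  S ⊆ T = ∀ {x} → x ∈ S → x ∈ T

  member? : ∀ x S → x ∈ S ⊎ x ∉ S
  member? x S with χ S x in eq
  ... | true  = inj₁ (mem eq)
  ... | false = inj₂ (nonmem eq)

  true≢false : ∀ {A : Set} {b} → b ≡ true → b ≡ false → A
  true≢false refl ()

  ∈∉-⊥ : ∀ {A : Set} {x S} → x ∈ S → x ∉ S → A
  ∈∉-⊥ (mem e) (nonmem e′) = true≢false e e′

  ∈-resp : ∀ S {x y} → x ≈ y → x ∈ S → y ∈ S
  ∈-resp S h (mem m) = mem (trans (sym (resp S h)) m)

  ∧-true : ∀ {a b} → a ∧ b ≡ true → a ≡ true × b ≡ true
  ∧-true {true} {true} _ = refl , refl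

  ∧-intro : ∀ {a b} → a ≡ true → b ≡ true → a ∧ b ≡ true
  ∧-intro refl refl = refl

  ∨-true : ∀ {a b} → a ∨ b ≡ true → a ≡ true ⊎ b ≡ true
  ∨-true {true} _ = inj₁ refl
  ∨-true {false} h = inj₂ h

  ∨-introˡ : ∀ {a b} → a ≡ true → a ∨ b ≡ true
  ∨-introˡ refl = refl

  ∨-introʳ : ∀ {a b} → b ≡ true → a ∨ b ≡ true
  ∨-introʳ {true} _ = refl
  ∨-introʳ {false} h = h

  not-true : ∀ {a} → not a ≡ true → a ≡ false
  not-true {false} _ = refl

  bool-ext : ∀ {a b} → (a ≡ true → b ≡ true) → (b ≡ true → a ≡ true) → a ≡ b
  bool-ext {true} {true} f g = refl
  bool-ext {true} {false} f g = sym (f refl)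
  bool-ext {false} {true} f g = g refl
  bool-ext {false} {false} f g = refl

  ind-mono : ∀ {a b} → (a ≡ true → b ≡ true) → ind a ≤ ind b
  ind-mono {true} h rewrite h refl = ≤-refl
  ind-mono {false} h = z≤n

  ⌊⌋-true : ∀ {P : Set} {d : Dec P} → P → ⌊ d ⌋ ≡ true
  ⌊⌋-true {d = yes _} _ = refl
  ⌊⌋-true {d = no ¬q} q = ⊥-elim (¬q q)

  ⌊⌋-elim : ∀ {P : Set} {d : Dec P} → ⌊ d ⌋ ≡ true → P
  ⌊⌋-elim {d = yes q} _ = q

  -- Set operations and cardinality

  infixl 6 _∪_
  infixl 7 _∩_
  infixl 7.5 _+>_ _∖_
  _∪_ _∩_ : PSet → PSet → PSet
  S ∪ T = record { χ = λ x → χ S x ∨ χ T x ; resp = λ h → cong₂ _∨_ (resp S h) (resp T h) }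
  S ∩ T = record { χ = λ x → χ S x ∧ χ T x ; resp = λ h → cong₂ _∧_ (resp S h) (resp T h) }

  ∁ : PSet → PSet
  ∁ S = record { χ = λ x → not (χ S x) ; resp = λ h → cong not (resp S h) }

  _+>_ : PSet → ℤ → PSet
  S +> g = record { χ = λ x → χ S (x -ᶻ g) ; resp = λ h → resp S (-‿cong≈ h ≈-refl) }

  ⟨_⟩ : ℤ → PSet
  ⟨ x ⟩ = record { χ = λ y → ⌊ y ≈? x ⌋
                 ; resp = λ h → bool-ext (λ e → ⌊⌋-true (≈-trans (≈-sym h) (⌊⌋-elim e)))
                                         (λ e → ⌊⌋-true (≈-trans h (⌊⌋-elim e))) }

  _∖_ : PSet → ℤ → PSet
  S ∖ x = S ∩ ∁ ⟨ x ⟩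

  ∖-elim : ∀ S {x y} → y ∈ S ∖ x → y ∈ S × y ≉ x
  ∖-elim S {x} {y} (mem h) with ∧-true {χ S y} h
  ... | m , n = mem m , λ e → true≢false (⌊⌋-true {d = y ≈? x} e) (not-true n)

  ∖-intro : ∀ S {x y} → y ∈ S → y ≉ x → y ∈ S ∖ x
  ∖-intro S {x} {y} (mem m) n = mem (∧-intro m (lem (y ≈? x)))
    where
    lem : (d : Dec (y ≈ x)) → not ⌊ d ⌋ ≡ true
    lem (yes e) = ⊥-elim (n e)
    lem (no _)  = refl

  card : PSet → ℕ
  card S = sum p (λ x → ind (χ S x))

  card-≐ : ∀ S T → (∀ x → χ S x ≡ χ T x) → card S ≡ card T
  card-≐ S T h = sum-cong p (λ x → cong ind (h x))

  card-mono : ∀ S T → S ⊆ T → card S ≤ card T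
  card-mono S T h = sum-mono p (λ x → ind-mono λ e → holds (h (mem e)))

  card-ext : ∀ S T → S ⊆ T → T ⊆ S → card S ≡ card T
  card-ext S T h k = ≤-antisym (card-mono S T h) (card-mono T S k)

  card-∪∩ : ∀ S T → card (S ∪ T) + card (S ∩ T) ≡ card S + card T
  card-∪∩ S T = begin
    card (S ∪ T) + card (S ∩ T)  ≡⟨ sym (sum-+ p _ _) ⟩
    sum p (λ x → ind (χ S x ∨ χ T x) + ind (χ S x ∧ χ T x))  ≡⟨ sum-cong p (λ x → lem (χ S x) (χ T x)) ⟩
    sum p (λ x → ind (χ S x) + ind (χ T x))  ≡⟨ sum-+ p _ _ ⟩
    card S + card T ∎
    where
    open ≡-Reasoning
    lem : ∀ a b → ind (a ∨ b) + ind (a ∧ b) ≡ ind a + ind b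
    lem true true = refl
    lem true false = refl
    lem false true = refl
    lem false false = refl

  card-∁ : ∀ S → card S + card (∁ S) ≡ p
  card-∁ S = trans (sym (sum-+ p _ _)) (trans (sum-cong p (λ x → lem (χ S x))) (sum-1 p))
    where
    lem : ∀ a → ind a + ind (not a) ≡ 1
    lem true = refl
    lem false = refl

  card≤p : ∀ S → card S ≤ p
  card≤p S = ≤-trans (m≤m+n _ _) (≤-reflexive (card-∁ S))

  χ-periodic : ∀ S → Periodic (λ x → ind (χ S x))
  χ-periodic S h = cong ind (resp S h)

  card-+> : ∀ S g → card (S +> g) ≡ card S
  card-+> S g = sum-shift (χ-periodic S) (-ᶻ g)

  sum-ind-zero : ∀ n → suc n ≤ p → sum (suc n) (λ y → ind ⌊ y ≈? + 0 ⌋) ≡ 1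
  sum-ind-zero zero _ with (+ 0) ≈? (+ 0)
  ... | yes _ = refl
  ... | no ¬e = ⊥-elim (¬e ≈-refl)
  sum-ind-zero (suc n) n<p with (+ suc n) ≈? (+ 0)
  ... | yes e = ⊥-elim (small≉0 (s≤s z≤n) n<p e)
  ... | no _  = sum-ind-zero n (≤-trans (n≤1+n _) n<p)

  card-⟨⟩ : ∀ x → card ⟨ x ⟩ ≡ 1
  card-⟨⟩ x = trans (sym (sum-shift (χ-periodic ⟨ x ⟩) x))
    (trans (sum-cong p (λ y → cong ind (bool-ext (λ e → ⌊⌋-true (to y (⌊⌋-elim e))) (λ e → ⌊⌋-true (from y (⌊⌋-elim e))))))
           (at-p p refl))
    where
    lem₁ : ∀ x y → y -ᶻ + 0 ≡ + 1 *ᶻ ((y +ᶻ x) -ᶻ x)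
    lem₁ = ℤR.solve-∀
    lem₂ : ∀ x y → (y +ᶻ x) -ᶻ x ≡ + 1 *ᶻ (y -ᶻ + 0)
    lem₂ = ℤR.solve-∀
    to : ∀ y → y +ᶻ x ≈ x → y ≈ + 0
    to y h = combine₁ (+ 1) h (lem₁ x y)
    from : ∀ y → y ≈ + 0 → y +ᶻ x ≈ x
    from y h = combine₁ (+ 1) h (lem₂ x y)
    at-p : ∀ q → q ≡ p → sum q (λ y → ind ⌊ y ≈? + 0 ⌋) ≡ 1
    at-p zero    e = ⊥-elim (n≮0 (subst (1 <_) (sym e) 1<p))
    at-p (suc q) e = sum-ind-zero q (≤-reflexive e)

  split-at : ∀ S {x} → x ∈ S → ∀ y → ind (χ S y) ≡ ind ⌊ y ≈? x ⌋ + ind (χ (S ∖ x) y)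
  split-at S {x} m y with y ≈? x
  ... | yes e rewrite holds (∈-resp S (≈-sym e) m) = refl
  ... | no _ with χ S y
  ...   | true = refl
  ...   | false = refl

  card-∖ : ∀ S {x} → x ∈ S → card S ≡ suc (card (S ∖ x))
  card-∖ S {x} m = trans (sum-cong p (split-at S m))
    (trans (sum-+ p _ _) (cong (_+ card (S ∖ x)) (card-⟨⟩ x)))

  card-pos : ∀ S {x} → x ∈ S → 0 < card S
  card-pos S m = subst (0 <_) (sym (card-∖ S m)) (s≤s z≤n)

  ∃-term : ∀ n (f : ℤ → Bool) → 0 < sum n (ind ∘ f) → ∃ λ x → f x ≡ true
  ∃-term (suc n) f h with f (+ n) in eq
  ... | true  = + n , eq
  ... | false = ∃-term n f h

  nonempty : ∀ S → 0 < card S → ∃ λ x → x ∈ S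
  nonempty S h with ∃-term p (χ S) h
  ... | x , e = x , mem e

  card≡0 : ∀ S → card S ≡ 0 → ∀ {x} → x ∈ S → ⊥
  card≡0 S e m = <-irrefl (sym e) (card-pos S m)

  ⊆-card≥ : ∀ S T → S ⊆ T → card T ≤ card S → T ⊆ S
  ⊆-card≥ S T h k {x} x∈T with member? x S
  ... | inj₁ m = m
  ... | inj₂ n = ⊥-elim (<-irrefl refl (≤-trans (≤-reflexive (sym (card-∖ T x∈T)))
          (≤-trans k (card-mono S (T ∖ x) λ y∈S → ∖-intro T (h y∈S) λ e → ∈∉-⊥ (∈-resp S e y∈S) n))))

  -- Sums of elements

  sumᶻ : ℕ → (ℤ → ℤ) → ℤ
  sumᶻ zero    f = + 0
  sumᶻ (suc n) f = f (+ n) +ᶻ sumᶻ n f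

  sumᶻ-cong≈ : ∀ n {f g : ℤ → ℤ} → (∀ x → f x ≈ g x) → sumᶻ n f ≈ sumᶻ n g
  sumᶻ-cong≈ zero    h = ≈-refl
  sumᶻ-cong≈ (suc n) h = +-cong≈ (h _) (sumᶻ-cong≈ n h)

  sumᶻ-+ : ∀ n (f g : ℤ → ℤ) → sumᶻ n (λ x → f x +ᶻ g x) ≡ sumᶻ n f +ᶻ sumᶻ n g
  sumᶻ-+ zero    f g = refl
  sumᶻ-+ (suc n) f g = trans (cong (λ t → (f (+ n) +ᶻ g (+ n)) +ᶻ t) (sumᶻ-+ n f g)) (lem (f (+ n)) (g (+ n)) (sumᶻ n f) (sumᶻ n g))
    where lem : ∀ a b c d → (a +ᶻ b) +ᶻ (c +ᶻ d) ≡ (a +ᶻ c) +ᶻ (b +ᶻ d)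
          lem = ℤR.solve-∀

  sumᶻ-step : ∀ n (f : ℤ → ℤ) → sumᶻ n (λ x → f (x +ᶻ + 1)) +ᶻ f (+ 0) ≡ sumᶻ n f +ᶻ f (+ n)
  sumᶻ-step zero    f = refl
  sumᶻ-step (suc n) f = begin
    f (+ (n + 1)) +ᶻ s′ +ᶻ f (+ 0)   ≡⟨ ℤP.+-assoc (f (+ (n + 1))) s′ (f (+ 0)) ⟩
    f (+ (n + 1)) +ᶻ (s′ +ᶻ f (+ 0)) ≡⟨ cong₂ (λ k r → f (+ k) +ᶻ r) (+-comm n 1) (sumᶻ-step n f) ⟩
    f (+ suc n) +ᶻ (sumᶻ n f +ᶻ f (+ n)) ≡⟨ rot (f (+ suc n)) (sumᶻ n f) (f (+ n)) ⟩
    f (+ n) +ᶻ sumᶻ n f +ᶻ f (+ suc n) ∎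
    where
    open ≡-Reasoning
    s′ = sumᶻ n (λ x → f (x +ᶻ + 1))
    rot : ∀ a b c → a +ᶻ (b +ᶻ c) ≡ c +ᶻ b +ᶻ a
    rot = ℤR.solve-∀

  sumᶻ-scaled : ∀ n (f : ℤ → ℕ) c → sumᶻ n (λ x → + f x *ᶻ c) ≡ + sum n f *ᶻ c
  sumᶻ-scaled zero    f c = refl
  sumᶻ-scaled (suc n) f c = trans (cong (λ t → + f (+ n) *ᶻ c +ᶻ t) (sumᶻ-scaled n f c))
    (sym (ℤP.*-distribʳ-+ c (+ f (+ n)) (+ sum n f)))

  term : PSet → ℤ → ℤ
  term S x = + ind (χ S x) *ᶻ x

  wsum : PSet → ℤ
  wsum S = sumᶻ p (term S)

  wsum-≐ : ∀ S T → (∀ x → χ S x ≡ χ T x) → wsum S ≈ wsum T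
  wsum-≐ S T h = sumᶻ-cong≈ p (λ x → ≡⇒≈ (cong (λ b → + ind b *ᶻ x) (h x)))

  wsum-+>1 : ∀ S → wsum (S +> + 1) ≈ wsum S +ᶻ + card S *ᶻ + 1
  wsum-+>1 S = combine₂ (+ 1) ℤ.-1ℤ shifted end
    (lem₁ (wsum (S +> + 1)) (wsum S +ᶻ + card S *ᶻ + 1) (h (+ 0)) (h (+ p)))
    where
    h : ℤ → ℤ
    h x = + ind (χ S (x -ᶻ + 1)) *ᶻ x
    lem₁ : ∀ w r h0 hp → w -ᶻ r ≡ + 1 *ᶻ ((w +ᶻ hp) -ᶻ (r +ᶻ h0)) +ᶻ ℤ.-1ℤ *ᶻ (hp -ᶻ h0)
    lem₁ = ℤR.solve-∀
    back : ∀ x → (x +ᶻ + 1) -ᶻ + 1 ≡ x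
    back = ℤR.solve-∀
    dist : ∀ i x → i *ᶻ (x +ᶻ + 1) ≡ i *ᶻ x +ᶻ i *ᶻ + 1
    dist = ℤR.solve-∀
    shifted : wsum (S +> + 1) +ᶻ h (+ p) ≈ (wsum S +ᶻ + card S *ᶻ + 1) +ᶻ h (+ 0)
    shifted = ≈-trans (≡⇒≈ (sym (sumᶻ-step p h))) (+-cong≈ (≈-trans
      (sumᶻ-cong≈ p (λ x → ≡⇒≈ (trans (cong (λ y → + ind (χ S y) *ᶻ (x +ᶻ + 1)) (back x)) (dist (+ ind (χ S x)) x))))
      (≡⇒≈ (trans (sumᶻ-+ p (term S) (λ x → + ind (χ S x) *ᶻ + 1)) (cong (λ t → wsum S +ᶻ t) (sumᶻ-scaled p (λ x → ind (χ S x)) (+ 1)))))) ≈-refl)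
    -- The factor x spoils periodicity over ℤ; the two boundary terms agree because both vanish
    -- modulo p.
    end : h (+ p) ≈ h (+ 0)
    end = ≈-by (+ ind (χ S (+ p -ᶻ + 1))) (lem (+ ind (χ S (+ p -ᶻ + 1))) (+ ind (χ S (+ 0 -ᶻ + 1))) (+ p))
      where lem : ∀ a b q → (a *ᶻ q) -ᶻ (b *ᶻ + 0) ≡ a *ᶻ q
            lem = ℤR.solve-∀

  wsum-+>⁺ : ∀ S k → wsum (S +> + k) ≈ wsum S +ᶻ + card S *ᶻ + k
  wsum-+>⁺ S zero = ≈-trans (wsum-≐ (S +> + 0) S (λ x → cong (χ S) (ℤP.+-identityʳ x))) (≡⇒≈ (lem (wsum S) (+ card S)))
    where lem : ∀ w c → w ≡ w +ᶻ c *ᶻ + 0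
          lem = ℤR.solve-∀
  wsum-+>⁺ S (suc k) = ≈-trans (wsum-≐ (S +> + suc k) (S +> + k +> + 1) (λ x → cong (χ S) (lem x (+ k))))
    (≈-trans (wsum-+>1 (S +> + k)) (≈-trans (+-cong≈ (wsum-+>⁺ S k) (≡⇒≈ (cong (λ c → + c *ᶻ + 1) (card-+> S (+ k))))) (≡⇒≈ (lem₂ (wsum S) (+ card S) (+ k)))))
    where
    lem : ∀ x k → x -ᶻ (+ 1 +ᶻ k) ≡ (x -ᶻ + 1) -ᶻ k
    lem = ℤR.solve-∀
    lem₂ : ∀ w c k → (w +ᶻ c *ᶻ k) +ᶻ c *ᶻ + 1 ≡ w +ᶻ c *ᶻ (+ 1 +ᶻ k)
    lem₂ = ℤR.solve-∀

  wsum-+> : ∀ S g → wsum (S +> g) ≈ wsum S +ᶻ + card S *ᶻ g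
  wsum-+> S (+ k) = wsum-+>⁺ S k
  wsum-+> S -[1+ k ] = combine₁ ℤ.-1ℤ undo (lem₂ (wsum (S +> -[1+ k ])) (wsum S) (+ card S) (+ suc k))
    where
    lem : ∀ x k → x ≡ (x -ᶻ k) -ᶻ (-ᶻ k)
    lem = ℤR.solve-∀
    lem₂ : ∀ w w′ c k → w -ᶻ (w′ +ᶻ c *ᶻ (-ᶻ k)) ≡ ℤ.-1ℤ *ᶻ (w′ -ᶻ (w +ᶻ c *ᶻ k))
    lem₂ = ℤR.solve-∀
    undo : wsum S ≈ wsum (S +> -[1+ k ]) +ᶻ + card S *ᶻ + suc k
    undo = ≈-trans (wsum-≐ S (S +> -[1+ k ] +> + suc k) (λ x → cong (χ S) (lem x (+ suc k))))
      (≈-trans (wsum-+>⁺ (S +> -[1+ k ]) (suc k)) (≡⇒≈ (cong (λ c → wsum (S +> -[1+ k ]) +ᶻ + c *ᶻ + suc k) (card-+> S -[1+ k ]))))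

  wsum-∖ : ∀ S {x} → x ∈ S → wsum S ≈ x +ᶻ wsum (S ∖ x)
  wsum-∖ S {x} m = ≈-trans (sumᶻ-cong≈ p pt) (≈-trans (≡⇒≈ (sumᶻ-+ p _ (term (S ∖ x))))
     (+-cong≈ (≡⇒≈ (trans (sumᶻ-scaled p (λ y → ind ⌊ y ≈? x ⌋) x) (trans (cong (λ c → + c *ᶻ x) (card-⟨⟩ x)) (ℤP.*-identityˡ x)))) ≈-refl))
    where
    lem : ∀ a b x y → (a +ᶻ b) *ᶻ y -ᶻ (a *ᶻ x +ᶻ b *ᶻ y) ≡ a *ᶻ (y -ᶻ x)
    lem = ℤR.solve-∀
    aux : ∀ y → + ind ⌊ y ≈? x ⌋ *ᶻ y ≈ + ind ⌊ y ≈? x ⌋ *ᶻ x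
    aux y with y ≈? x
    ... | yes e = *-congˡ≈ (+ 1) e
    ... | no _  = ≡⇒≈ refl
    pt : ∀ y → term S y ≈ + ind ⌊ y ≈? x ⌋ *ᶻ x +ᶻ term (S ∖ x) y
    pt y = ≈-trans (≡⇒≈ (trans (cong (λ c → + c *ᶻ y) (split-at S m y)) (ℤP.*-distribʳ-+ y (+ ind ⌊ y ≈? x ⌋) (+ ind (χ (S ∖ x) y)))))
                   (+-cong≈ (aux y) ≈-refl)

  -- Endpoints

  E : ℤ → PSet → PSet
  E g S = record { χ = λ x → χ S x ∧ not (χ S (x +ᶻ g))
                 ; resp = λ h → cong₂ (λ a b → a ∧ not b) (resp S h) (resp S (+-cong≈ h ≈-refl)) }

  E-elim : ∀ {g} S {x} → x ∈ E g S → x ∈ S × x +ᶻ g ∉ S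
  E-elim S {x} (mem h) with ∧-true {χ S x} h
  ... | m , n = mem m , nonmem (not-true n)

  E-intro : ∀ {g} S {x} → x ∈ S → x +ᶻ g ∉ S → x ∈ E g S
  E-intro S (mem m) (nonmem n) = mem (∧-intro m (cong not n))

  infixl 7.5 _⊔>_ _⊓>_
  _⊔>_ _⊓>_ : PSet → ℤ → PSet
  S ⊔> g = S ∪ S +> g
  S ⊓> g = S ∩ S +> g

  x-g+g : ∀ x g → (x -ᶻ g) +ᶻ g ≡ x
  x-g+g = ℤR.solve-∀

  x+g-g : ∀ x g → (x +ᶻ g) -ᶻ g ≡ x
  x+g-g = ℤR.solve-∀

  -- What S + g adds to S is exactly the translate by g of the g-ends of S.
  card-⊔> : ∀ S g → card (S ⊔> g) ≡ card S + card (E g S)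
  card-⊔> S g = trans (sum-cong p pt) (trans (sum-+ p (λ x → ind (χ S x)) (λ x → ind (χ (E g S +> g) x))) (cong₂ _+_ refl (card-+> (E g S) g)))
    where
    lem : ∀ a b → ind (a ∨ b) ≡ ind a + ind (b ∧ not a)
    lem true true = refl
    lem true false = refl
    lem false true = refl
    lem false false = refl
    pt : ∀ x → ind (χ (S ⊔> g) x) ≡ ind (χ S x) + ind (χ (E g S +> g) x)
    pt x = trans (lem (χ S x) (χ S (x -ᶻ g))) (cong (λ y → ind (χ S x) + ind (χ S (x -ᶻ g) ∧ not (χ S y))) (sym (x-g+g x g)))

  card-⊓> : ∀ S g → card (S ⊓> g) + card (E g S) ≡ card S
  card-⊓> S g = +-cancelˡ-≡ (card S) _ _ (begin
    card S + (card (S ⊓> g) + card (E g S)) ≡⟨ lem (card S) (card (S ⊓> g)) (card (E g S)) ⟩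
    card S + card (E g S) + card (S ⊓> g) ≡⟨ cong (_+ card (S ⊓> g)) (sym (card-⊔> S g)) ⟩
    card (S ⊔> g) + card (S ⊓> g) ≡⟨ card-∪∩ S (S +> g) ⟩
    card S + card (S +> g) ≡⟨ cong₂ _+_ refl (card-+> S g) ⟩
    card S + card S ∎)
    where
    open ≡-Reasoning
    lem : ∀ a b c → a + (b + c) ≡ a + c + b
    lem = ℕR.solve-∀

  balance : ∀ a b → ind b + ind (a ∧ not b) ≡ ind a + ind (b ∧ not a)
  balance true true = refl
  balance true false = refl
  balance false true = refl
  balance false false = refl

  balance-E : ∀ S g x → ind (χ (S +> g) x) + ind (χ (E (-ᶻ g) S) x) ≡ ind (χ S x) + ind (χ (E g S +> g) x)
  balance-E S g x = trans (balance (χ S x) (χ S (x -ᶻ g)))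
    (cong (λ y → ind (χ S x) + ind (χ S (x -ᶻ g) ∧ not (χ S y))) (sym (x-g+g x g)))

  -- In effect each maximal g-progression has one end in each direction; the pointwise `balance-E`
  -- replaces a decomposition into progressions.
  card-E-neg : ∀ S g → card (E (-ᶻ g) S) ≡ card (E g S)
  card-E-neg S g = +-cancelˡ-≡ (card S) _ _ (begin
    card S + card (E (-ᶻ g) S) ≡⟨ cong (_+ card (E (-ᶻ g) S)) (sym (card-+> S g)) ⟩
    card (S +> g) + card (E (-ᶻ g) S) ≡⟨ sym (sum-+ p _ _) ⟩
    sum p (λ x → ind (χ (S +> g) x) + ind (χ (E (-ᶻ g) S) x)) ≡⟨ sum-cong p (balance-E S g) ⟩
    sum p (λ x → ind (χ S x) + ind (χ (E g S +> g) x)) ≡⟨ sum-+ p _ _ ⟩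
    card S + card (E g S +> g) ≡⟨ cong₂ _+_ refl (card-+> (E g S) g) ⟩
    card S + card (E g S) ∎)
    where open ≡-Reasoning

  -- Telescoping the sum of (x + g) - x over x ∈ S.
  wsum-E : ∀ S g → wsum (E g S) +ᶻ + card (E g S) *ᶻ g ≈ wsum (E (-ᶻ g) S) +ᶻ + card S *ᶻ g
  wsum-E S g = combine₂ ℤ.-1ℤ (+ 1) key shiftS′ (lem (wsum (E g S)) (+ card (E g S) *ᶻ g) (wsum (E (-ᶻ g) S)) (+ card S *ᶻ g) (wsum S) (wsum (S +> g)))
    where
    lem : ∀ e c e′ d s t → (e +ᶻ c) -ᶻ (e′ +ᶻ d) ≡ ℤ.-1ℤ *ᶻ ((t +ᶻ e′) -ᶻ (s +ᶻ (e +ᶻ c))) +ᶻ + 1 *ᶻ (t -ᶻ (s +ᶻ d))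
    lem = ℤR.solve-∀
    shiftS′ = wsum-+> S g
    dist : ∀ a b x → (+ (a + b)) *ᶻ x ≡ + a *ᶻ x +ᶻ + b *ᶻ x
    dist a b x = ℤP.*-distribʳ-+ x (+ a) (+ b)
    pt : ∀ x → term (S +> g) x +ᶻ term (E (-ᶻ g) S) x ≡ term S x +ᶻ term (E g S +> g) x
    pt x = trans (sym (dist (ind (χ (S +> g) x)) (ind (χ (E (-ᶻ g) S) x)) x))
      (trans (cong (λ c → + c *ᶻ x) (balance-E S g x)) (dist (ind (χ S x)) (ind (χ (E g S +> g) x)) x))
    key : wsum (S +> g) +ᶻ wsum (E (-ᶻ g) S) ≈ wsum S +ᶻ (wsum (E g S) +ᶻ + card (E g S) *ᶻ g)
    key = ≈-trans (≡⇒≈ (sym (sumᶻ-+ p (term (S +> g)) (term (E (-ᶻ g) S)))))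
      (≈-trans (sumᶻ-cong≈ p {λ x → term (S +> g) x +ᶻ term (E (-ᶻ g) S) x} {λ x → term S x +ᶻ term (E g S +> g) x} (λ x → ≡⇒≈ (pt x)))
      (≈-trans (≡⇒≈ (sumᶻ-+ p (term S) (term (E g S +> g)))) (+-cong≈ (≈-refl {wsum S}) (wsum-+> (E g S) g))))

  wsum-empty : ∀ S → card S ≡ 0 → wsum S ≈ + 0
  wsum-empty S e = ≈-trans (sumᶻ-cong≈ p {term S} {λ _ → + 0} (λ x → ≡⇒≈ (pt x))) (≡⇒≈ (sumᶻ-0 p))
    where
    sumᶻ-0 : ∀ n → sumᶻ n (λ _ → + 0) ≡ + 0
    sumᶻ-0 zero    = refl
    sumᶻ-0 (suc n) = trans (ℤP.+-identityˡ _) (sumᶻ-0 n)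
    pt : ∀ x → term S x ≡ + 0
    pt x with member? x S
    ... | inj₁ m = ⊥-elim (card≡0 S e m)
    ... | inj₂ n = cong (λ b → + ind b *ᶻ x) (fails n)

  -- Without g-ends, and hence without (-g)-ends, `wsum-E` collapses to |S| g ≡ 0, so p divides |S|.
  E-empty : ∀ S {g} → g ≉ + 0 → card (E g S) ≡ 0 → card S ≡ 0 ⊎ card S ≡ p
  E-empty S {g} g≉0 e = conclude (≈0-product (card S) g key)
    where
    zero* : + card (E g S) *ᶻ g ≡ + 0
    zero* = cong (λ c → + c *ᶻ g) e
    left : wsum (E g S) +ᶻ + card (E g S) *ᶻ g ≈ + 0
    left = combine₂ (+ 1) (+ 1) (wsum-empty (E g S) e) (≡⇒≈ zero*) (lem₂ (wsum (E g S)) (+ card (E g S) *ᶻ g))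
      where lem₂ : ∀ a b → (a +ᶻ b) -ᶻ + 0 ≡ + 1 *ᶻ (a -ᶻ + 0) +ᶻ + 1 *ᶻ (b -ᶻ + 0)
            lem₂ = ℤR.solve-∀
    right : wsum (E (-ᶻ g) S) ≈ + 0
    right = wsum-empty (E (-ᶻ g) S) (trans (card-E-neg S g) e)
    lem : ∀ c e e′ d → c -ᶻ + 0 ≡ ℤ.-1ℤ *ᶻ ((e +ᶻ d) -ᶻ (e′ +ᶻ c)) +ᶻ + 1 *ᶻ ((e +ᶻ d) -ᶻ + 0) +ᶻ ℤ.-1ℤ *ᶻ (e′ -ᶻ + 0)
    lem = ℤR.solve-∀
    key : + card S *ᶻ g ≈ + 0
    key = combine₃ ℤ.-1ℤ (+ 1) ℤ.-1ℤ (wsum-E S g) left right (lem (+ card S *ᶻ g) (wsum (E g S)) (wsum (E (-ᶻ g) S)) (+ card (E g S) *ᶻ g))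
    aux : ∀ n → p ℕDiv.∣ n → n ≤ p → n ≡ 0 ⊎ n ≡ p
    aux zero    _ _ = inj₁ refl
    aux (suc n) d h = inj₂ (≤-antisym h (ℕDiv.∣⇒≤ d))
    conclude : p ℕDiv.∣ card S ⊎ g ≈ + 0 → card S ≡ 0 ⊎ card S ≡ p
    conclude (inj₂ h) = ⊥-elim (g≉0 h)
    conclude (inj₁ d) = aux (card S) d (card≤p S)

  E-pos : ∀ S {g} → g ≉ + 0 → 0 < card S → card S < p → 0 < card (E g S)
  E-pos S {g} g≉0 l u = n≢0⇒n>0 λ e → case (E-empty S g≉0 e)
    where
    case : card S ≡ 0 ⊎ card S ≡ p → ⊥
    case (inj₁ z) = <-irrefl (sym z) l
    case (inj₂ z) = <-irrefl z u

  -- Sumsets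

  any<_ : ℕ → (ℤ → Bool) → Bool
  any<_ zero    f = false
  any<_ (suc n) f = f (+ n) ∨ (any< n) f

  any<-intro : ∀ {n i} f → i < n → f (+ i) ≡ true → (any< n) f ≡ true
  any<-intro {suc n} {i} f i<n h with m≤n⇒m<n∨m≡n i<n
  ... | inj₁ (s≤s i<) = ∨-introʳ (any<-intro f i< h)
  ... | inj₂ refl = ∨-introˡ h

  any<-elim : ∀ n f → (any< n) f ≡ true → ∃ λ x → f x ≡ true
  any<-elim (suc n) f h with f (+ n) in eq
  ... | true  = + n , eq
  ... | false = any<-elim n f h

  any<-cong : ∀ n {f g} → (∀ x → f x ≡ g x) → (any< n) f ≡ (any< n) g
  any<-cong zero    h = refl
  any<-cong (suc n) h = cong₂ _∨_ (h _) (any<-cong n h)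

  infixl 7 _⊞_
  _⊞_ : PSet → PSet → PSet
  A ⊞ X = record
    { χ = λ z → (any< p) (λ a → χ A a ∧ χ X (z -ᶻ a))
    ; resp = λ h → any<-cong p (λ a → cong (χ A a ∧_) (resp X (-‿cong≈ h ≈-refl))) }

  ⊞-intro : ∀ A X {a z} → a ∈ A → z -ᶻ a ∈ X → z ∈ A ⊞ X
  ⊞-intro A X {a} {z} m n = go (representative a)
    where
    go : (∃ λ i → i < p × a ≈ + i) → z ∈ A ⊞ X
    go (i , i<p , e) = mem (any<-intro (λ b → χ A b ∧ χ X (z -ᶻ b)) i<p (∧-intro (holds (∈-resp A e m)) (holds (∈-resp X (-‿cong≈ (≈-refl {z}) e) n))))

  ⊞-elim : ∀ A X {z} → z ∈ A ⊞ X → ∃ λ a → a ∈ A × z -ᶻ a ∈ X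
  ⊞-elim A X {z} (mem h) with any<-elim p (λ b → χ A b ∧ χ X (z -ᶻ b)) h
  ... | a , e = a , mem (proj₁ (∧-true {χ A a} e)) , mem (proj₂ (∧-true {χ A a} e))

  ⊞-mono : ∀ A B X → A ⊆ B → A ⊞ X ⊆ B ⊞ X
  ⊞-mono A B X h {z} m with ⊞-elim A X m
  ... | a , a∈ , x∈ = ⊞-intro B X (h a∈) x∈

  ⊞-comm : ∀ A X → A ⊞ X ⊆ X ⊞ A
  ⊞-comm A X {z} m with ⊞-elim A X m
  ... | a , a∈ , x∈ = ⊞-intro X A x∈ (subst (_∈ A) (sym (lem z a)) a∈)
    where lem : ∀ z a → z -ᶻ (z -ᶻ a) ≡ a
          lem = ℤR.solve-∀

  card-⊞-comm : ∀ A X → card (A ⊞ X) ≡ card (X ⊞ A)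
  card-⊞-comm A X = card-ext (A ⊞ X) (X ⊞ A) (⊞-comm A X) (⊞-comm X A)

  ⊔>-elim : ∀ S {g x} → x ∈ S ⊔> g → x ∈ S ⊎ x -ᶻ g ∈ S
  ⊔>-elim S {g} {x} (mem h) with ∨-true {χ S x} h
  ... | inj₁ e = inj₁ (mem e)
  ... | inj₂ e = inj₂ (mem e)

  ⊓>-elim : ∀ S {g x} → x ∈ S ⊓> g → x ∈ S × x -ᶻ g ∈ S
  ⊓>-elim S {g} {x} (mem h) with ∧-true {χ S x} h
  ... | e , e′ = mem e , mem e′

  ⊓>-intro : ∀ S {g x} → x ∈ S → x -ᶻ g ∈ S → x ∈ S ⊓> g
  ⊓>-intro S (mem e) (mem e′) = mem (∧-intro e e′)

  ⊔>-introˡ : ∀ S {g x} → x ∈ S → x ∈ S ⊔> g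
  ⊔>-introˡ S {g} {x} (mem e) = mem (∨-introˡ {χ S x} e)

  ⊔>-introʳ : ∀ S {g x} → x -ᶻ g ∈ S → x ∈ S ⊔> g
  ⊔>-introʳ S {g} {x} (mem e) = mem (∨-introʳ {χ S x} e)

  ⊔>-⊞ : ∀ A X g → (A ⊔> g) ⊞ X ⊆ (A ⊞ X) ⊔> g
  ⊔>-⊞ A X g {z} m with ⊞-elim (A ⊔> g) X m
  ... | a , a∈ , x∈ with ⊔>-elim A {g} {a} a∈
  ...   | inj₁ h = ⊔>-introˡ (A ⊞ X) (⊞-intro A X h x∈)
  ...   | inj₂ h = ⊔>-introʳ (A ⊞ X) (⊞-intro A X h (subst (_∈ X) (lem z g a) x∈))
    where lem : ∀ z g a → z -ᶻ a ≡ (z -ᶻ g) -ᶻ (a -ᶻ g)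
          lem = ℤR.solve-∀

  ⊞-⊔> : ∀ A X g → (A ⊞ X) ⊔> g ⊆ (A ⊔> g) ⊞ X
  ⊞-⊔> A X g {z} m with ⊔>-elim (A ⊞ X) {g} {z} m
  ... | inj₁ h = ⊞-mono A (A ⊔> g) X (⊔>-introˡ A) h
  ... | inj₂ h with ⊞-elim A X h
  ...   | a , a∈ , x∈ = ⊞-intro (A ⊔> g) X {a +ᶻ g} (⊔>-introʳ A (subst (_∈ A) (sym (x+g-g a g)) a∈)) (subst (_∈ X) (lem z g a) x∈)
    where lem : ∀ z g a → (z -ᶻ g) -ᶻ a ≡ z -ᶻ (a +ᶻ g)
          lem = ℤR.solve-∀

  -- Translation commutes with the sumset, so the g-ends of A + X measure the cost of enlarging A to
  -- A ∪ (A + g).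
  card-⊔>-⊞ : ∀ A X g → card ((A ⊔> g) ⊞ X) ≡ card (A ⊞ X) + card (E g (A ⊞ X))
  card-⊔>-⊞ A X g = trans (card-ext ((A ⊔> g) ⊞ X) ((A ⊞ X) ⊔> g) (⊔>-⊞ A X g) (⊞-⊔> A X g)) (card-⊔> (A ⊞ X) g)

  ⊓>-⊞ : ∀ A X g → (A ⊓> g) ⊞ X ⊆ (A ⊞ X) ⊓> g
  ⊓>-⊞ A X g {z} m with ⊞-elim (A ⊓> g) X m
  ... | a , a∈ , x∈ with ⊓>-elim A {g} {a} a∈
  ...   | h , k = ⊓>-intro (A ⊞ X) (⊞-intro A X h x∈) (⊞-intro A X k (subst (_∈ X) (lem z g a) x∈))
    where lem : ∀ z g a → z -ᶻ a ≡ (z -ᶻ g) -ᶻ (a -ᶻ g)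
          lem = ℤR.solve-∀

  -- Submodularity of S ↦ |S + X| applied to A and A + g.
  E-⊞-bound : ∀ A X g → card (E g (A ⊞ X)) + card ((A ⊓> g) ⊞ X) ≤ card (A ⊞ X)
  E-⊞-bound A X g = ≤-trans (+-monoʳ-≤ (card (E g (A ⊞ X))) (card-mono ((A ⊓> g) ⊞ X) ((A ⊞ X) ⊓> g) (⊓>-⊞ A X g)))
    (≤-reflexive (trans (+-comm (card (E g (A ⊞ X))) (card ((A ⊞ X) ⊓> g))) (card-⊓> (A ⊞ X) g)))

  card≤⊞ : ∀ A X → 0 < card X → card A ≤ card (A ⊞ X)
  card≤⊞ A X pos = go (nonempty X pos)
    where
    lem : ∀ z x → z -ᶻ (z -ᶻ x) ≡ x
    lem = ℤR.solve-∀
    go : (∃ λ x → x ∈ X) → card A ≤ card (A ⊞ X)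
    go (x , x∈) = subst (_≤ card (A ⊞ X)) (card-+> A x)
      (card-mono (A +> x) (A ⊞ X) λ {z} h → ⊞-intro A X {z -ᶻ x} (mem (holds h)) (subst (_∈ X) (sym (lem z x)) x∈))

  -- Explicit enumeration of small sets

  record Enum₁ (S : PSet) (x : ℤ) : Set where
    field
      x∈    : x ∈ S
      only  : ∀ {w} → w ∈ S → w ≈ x
      total : wsum S ≈ x

  record Enum₂ (S : PSet) (x y : ℤ) : Set where
    field
      x∈    : x ∈ S
      y∈    : y ∈ S
      x≉y   : x ≉ y
      only  : ∀ {w} → w ∈ S → w ≈ x ⊎ w ≈ y
      total : wsum S ≈ x +ᶻ y

  record Enum₃ (S : PSet) (x y z : ℤ) : Set where
    field
      x∈    : x ∈ S
      y∈    : y ∈ S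
      z∈    : z ∈ S
      x≉y   : x ≉ y
      x≉z   : x ≉ z
      y≉z   : y ≉ z
      only  : ∀ {w} → w ∈ S → w ≈ x ⊎ w ≈ y ⊎ w ≈ z
      total : wsum S ≈ x +ᶻ (y +ᶻ z)

  ≉-sym : ∀ {x y} → x ≉ y → y ≉ x
  ≉-sym n e = n (≈-sym e)

  card-∖-pred : ∀ S {x n} → x ∈ S → card S ≡ suc n → card (S ∖ x) ≡ n
  card-∖-pred S m e = suc-injective (trans (sym (card-∖ S m)) e)

  enum₁ : ∀ S → card S ≡ 1 → ∃ λ x → Enum₁ S x
  enum₁ S e = go (nonempty S (subst (0 <_) (sym e) (s≤s z≤n)))
    where
    go : (∃ λ x → x ∈ S) → ∃ λ x → Enum₁ S x
    go (x , m) = x , record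
      { x∈ = m
      ; only = λ {w} w∈ → only w (w ≈? x) w∈
      ; total = ≈-trans (wsum-∖ S m) (≈-trans (+-cong≈ (≈-refl {x}) (wsum-empty (S ∖ x) (card-∖-pred S m e))) (≡⇒≈ (ℤP.+-identityʳ x))) }
      where
      only : ∀ w → Dec (w ≈ x) → w ∈ S → w ≈ x
      only w (yes h) _ = h
      only w (no h) w∈ = ⊥-elim (card≡0 (S ∖ x) (card-∖-pred S m e) (∖-intro S w∈ h))

  enum₂ : ∀ S {x} → x ∈ S → card S ≡ 2 → ∃ λ y → Enum₂ S x y
  enum₂ S {x} m e = go (enum₁ (S ∖ x) (card-∖-pred S m e))
    where
    go : (∃ λ y → Enum₁ (S ∖ x) y) → ∃ λ y → Enum₂ S x y
    go (y , en) = y , record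
      { x∈ = m
      ; y∈ = proj₁ (∖-elim S (Enum₁.x∈ en))
      ; x≉y = ≉-sym (proj₂ (∖-elim S (Enum₁.x∈ en)))
      ; only = λ {w} w∈ → only w (w ≈? x) w∈
      ; total = ≈-trans (wsum-∖ S m) (+-cong≈ (≈-refl {x}) (Enum₁.total en)) }
      where
      only : ∀ w → Dec (w ≈ x) → w ∈ S → w ≈ x ⊎ w ≈ y
      only w (yes h) _ = inj₁ h
      only w (no h) w∈ = inj₂ (Enum₁.only en (∖-intro S w∈ h))

  enum₃ : ∀ S {x y} → x ∈ S → y ∈ S → x ≉ y → card S ≡ 3 → ∃ λ z → Enum₃ S x y z
  enum₃ S {x} {y} m n x≉y e = go (enum₂ (S ∖ x) (∖-intro S n (≉-sym x≉y)) (card-∖-pred S m e))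
    where
    go : (∃ λ z → Enum₂ (S ∖ x) y z) → ∃ λ z → Enum₃ S x y z
    go (z , en) = z , record
      { x∈ = m
      ; y∈ = n
      ; z∈ = proj₁ (∖-elim S (Enum₂.y∈ en))
      ; x≉y = x≉y
      ; x≉z = ≉-sym (proj₂ (∖-elim S (Enum₂.y∈ en)))
      ; y≉z = Enum₂.x≉y en
      ; only = λ {w} w∈ → only w (w ≈? x) w∈
      ; total = ≈-trans (wsum-∖ S m) (+-cong≈ (≈-refl {x}) (Enum₂.total en)) }
      where
      only : ∀ w → Dec (w ≈ x) → w ∈ S → w ≈ x ⊎ w ≈ y ⊎ w ≈ z
      only w (yes h) _ = inj₁ h
      only w (no h) w∈ = inj₂ (Enum₂.only en (∖-intro S w∈ h))

  two-elements : ∀ S → 2 ≤ card S → ∃ λ x → ∃ λ y → x ∈ S × y ∈ S × x ≉ y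
  two-elements S h = go (nonempty S (≤-trans (s≤s z≤n) h))
    where
    go : (∃ λ x → x ∈ S) → _
    go (x , m) = go′ (nonempty (S ∖ x) (≤-pred (subst (2 ≤_) (card-∖ S m) h)))
      where
      go′ : (∃ λ y → y ∈ S ∖ x) → _
      go′ (y , n) = x , y , m , proj₁ (∖-elim S n) , ≉-sym (proj₂ (∖-elim S n))

  subset-of-size : ∀ S j → j ≤ card S → ∃ λ T → T ⊆ S × card T ≡ j
  subset-of-size S j h = go (card S ∸ j) S (λ m → m) (sym (m+[n∸m]≡n h))
    where
    go : ∀ d U → U ⊆ S → card U ≡ j + d → ∃ λ T → T ⊆ S × card T ≡ j
    go zero    U sub e = U , sub , trans e (+-identityʳ j)
    go (suc d) U sub e = next (nonempty U (subst (0 <_) (sym e′) (s≤s z≤n)))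
      where
      e′ : card U ≡ suc (j + d)
      e′ = trans e (+-suc j d)
      next : (∃ λ x → x ∈ U) → ∃ λ T → T ⊆ S × card T ≡ j
      next (x , m) = go d (U ∖ x) (λ n → sub (proj₁ (∖-elim U n))) (card-∖-pred U m e′)

  -- Second moment of the number of representations z = a + x

  -- This is (r - m)(r - m - 1) ≥ 0, true for integers, written without subtraction.
  square-bound : ∀ m r → suc (2 * m) * r ≤ m * suc m + r * r
  square-bound m r with ≤-total r m
  ... | inj₁ r≤m rewrite sym (m+[n∸m]≡n r≤m) = ≤-trans (m≤m+n _ _) (≤-reflexive (lem r (m ∸ r)))
    where lem : ∀ r d → (1 + 2 * (r + d)) * r + (d * d + d) ≡ (r + d) * (1 + (r + d)) + r * r
          lem = ℕR.solve-∀
  ... | inj₂ m≤r with m≤n⇒m<n∨m≡n m≤r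
  ...   | inj₂ refl = ≤-reflexive (lem m)
    where lem : ∀ r → (1 + 2 * r) * r ≡ r * (1 + r) + r * r
          lem = ℕR.solve-∀
  ...   | inj₁ m<r rewrite sym (m+[n∸m]≡n m<r) = ≤-trans (m≤m+n _ _) (≤-reflexive (lem m (r ∸ suc m)))
    where lem : ∀ m d → (1 + 2 * m) * (1 + m + d) + (d * d + d) ≡ m * (1 + m) + (1 + m + d) * (1 + m + d)
          lem = ℕR.solve-∀

  module Energy (A X : PSet) where

    hit : ℤ → ℤ → ℕ
    hit z a = ind (χ A a ∧ χ X (z -ᶻ a))

    reps : ℤ → ℕ
    reps z = sum p (hit z)

    ind-∧ : ∀ a b → ind (a ∧ b) ≡ ind a * ind b
    ind-∧ true true = refl
    ind-∧ true false = refl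
    ind-∧ false b = refl

    first-moment : sum p reps ≡ card A * card X
    first-moment = trans (sum-swap p p hit) (trans (sum-cong p col) (sum-*ʳ p (card X) (λ a → ind (χ A a))))
      where
      col : ∀ a → sum p (λ z → hit z a) ≡ ind (χ A a) * card X
      col a = trans (sum-cong p (λ z → ind-∧ (χ A a) (χ X (z -ᶻ a)))) (trans (sum-* p (ind (χ A a)) (λ z → ind (χ X (z -ᶻ a)))) (cong (ind (χ A a) *_) (card-+> X a)))

    common : ℤ → ℤ → ℕ
    common a b = sum p (λ z → ind (χ X (z -ᶻ a)) * ind (χ X (z -ᶻ b)))

    sum-product : ∀ m n (f g : ℤ → ℕ) → sum m f * sum n g ≡ sum m (λ x → sum n (λ y → f x * g y))
    sum-product m n f g = trans (sym (sum-*ʳ m (sum n g) f)) (sum-cong m (λ x → sym (sum-* n (f x) g)))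

    -- Both sides count the triples (z, a, b) with a, b ∈ A and z in both X + a and X + b.
    second-moment : sum p (λ z → reps z * reps z) ≡
                    sum p (λ a → sum p (λ b → ind (χ A a) * ind (χ A b) * common a b))
    second-moment = trans (sum-cong p (λ z → sum-product p p (hit z) (hit z)))
      (trans (sum-swap p p (λ z a → sum p (λ b → hit z a * hit z b)))
        (sum-cong p (λ a → trans (sum-swap p p (λ z b → hit z a * hit z b)) (sum-cong p (λ b → cell a b)))))
      where
      lem : ∀ a b x y → (a * x) * (b * y) ≡ (a * b) * (x * y)
      lem = ℕR.solve-∀
      cell : ∀ a b → sum p (λ z → hit z a * hit z b) ≡ ind (χ A a) * ind (χ A b) * common a b
      cell a b = trans (sum-cong p (λ z → trans (cong₂ _*_ (ind-∧ (χ A a) (χ X (z -ᶻ a))) (ind-∧ (χ A b) (χ X (z -ᶻ b))))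
                   (lem (ind (χ A a)) (ind (χ A b)) (ind (χ X (z -ᶻ a))) (ind (χ X (z -ᶻ b))))))
                 (sum-* p (ind (χ A a) * ind (χ A b)) (λ z → ind (χ X (z -ᶻ a)) * ind (χ X (z -ᶻ b))))

    common-≈ : ∀ a b → common a b ≤ card X
    common-≈ a b = ≤-trans (sum-mono p (λ z → pt (χ X (z -ᶻ a)) (χ X (z -ᶻ b)))) (≤-reflexive (card-+> X a))
      where
      pt : ∀ x y → ind x * ind y ≤ ind x
      pt true true = s≤s z≤n
      pt true false = z≤n
      pt false y = z≤n

    common-≉ : ∀ a b → common a b ≡ card (X ⊓> (b -ᶻ a))
    common-≉ a b = trans (sym (sum-shift {λ z → ind (χ X (z -ᶻ a)) * ind (χ X (z -ᶻ b))}
        (λ h → cong₂ _*_ (cong ind (resp X (-‿cong≈ h (≈-refl {a})))) (cong ind (resp X (-‿cong≈ h (≈-refl {b}))))) a))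
      (sum-cong p (λ z → trans (cong₂ (λ u v → ind (χ X u) * ind (χ X v)) (x+g-g z a) (lem z a b)) (sym (ind-∧ (χ X z) (χ X (z -ᶻ (b -ᶻ a)))))))
      where lem : ∀ z a b → (z +ᶻ a) -ᶻ b ≡ z -ᶻ (b -ᶻ a)
            lem = ℤR.solve-∀

    diagonal : sum p (λ a → sum p (λ b → ind (χ A a) * ind (χ A b) * ind ⌊ b ≈? a ⌋)) ≡ card A
    diagonal = sum-cong p (λ a → trans (sum-cong p (pt a)) (trans (sum-* p (ind (χ A a)) (λ b → ind ⌊ b ≈? a ⌋)) (trans (cong (ind (χ A a) *_) (card-⟨⟩ a)) (*-identityʳ _))))
      where
      pt : ∀ a b → ind (χ A a) * ind (χ A b) * ind ⌊ b ≈? a ⌋ ≡ ind (χ A a) * ind ⌊ b ≈? a ⌋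
      pt a b with b ≈? a
      ... | no _ = trans (*-zeroʳ (ind (χ A a) * ind (χ A b))) (sym (*-zeroʳ (ind (χ A a))))
      ... | yes e rewrite resp A e with χ A a
      ...   | true = refl
      ...   | false = refl

    double-sum-* : ∀ c (f : ℤ → ℤ → ℕ) → sum p (λ a → sum p (λ b → f a b * c)) ≡ sum p (λ a → sum p (f a)) * c
    double-sum-* c f = trans (sum-cong p (λ a → sum-*ʳ p c (f a))) (sum-*ʳ p c (λ a → sum p (f a)))

    double-sum-+ : ∀ (f g : ℤ → ℤ → ℕ) → sum p (λ a → sum p (λ b → f a b + g a b)) ≡ sum p (λ a → sum p (f a)) + sum p (λ a → sum p (g a))
    double-sum-+ f g = trans (sum-cong p (λ a → sum-+ p (f a) (g a))) (sum-+ p (λ a → sum p (f a)) (λ a → sum p (g a)))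

    -- The |A| diagonal pairs contribute at most |X| each, the others at most `o`; the term
    -- `card A * o` on the left stands for the diagonal pairs that the right side counts with weight
    -- `o` as well.
    second-moment-bound : ∀ o → (∀ g → g ≉ + 0 → card (X ⊓> g) ≤ o) →
      sum p (λ z → reps z * reps z) + card A * o ≤ card A * card A * o + card A * card X
    second-moment-bound o h = begin
      sum p (λ z → reps z * reps z) + card A * o
        ≡⟨ cong₂ _+_ second-moment (trans (cong (_* o) (sym diagonal)) (sym (double-sum-* o (λ a b → w a b * δ a b)))) ⟩
      sum p (λ a → sum p (λ b → w a b * common a b)) + sum p (λ a → sum p (λ b → w a b * δ a b * o))
        ≡⟨ sym (double-sum-+ _ _) ⟩
      sum p (λ a → sum p (λ b → w a b * common a b + w a b * δ a b * o))
        ≤⟨ sum-mono p (λ a → sum-mono p (λ b → pt a b)) ⟩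
      sum p (λ a → sum p (λ b → w a b * o + w a b * δ a b * card X))
        ≡⟨ double-sum-+ _ _ ⟩
      sum p (λ a → sum p (λ b → w a b * o)) + sum p (λ a → sum p (λ b → w a b * δ a b * card X))
        ≡⟨ cong₂ _+_ (trans (double-sum-* o w) (cong (_* o) (sym (sum-product p p (λ a → ind (χ A a)) (λ b → ind (χ A b))))))
                     (trans (double-sum-* (card X) (λ a b → w a b * δ a b)) (cong (_* card X) diagonal)) ⟩
      card A * card A * o + card A * card X ∎
      where
      open ≤-Reasoning
      w δ : ℤ → ℤ → ℕ
      w a b = ind (χ A a) * ind (χ A b)
      δ a b = ind ⌊ b ≈? a ⌋
      lem₀ : ∀ w c o x → w * c + w * 0 * o ≡ w * c
      lem₀ = ℕR.solve-∀
      lem₀′ : ∀ w o x → w * o + w * 0 * x ≡ w * o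
      lem₀′ = ℕR.solve-∀
      lem₁ : ∀ w c o → w * c + w * 1 * o ≡ w * o + w * 1 * c
      lem₁ = ℕR.solve-∀
      lem : ∀ a b → b ≉ a → b -ᶻ a ≉ + 0
      lem a b n e = n (combine₁ (+ 1) e (eq a b))
        where eq : ∀ a b → b -ᶻ a ≡ + 1 *ᶻ ((b -ᶻ a) -ᶻ + 0)
              eq = ℤR.solve-∀
      pt : ∀ a b → w a b * common a b + w a b * δ a b * o ≤ w a b * o + w a b * δ a b * card X
      pt a b with b ≈? a
      ... | yes e = subst (_≤ w a b * o + w a b * 1 * card X) (sym (lem₁ (w a b) (common a b) o)) (+-monoʳ-≤ (w a b * o) (*-monoʳ-≤ (w a b * 1) (common-≈ a b)))
      ... | no n = subst₂ _≤_ (sym (lem₀ (w a b) (common a b) o 0)) (sym (lem₀′ (w a b) o (card X)))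
                     (*-monoʳ-≤ (w a b) (subst (_≤ o) (sym (common-≉ a b)) (h (b -ᶻ a) (lem a b n))))

    reps-bound : ∀ m z → suc (2 * m) * reps z ≤ ind (χ (A ⊞ X) z) * (m * suc m) + reps z * reps z
    reps-bound m z with member? z (A ⊞ X)
    ... | inj₁ (mem e) rewrite e = subst (λ k → suc (2 * m) * reps z ≤ k + reps z * reps z) (sym (+-identityʳ (m * suc m))) (square-bound m (reps z))
    ... | inj₂ z∉@(nonmem e) rewrite e = subst (λ k → suc (2 * m) * k ≤ k * k) (sym reps≡0) (≤-reflexive (*-zeroʳ (suc (2 * m))))
      where
      reps≡0 : reps z ≡ 0
      reps≡0 = trans (sum-cong p (λ a → cong ind (bool-ext (λ h → let (u , v) = ∧-true {χ A a} h in ∈∉-⊥ (⊞-intro A X (mem u) (mem v)) z∉) λ ()))) (sum-0 p)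

    -- Sum `square-bound`, which is sharp at r = m and r = m + 1, over A + X. For m = 1 the result
    -- is Bonferroni's inequality |A + X| ≥ |A| |X| - o |A| (|A| - 1) / 2.
    sumset-bound : ∀ m o → (∀ g → g ≉ + 0 → card (X ⊓> g) ≤ o) →
      suc (2 * m) * (card A * card X) + card A * o ≤ m * suc m * card (A ⊞ X) + (card A * card A * o + card A * card X)
    sumset-bound m o h = begin
      suc (2 * m) * (card A * card X) + card A * o
        ≡⟨ cong (λ k → suc (2 * m) * k + card A * o) (sym first-moment) ⟩
      suc (2 * m) * sum p reps + card A * o
        ≡⟨ cong (_+ card A * o) (sym (sum-* p (suc (2 * m)) reps)) ⟩
      sum p (λ z → suc (2 * m) * reps z) + card A * o
        ≤⟨ +-monoˡ-≤ (card A * o) (sum-mono p (reps-bound m)) ⟩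
      sum p (λ z → ind (χ (A ⊞ X) z) * (m * suc m) + reps z * reps z) + card A * o
        ≡⟨ cong (_+ card A * o) (trans (sum-+ p (λ z → ind (χ (A ⊞ X) z) * (m * suc m)) (λ z → reps z * reps z))
             (cong (_+ sum p (λ z → reps z * reps z)) (trans (sum-*ʳ p (m * suc m) (λ z → ind (χ (A ⊞ X) z))) (*-comm (card (A ⊞ X)) (m * suc m))))) ⟩
      m * suc m * card (A ⊞ X) + sum p (λ z → reps z * reps z) + card A * o
        ≡⟨ +-assoc (m * suc m * card (A ⊞ X)) (sum p (λ z → reps z * reps z)) (card A * o) ⟩
      m * suc m * card (A ⊞ X) + (sum p (λ z → reps z * reps z) + card A * o)
        ≤⟨ +-monoʳ-≤ (m * suc m * card (A ⊞ X)) (second-moment-bound o h) ⟩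
      m * suc m * card (A ⊞ X) + (card A * card A * o + card A * card X) ∎
      where open ≤-Reasoning

  open Energy public using (sumset-bound)

  -- Atoms

  -- `minimal` and `least` compare the excesses |S + X| - |S| with the negative terms moved across,
  -- which makes them summands for linear arithmetic and avoids κ.
  record Atom (k : ℕ) (X A : PSet) : Set where
    field
      size       : k ≤ card A
      room       : card (A ⊞ X) + k ≤ p
      minimal    : ∀ T → k ≤ card T → card (T ⊞ X) + k ≤ p →
                   card (A ⊞ X) + card T ≤ card (T ⊞ X) + card A
      least      : ∀ T → k ≤ card T → card (T ⊞ X) + k ≤ p →
                   card (T ⊞ X) + card A ≤ card (A ⊞ X) + card T → card A ≤ card T

  sum-front : ∀ n (f : ℤ → ℕ) → sum (suc n) f ≡ f (+ 0) + sum n (λ x → f (x +ᶻ + 1))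
  sum-front n f = trans (+-comm (f (+ n)) (sum n f)) (trans (sym (sum-step n f)) (+-comm _ (f (+ 0))))

  sum-reverse : ∀ n (f : ℤ → ℕ) → sum (suc n) (λ x → f (+ n -ᶻ x)) ≡ sum (suc n) f
  sum-reverse zero    f = refl
  sum-reverse (suc n) f = trans (sum-front (suc n) (λ x → f (+ suc n -ᶻ x)))
    (cong₂ _+_ (cong f (ℤP.+-identityʳ (+ suc n)))
               (trans (sum-cong (suc n) (λ x → cong f (lem (+ n) x))) (sum-reverse n f)))
    where lem : ∀ n x → (+ 1 +ᶻ n) -ᶻ (x +ᶻ + 1) ≡ n -ᶻ x
          lem = ℤR.solve-∀

  sum-neg : ∀ {f} → Periodic f → sum p (λ x → f (-ᶻ x)) ≡ sum p f
  sum-neg {f} per = go p refl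
    where
    lem : ∀ n x → (-ᶻ x) ≡ ((n -ᶻ x) +ᶻ + 1) -ᶻ (+ 1 +ᶻ n)
    lem = ℤR.solve-∀
    lem′ : ∀ a b → (a -ᶻ b) -ᶻ a ≡ ℤ.-1ℤ *ᶻ b
    lem′ = ℤR.solve-∀
    go : ∀ q → q ≡ p → sum p (λ x → f (-ᶻ x)) ≡ sum p f
    go zero    e = ⊥-elim (n≮0 (subst (1 <_) (sym e) 1<p))
    go (suc n) e = trans (sum-cong p (λ x → per (≈-trans (≡⇒≈ (lem (+ n) x)) (≈-by ℤ.-1ℤ (trans (lem′ ((+ n -ᶻ x) +ᶻ + 1) (+ suc n)) (cong (λ m → ℤ.-1ℤ *ᶻ + m) e))))))
      (trans (subst (λ m → sum m (λ x → f ((+ n -ᶻ x) +ᶻ + 1)) ≡ sum m (λ x → f (x +ᶻ + 1))) e (sum-reverse n (λ x → f (x +ᶻ + 1))))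
             (sum-shift-suc per))

  neg-cong : ∀ {x y} → x ≈ y → -ᶻ x ≈ -ᶻ y
  neg-cong {x} {y} h = combine₁ ℤ.-1ℤ h (lem x y)
    where lem : ∀ x y → (-ᶻ x) -ᶻ (-ᶻ y) ≡ ℤ.-1ℤ *ᶻ (x -ᶻ y)
          lem = ℤR.solve-∀

  reflect : PSet → PSet
  reflect S = record { χ = λ x → χ S (-ᶻ x) ; resp = λ h → resp S (neg-cong h) }

  card-reflect : ∀ S → card (reflect S) ≡ card S
  card-reflect S = sum-neg (χ-periodic S)

  ∁-elim : ∀ S {x} → x ∈ ∁ S → x ∉ S
  ∁-elim S (mem e) = nonmem (not-true e)

  -- Taking for `β` the first summand of one representation of z yields a second representation.
  Double : PSet → PSet → Set
  Double A X = ∀ {z} β → z ∈ A ⊞ X → ∃ λ α → α ∈ A × α ≉ β × z -ᶻ α ∈ X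

  module AtomProperties {k X A} (atom : Atom k X A) (0<k : 0 < k) (X≠∅ : 0 < card X) where
    open Atom atom

    private
      Z = A ⊞ X

    A≤Z : card A ≤ card Z
    A≤Z = card≤⊞ A X X≠∅

    0<A : 0 < card A
    0<A = ≤-trans 0<k size

    A<p : card A < p
    A<p = ≤-trans (≤-trans (≤-reflexive (sym (+-comm (card A) 1))) (+-mono-≤ A≤Z 0<k)) room

    -- The reflected complement of A + X competes with A.
    dual : card A + card Z ≤ p
    dual = ≤-trans (+-monoˡ-≤ (card Z) A≤Zᶜ) (≤-reflexive Zᶜ+Z)
      where
      Zᶜ : PSet
      Zᶜ = reflect (∁ Z)
      Zᶜ+Z : card Zᶜ + card Z ≡ p
      Zᶜ+Z = trans (cong (_+ card Z) (card-reflect (∁ Z))) (trans (+-comm (card (∁ Z)) (card Z)) (card-∁ Z))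
      lem : ∀ z t → (-ᶻ t) -ᶻ (-ᶻ z) ≡ z -ᶻ t
      lem = ℤR.solve-∀
      Zᶜ⊞X⊆ : Zᶜ ⊞ X ⊆ reflect (∁ A)
      Zᶜ⊞X⊆ {z} m with ⊞-elim Zᶜ X m
      ... | t , t∈ , x∈ with member? (-ᶻ z) A
      ...   | inj₂ (nonmem n) = mem (cong not n)
      ...   | inj₁ y = ∈∉-⊥ (⊞-intro A X y (subst (_∈ X) (sym (lem z t)) x∈)) (∁-elim Z {(-ᶻ t)} (mem (holds t∈)))
      Zᶜ⊞X+A≤p : card (Zᶜ ⊞ X) + card A ≤ p
      Zᶜ⊞X+A≤p = ≤-trans (+-monoˡ-≤ (card A) (card-mono (Zᶜ ⊞ X) (reflect (∁ A)) Zᶜ⊞X⊆))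
        (≤-reflexive (trans (cong (_+ card A) (card-reflect (∁ A))) (trans (+-comm (card (∁ A)) (card A)) (card-∁ A))))
      A≤Zᶜ : card A ≤ card Zᶜ
      A≤Zᶜ = least Zᶜ (+-cancelˡ-≤ (card Z) k (card Zᶜ) (≤-trans room (≤-reflexive (trans (sym Zᶜ+Z) (+-comm (card Zᶜ) (card Z))))))
                    (≤-trans (+-monoʳ-≤ (card (Zᶜ ⊞ X)) size) Zᶜ⊞X+A≤p)
                    (≤-trans Zᶜ⊞X+A≤p (≤-reflexive (trans (sym Zᶜ+Z) (+-comm (card Zᶜ) (card Z)))))

    strict : ∀ C → k ≤ card C → card (C ⊞ X) + k ≤ p → card C < card A →
             card Z + card C < card (C ⊞ X) + card A
    strict C kC roomC C<A = ≤∧≢⇒< (minimal C kC roomC) λ e → <⇒≱ C<A (least C kC roomC (≤-reflexive (sym e)))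

    ⊓>-room : ∀ C → C ⊆ A → card (C ⊞ X) + k ≤ p
    ⊓>-room C sub = ≤-trans (+-monoˡ-≤ k (card-mono (C ⊞ X) Z (⊞-mono C A X sub))) room

    -- A ∪ (A + g) competes with A: it gains the g-ends of A, its sumset those of A + X.
    growth : ∀ g → card Z + card (E g Z) + k ≤ p → card (E g A) ≤ card (E g Z)
    growth g h = ≤-shift (card Z + card A)
      (minimal (A ⊔> g) (≤-trans size (card-mono A (A ⊔> g) (⊔>-introˡ A))) (subst (λ c → c + k ≤ p) (sym (card-⊔>-⊞ A X g)) h))
      (trans (cong₂ _+_ (refl {x = card Z}) (card-⊔> A g)) (lem₁ (card Z) (card A) (card (E g A))))
      (trans (cong (_+ card A) (card-⊔>-⊞ A X g)) (lem₂ (card Z) (card A) (card (E g Z))))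
      where
      lem₁ : ∀ z a s → z + (a + s) ≡ s + (z + a)
      lem₁ = ℕR.solve-∀
      lem₂ : ∀ z a u → z + u + a ≡ u + (z + a)
      lem₂ = ℕR.solve-∀

    -- If A ∪ (A + g) is too large to compete, then A + X has so many g-ends that the inequality
    -- holds anyway.
    growth′ : ∀ g → card Z + card (E g A) + k ≤ suc p → card (E g A) ≤ card (E g Z)
    growth′ g h with card Z + card (E g Z) + k ≤? p
    ... | yes r = growth g r
    ... | no ¬r = ≤-shift (card Z + k) (≤-trans h (≰⇒> ¬r)) (lem (card Z) (card (E g A)) k) (lem (card Z) (card (E g Z)) k)
      where
      lem : ∀ z s k → z + s + k ≡ s + (z + k)
      lem = ℕR.solve-∀

    -- If A ∩ (A + g) had k elements, its excess would be strictly larger than that of A, and by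
    -- submodularity the excess of A ∪ (A + g) strictly smaller. `dual` ensures that the union
    -- leaves enough room to compete.
    overlap-bound : ∀ g → g ≉ + 0 → card (A ⊓> g) < k
    overlap-bound g g≉0 = ≰⇒> λ k≤C → absurd-≤ 0
        (st k≤C ⊞≤ E-⊞-bound A X g ⊞≤ mn k≤C ⊞≤ ≤-reflexive (sym (card-⊓> A g)))
        (lem (card Z) (card C) (card (E g Z)) (card (C ⊞ X)) (card A) (card (E g A)))
      where
      C = A ⊓> g
      C⊆A : C ⊆ A
      C⊆A m = proj₁ (⊓>-elim A m)
      roomC = ⊓>-room C C⊆A
      C<A : card C < card A
      C<A = ≤-trans (≤-trans (≤-reflexive (sym (+-comm (card C) 1))) (+-monoʳ-≤ (card C) (E-pos A g≉0 0<A A<p))) (≤-reflexive (card-⊓> A g))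
      st : k ≤ card C → card Z + card C < card (C ⊞ X) + card A
      st k≤C = strict C k≤C roomC C<A
      mn : k ≤ card C → card Z + (card A + card (E g A)) ≤ card Z + card (E g Z) + card A
      mn k≤C = subst₂ _≤_ (cong₂ _+_ (refl {x = card Z}) (card-⊔> A g)) (cong (_+ card A) (card-⊔>-⊞ A X g))
        (minimal (A ⊔> g) (≤-trans size (card-mono A (A ⊔> g) (⊔>-introˡ A))) (subst (λ c → c + k ≤ p) (sym (card-⊔>-⊞ A X g))
          (<⇒≤ (≤-shift (card C + card (C ⊞ X) + card A + card Z)
            (st k≤C ⊞≤ E-⊞-bound A X g ⊞≤ dual ⊞≤ k≤C)
            (lem₁ (card Z) (card C) (card (E g Z)) (card (C ⊞ X)) (card A) k) (lem₂ (card Z) (card C) (card (C ⊞ X)) (card A) p)))))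
        where
        lem₁ : ∀ z c u d a k → suc (z + c) + (u + d) + (a + z) + k ≡ suc (z + u + k) + (c + d + a + z)
        lem₁ = ℕR.solve-∀
        lem₂ : ∀ z c d a q → d + a + z + q + c ≡ q + (c + d + a + z)
        lem₂ = ℕR.solve-∀
      lem : ∀ z c u d a s → suc (z + c) + (u + d) + (z + (a + s)) + a ≡ suc (d + a + z + (z + u + a) + (c + s))
      lem = ℕR.solve-∀

    -- Deleting β leaves a competitor with at least k elements, and its strictly larger excess
    -- forces its sumset to be all of A + X.
    double : k < card A → Double A X
    double k<A {z} β m = go (member? β A)
      where
      direct : β ∉ A → ∃ λ α → α ∈ A × α ≉ β × z -ᶻ α ∈ X
      direct n with ⊞-elim A X m
      ... | α , α∈ , x∈ = α , α∈ , (λ e → ∈∉-⊥ (∈-resp A e α∈) n) , x∈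
      go : β ∈ A ⊎ β ∉ A → ∃ λ α → α ∈ A × α ≉ β × z -ᶻ α ∈ X
      go (inj₂ n) = direct n
      go (inj₁ b) = finish (⊞-elim A′ X (full m))
        where
        A′ = A ∖ β
        sub : A′ ⊆ A
        sub h = proj₁ (∖-elim A h)
        k≤A′ : k ≤ card A′
        k≤A′ = ≤-pred (≤-trans k<A (≤-reflexive (card-∖ A b)))
        Z≤ : card Z ≤ card (A′ ⊞ X)
        Z≤ = ≤-shift (suc (card A′)) (strict A′ k≤A′ (⊓>-room A′ sub) (≤-reflexive (sym (card-∖ A b))))
               (sym (+-suc (card Z) (card A′))) (cong₂ _+_ (refl {x = card (A′ ⊞ X)}) (card-∖ A b))
        full : Z ⊆ A′ ⊞ X
        full = ⊆-card≥ (A′ ⊞ X) Z (⊞-mono A′ A X sub) Z≤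
        finish : (∃ λ α → α ∈ A′ × z -ᶻ α ∈ X) → ∃ λ α → α ∈ A × α ≉ β × z -ᶻ α ∈ X
        finish (α , α∈ , x∈) = α , proj₁ (∖-elim A α∈) , proj₂ (∖-elim A α∈) , x∈

  -- Endpoints of a sumset

  E-⊞-elim : ∀ A X {g z α} → z ∈ E g (A ⊞ X) → α ∈ A → z -ᶻ α ∈ X → α ∈ E g A × z -ᶻ α ∈ E g X
  E-⊞-elim A X {g} {z} {α} m α∈ x∈ = E-intro A α∈ (not-A (member? (α +ᶻ g) A)) , E-intro X x∈ (not-X (member? ((z -ᶻ α) +ᶻ g) X))
    where
    z+g∉ = proj₂ (E-elim (A ⊞ X) m)
    lem₁ : ∀ z α g → (z +ᶻ g) -ᶻ (α +ᶻ g) ≡ z -ᶻ α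
    lem₁ = ℤR.solve-∀
    lem₂ : ∀ z α g → (z +ᶻ g) -ᶻ α ≡ (z -ᶻ α) +ᶻ g
    lem₂ = ℤR.solve-∀
    not-A : α +ᶻ g ∈ A ⊎ α +ᶻ g ∉ A → α +ᶻ g ∉ A
    not-A (inj₂ n) = n
    not-A (inj₁ h) = ∈∉-⊥ (⊞-intro A X h (subst (_∈ X) (sym (lem₁ z α g)) x∈)) z+g∉
    not-X : (z -ᶻ α) +ᶻ g ∈ X ⊎ (z -ᶻ α) +ᶻ g ∉ X → (z -ᶻ α) +ᶻ g ∉ X
    not-X (inj₂ n) = n
    not-X (inj₁ h) = ∈∉-⊥ (⊞-intro A X α∈ (subst (_∈ X) (sym (lem₂ z α g)) h)) z+g∉

  record TwoReps (K V : PSet) (z : ℤ) : Set where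
    constructor twoReps
    field
      {α β} : ℤ
      α≉β  : α ≉ β
      α∈   : α ∈ K
      β∈   : β ∈ K
      z-α∈ : z -ᶻ α ∈ V
      z-β∈ : z -ᶻ β ∈ V

  endpoint-reps : ∀ A X → Double A X → ∀ {g z} → z ∈ E g (A ⊞ X) → TwoReps (E g A) (E g X) z
  endpoint-reps A X dbl {g} {z} m = go (⊞-elim A X (proj₁ (E-elim (A ⊞ X) m)))
    where
    go : (∃ λ α → α ∈ A × z -ᶻ α ∈ X) → TwoReps (E g A) (E g X) z
    go (α , α∈ , x∈) = go′ (dbl α (proj₁ (E-elim (A ⊞ X) m)))
      where
      go′ : (∃ λ β → β ∈ A × β ≉ α × z -ᶻ β ∈ X) → TwoReps (E g A) (E g X) z
      go′ (β , β∈ , β≉α , y∈) = twoReps (≉-sym β≉α) (proj₁ r) (proj₁ r′) (proj₂ r) (proj₂ r′)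
        where
        r  = E-⊞-elim A X m α∈ x∈
        r′ = E-⊞-elim A X m β∈ y∈

  sub-cancel : ∀ z {α β} → z -ᶻ α ≈ z -ᶻ β → α ≈ β
  sub-cancel z {α} {β} h = combine₁ ℤ.-1ℤ h (lem z α β)
    where lem : ∀ z α β → α -ᶻ β ≡ ℤ.-1ℤ *ᶻ ((z -ᶻ α) -ᶻ (z -ᶻ β))
          lem = ℤR.solve-∀

  sub-flip : ∀ z {α v} → z -ᶻ α ≈ v → α ≈ z -ᶻ v
  sub-flip z {α} {v} h = combine₁ ℤ.-1ℤ h (lem z α v)
    where lem : ∀ z α v → α -ᶻ (z -ᶻ v) ≡ ℤ.-1ℤ *ᶻ ((z -ᶻ α) -ᶻ v)
          lem = ℤR.solve-∀

  translate-eq : ∀ S {d} → d ≉ + 0 → 0 < card S → card S < p → (∀ {x} → x ∈ S → x +ᶻ d ∈ S) → ⊥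
  translate-eq S {d} d≉0 l u h = <-irrefl (sym empty) (E-pos S d≉0 l u)
    where
    empty : card (E d S) ≡ 0
    empty = n≤0⇒n≡0 (≤-trans (sum-mono p (λ x → ind-mono {b = false} λ e →
              ∈∉-⊥ (h (proj₁ (E-elim S (mem {x} e)))) (proj₂ (E-elim {d} S (mem {x} e))))) (≤-reflexive (sum-0 p)))

  -- With fewer than two ends in X, two representations of z coincide or do not exist. With exactly
  -- two, v and v′, the ends F of A + X lie in both K + v and K + v′; since |F| ≥ |K|, F equals K +
  -- v, and K would be stable under translation by v - v′.
  three-endpoints : ∀ A X g → g ≉ + 0 → Double A X → card (E g A) ≤ card (E g (A ⊞ X)) →
                    0 < card (E g A) → card (E g A) < p → 3 ≤ card (E g X)
  three-endpoints A X g g≉0 dbl s≤u 0<s s<p = go (card (E g X)) refl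
    where
    K = E g A
    V = E g X
    F = E g (A ⊞ X)
    reps : ∀ {z} → z ∈ F → TwoReps K V z
    reps = endpoint-reps A X dbl
    inhabited : ∃ λ z → z ∈ F
    inhabited = nonempty F (≤-trans 0<s s≤u)
    not-one : (∃ λ v → Enum₁ V v) → (∃ λ z → z ∈ F) → ⊥
    not-one (v , en) (z , m) = α≉β (sub-cancel z (≈-trans (Enum₁.only en z-α∈) (≈-sym (Enum₁.only en z-β∈))))
      where open TwoReps (reps m)
    not-two : ∀ {v v′} → Enum₂ V v v′ → ⊥
    not-two {v} {v′} en = translate-eq K {v -ᶻ v′} d≉0 0<s s<p closed
      where
      d≉0 : v -ᶻ v′ ≉ + 0
      d≉0 h = Enum₂.x≉y en (combine₁ (+ 1) h (lem v v′))
        where lem : ∀ v w → v -ᶻ w ≡ + 1 *ᶻ ((v -ᶻ w) -ᶻ + 0)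
              lem = ℤR.solve-∀
      both : ∀ {z} → z ∈ F → z -ᶻ v ∈ K × z -ᶻ v′ ∈ K
      both {z} m = pick (Enum₂.only en z-α∈) (Enum₂.only en z-β∈)
        where
        open TwoReps (reps m)
        pick : (z -ᶻ α ≈ v ⊎ z -ᶻ α ≈ v′) → (z -ᶻ β ≈ v ⊎ z -ᶻ β ≈ v′) → z -ᶻ v ∈ K × z -ᶻ v′ ∈ K
        pick (inj₁ a) (inj₂ b) = ∈-resp K (sub-flip z a) α∈ , ∈-resp K (sub-flip z b) β∈
        pick (inj₂ a) (inj₁ b) = ∈-resp K (sub-flip z b) β∈ , ∈-resp K (sub-flip z a) α∈
        pick (inj₁ a) (inj₁ b) = ⊥-elim (α≉β (sub-cancel z (≈-trans a (≈-sym b))))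
        pick (inj₂ a) (inj₂ b) = ⊥-elim (α≉β (sub-cancel z (≈-trans a (≈-sym b))))
      K+v⊆F : K +> v ⊆ F
      K+v⊆F = ⊆-card≥ F (K +> v) (λ m → mem (holds (proj₁ (both m)))) (≤-trans (≤-reflexive (card-+> K v)) s≤u)
      closed : ∀ {x} → x ∈ K → x +ᶻ (v -ᶻ v′) ∈ K
      closed {x} m = subst (_∈ K) (lem x v v′) (proj₂ (both (K+v⊆F {x +ᶻ v} (mem (holds (subst (_∈ K) (sym (x+g-g x v)) m))))))
        where lem : ∀ x v w → (x +ᶻ v) -ᶻ w ≡ x +ᶻ (v -ᶻ w)
              lem = ℤR.solve-∀
    go : ∀ t → card V ≡ t → 3 ≤ t
    go 0 e = ⊥-elim (card≡0 V e (TwoReps.z-α∈ (reps (proj₂ inhabited))))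
    go 1 e = ⊥-elim (not-one (enum₁ V e) inhabited)
    go 2 e = ⊥-elim (not-two (proj₂ (enum₂ V (proj₂ (nonempty V (subst (0 <_) (sym e) (s≤s z≤n)))) e)))
    go (suc (suc (suc t))) e = s≤s (s≤s (s≤s z≤n))

  sub≈0 : ∀ {x y} → x -ᶻ y ≈ + 0 → x ≈ y
  sub≈0 {x} {y} h = combine₁ (+ 1) h (lem x y)
    where lem : ∀ x y → x -ᶻ y ≡ + 1 *ᶻ ((x -ᶻ y) -ᶻ + 0)
          lem = ℤR.solve-∀

  sub≉0 : ∀ {x y} → x ≉ y → x -ᶻ y ≉ + 0
  sub≉0 n h = n (sub≈0 h)

  infixr 6 _⊹_
  _⊹_ : ∀ {x y x′ y′} → x ≈ y → x′ ≈ y′ → x +ᶻ x′ ≈ y +ᶻ y′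
  _⊹_ = +-cong≈

  infixr 7 _·≈_
  _·≈_ : ∀ c {x y} → x ≈ y → c *ᶻ x ≈ c *ᶻ y
  _·≈_ = *-congˡ≈

  module TwoColumns (K V F : PSet) {k l} (enK : Enum₂ K k l) (reps : ∀ {z} → z ∈ F → TwoReps K V z) where

    d : ℤ
    d = l -ᶻ k

    d≉0 : d ≉ + 0
    d≉0 = sub≉0 (≉-sym (Enum₂.x≉y enK))

    both : ∀ {z} → z ∈ F → z -ᶻ k ∈ V × z -ᶻ l ∈ V
    both {z} m = pick (Enum₂.only enK α∈) (Enum₂.only enK β∈)
      where
      open TwoReps (reps m)
      at : ∀ {α c} → α ≈ c → z -ᶻ α ∈ V → z -ᶻ c ∈ V
      at {α} {c} e h = ∈-resp V {z -ᶻ α} {z -ᶻ c} (-‿cong≈ (≈-refl {z}) e) h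
      pick : (α ≈ k ⊎ α ≈ l) → (β ≈ k ⊎ β ≈ l) → z -ᶻ k ∈ V × z -ᶻ l ∈ V
      pick (inj₁ a) (inj₂ b) = at a z-α∈ , at b z-β∈
      pick (inj₂ a) (inj₁ b) = at b z-β∈ , at a z-α∈
      pick (inj₁ a) (inj₁ b) = ⊥-elim (α≉β (≈-trans a (≈-sym b)))
      pick (inj₂ a) (inj₂ b) = ⊥-elim (α≉β (≈-trans a (≈-sym b)))

    -- Each z in F uses both k and l, so F - k lies in V ∩ (V + d), which misses the d-ends of V.
    fewer : 0 < card V → card V < p → card F < card V
    fewer 0<V V<p = ≤-trans (≤-reflexive (+-comm 1 (card F)))
        (≤-trans (+-mono-≤ F≤V⊓ (E-pos V d≉0 0<V V<p)) (≤-reflexive (card-⊓> V d)))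
      where
      lem : ∀ z k l → z -ᶻ l ≡ (z -ᶻ k) -ᶻ (l -ᶻ k)
      lem = ℤR.solve-∀
      F≤V⊓ : card F ≤ card (V ⊓> d)
      F≤V⊓ = ≤-trans (card-mono F ((V ⊓> d) +> k) λ {z} m → mem (holds (⊓>-intro V {d} {z -ᶻ k} (proj₁ (both m)) (subst (_∈ V) (lem z k l) (proj₂ (both m))))))
        (≤-reflexive (card-+> (V ⊓> d) k))

  -- If |K| = 2 and |V| = 3, two elements of F force V to be an arithmetic
  -- progression whose difference is that of K; this locates the barycentre of F.
  two-three : ∀ K V F → 5 < p → card K ≡ 2 → card V ≡ 3 → 2 ≤ card F → (∀ {z} → z ∈ F → TwoReps K V z) →
              card F ≡ 2 × + 3 *ᶻ wsum F ≈ + 3 *ᶻ wsum K +ᶻ + 2 *ᶻ wsum V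
  two-three K V F 5<p cK cV cF reps = start (nonempty K (subst (0 <_) (sym cK) (s≤s z≤n)))
    where
    Goal = card F ≡ 2 × + 3 *ᶻ wsum F ≈ + 3 *ᶻ wsum K +ᶻ + 2 *ᶻ wsum V
    module _ {k l} (enK : Enum₂ K k l) where
      open TwoColumns K V F enK reps
      2d≉0 : + 2 *ᶻ d ≉ + 0
      2d≉0 h = d≉0 (cancel≈ 2 (s≤s z≤n) (≤-trans (s≤s (s≤s (s≤s z≤n))) 5<p) h)
      F≡2 : card F ≡ 2
      F≡2 = ≤-antisym (≤-pred (subst (card F <_) cV (fewer (subst (0 <_) (sym cV) (s≤s z≤n))
              (subst (_< p) (sym cV) (≤-trans (s≤s (s≤s (s≤s (s≤s z≤n)))) 5<p))))) cF
      module _ {x y} (enF : Enum₂ F x y) where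
        x-k≉x-l : x -ᶻ k ≉ x -ᶻ l
        x-k≉x-l h = Enum₂.x≉y enK (sub-cancel x h)
        y-k≉x-k : y -ᶻ k ≉ x -ᶻ k
        y-k≉x-k h = Enum₂.x≉y enF (≈-sym (combine₁ (+ 1) h (lem x y k)))
          where lem : ∀ x y k → y -ᶻ x ≡ + 1 *ᶻ ((y -ᶻ k) -ᶻ (x -ᶻ k))
                lem = ℤR.solve-∀
        Sum : Set
        Sum = + 3 *ᶻ (x +ᶻ y) ≈ + 3 *ᶻ (k +ᶻ l) +ᶻ + 2 *ᶻ wsum V
        module _ {w} (enV : Enum₃ V (x -ᶻ k) (x -ᶻ l) w) where
          -- Two of the four elements x - k, x - l, y - k, y - l of the three-element V must
          -- coincide: here y - k = x - l, in `ascending` y - l = x - k. Both together would give 2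
          -- d ≡ 0.
          descending : y -ᶻ k ≈ x -ᶻ l → w ≈ y -ᶻ l → Sum
          descending e f = combine₃ (+ 1) -[1+ 1 ] -[1+ 1 ] e (Enum₃.total enV) f (lem x y k l (wsum V) w)
            where lem : ∀ x y k l v w → + 3 *ᶻ (x +ᶻ y) -ᶻ (+ 3 *ᶻ (k +ᶻ l) +ᶻ + 2 *ᶻ v) ≡
                        + 1 *ᶻ ((y -ᶻ k) -ᶻ (x -ᶻ l)) +ᶻ -[1+ 1 ] *ᶻ (v -ᶻ ((x -ᶻ k) +ᶻ ((x -ᶻ l) +ᶻ w))) +ᶻ -[1+ 1 ] *ᶻ (w -ᶻ (y -ᶻ l))
                  lem = ℤR.solve-∀
          ascending : y -ᶻ k ≈ w → y -ᶻ l ≈ x -ᶻ k → Sum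
          ascending e f = combine₃ (+ 2) -[1+ 1 ] (+ 1) e (Enum₃.total enV) f (lem x y k l (wsum V) w)
            where lem : ∀ x y k l v w → + 3 *ᶻ (x +ᶻ y) -ᶻ (+ 3 *ᶻ (k +ᶻ l) +ᶻ + 2 *ᶻ v) ≡
                        + 2 *ᶻ ((y -ᶻ k) -ᶻ w) +ᶻ -[1+ 1 ] *ᶻ (v -ᶻ ((x -ᶻ k) +ᶻ ((x -ᶻ l) +ᶻ w))) +ᶻ + 1 *ᶻ ((y -ᶻ l) -ᶻ (x -ᶻ k))
                  lem = ℤR.solve-∀
          wrap : y -ᶻ k ≈ x -ᶻ l → y -ᶻ l ≈ x -ᶻ k → ⊥
          wrap e f = 2d≉0 (combine₂ (+ 1) ℤ.-1ℤ e f (lem x y k l))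
            where lem : ∀ x y k l → + 2 *ᶻ (l -ᶻ k) -ᶻ + 0 ≡ + 1 *ᶻ ((y -ᶻ k) -ᶻ (x -ᶻ l)) +ᶻ ℤ.-1ℤ *ᶻ ((y -ᶻ l) -ᶻ (x -ᶻ k))
                  lem = ℤR.solve-∀
          y-k≉y-l : ∀ {c} → y -ᶻ k ≈ c → y -ᶻ l ≈ c → ⊥
          y-k≉y-l e f = Enum₂.x≉y enK (sub-cancel y (≈-trans e (≈-sym f)))
          y-l≉x-l : y -ᶻ l ≉ x -ᶻ l
          y-l≉x-l h = Enum₂.x≉y enF (≈-sym (combine₁ (+ 1) h (lem x y l)))
            where lem : ∀ x y k → y -ᶻ x ≡ + 1 *ᶻ ((y -ᶻ k) -ᶻ (x -ᶻ k))
                  lem = ℤR.solve-∀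
          conclude : (y -ᶻ k ≈ x -ᶻ k ⊎ y -ᶻ k ≈ x -ᶻ l ⊎ y -ᶻ k ≈ w) →
                     (y -ᶻ l ≈ x -ᶻ k ⊎ y -ᶻ l ≈ x -ᶻ l ⊎ y -ᶻ l ≈ w) → Sum
          conclude (inj₁ e) _ = ⊥-elim (y-k≉x-k e)
          conclude _ (inj₂ (inj₁ f)) = ⊥-elim (y-l≉x-l f)
          conclude (inj₂ (inj₁ e)) (inj₁ f) = ⊥-elim (wrap e f)
          conclude (inj₂ (inj₁ e)) (inj₂ (inj₂ f)) = descending e (≈-sym f)
          conclude (inj₂ (inj₂ e)) (inj₁ f) = ascending e f
          conclude (inj₂ (inj₂ e)) (inj₂ (inj₂ f)) = ⊥-elim (y-k≉y-l e f)
        barycentre : Sum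
        barycentre = go (enum₃ V (proj₁ (both (Enum₂.x∈ enF))) (proj₂ (both (Enum₂.x∈ enF))) x-k≉x-l cV)
          where
          go : (∃ λ w → Enum₃ V (x -ᶻ k) (x -ᶻ l) w) → Sum
          go (w , enV) = conclude enV (Enum₃.only enV (proj₁ (both (Enum₂.y∈ enF)))) (Enum₃.only enV (proj₂ (both (Enum₂.y∈ enF))))
        result : + 3 *ᶻ wsum F ≈ + 3 *ᶻ wsum K +ᶻ + 2 *ᶻ wsum V
        result = combine₃ (+ 1) (+ 3) -[1+ 2 ] barycentre (Enum₂.total enF) (Enum₂.total enK) (lem x y k l (wsum F) (wsum K) (wsum V))
          where lem : ∀ x y k l f c v → + 3 *ᶻ f -ᶻ (+ 3 *ᶻ c +ᶻ + 2 *ᶻ v) ≡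
                      + 1 *ᶻ (+ 3 *ᶻ (x +ᶻ y) -ᶻ (+ 3 *ᶻ (k +ᶻ l) +ᶻ + 2 *ᶻ v)) +ᶻ + 3 *ᶻ (f -ᶻ (x +ᶻ y)) +ᶻ -[1+ 2 ] *ᶻ (c -ᶻ (k +ᶻ l))
                lem = ℤR.solve-∀
      finish : (∃ λ x → x ∈ F) → Goal
      finish (x , m) = F≡2 , result (proj₂ (enum₂ F m F≡2))
    start : (∃ λ k → k ∈ K) → Goal
    start (k , m) = finish (proj₂ (enum₂ K m cK)) (nonempty F (≤-trans (s≤s z≤n) cF))

  -- Both ends of the g-progressions of A, X and A + X obey two-three, and the
  -- difference of the end sums of S is (|S| - |E g S|) g.
  two-three-impossible : ∀ A X g m → 5 < p → g ≉ + 0 → Double A X →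
    card (E g A) ≡ 2 → card (E g X) ≡ 3 → 2 ≤ card (E g (A ⊞ X)) →
    card (A ⊞ X) ≡ card A + card X + m → card X + (m + m + m) + 6 < p → ⊥
  two-three-impossible A X g m 5<p g≉0 dbl cK cV cF cZ small = g≉0 (cancel≈ N (≤-trans (s≤s z≤n) (m≤n+m 6 _)) small key)
    where
    -- 3 (|A| + |X| + m - 2) - 3 (|A| - 2) - 2 (|X| - 3), the multiple of g left when the relation
    -- for -g is subtracted from that for g.
    N = card X + (m + m + m) + 6
    Z = A ⊞ X
    right = two-three (E g A) (E g X) (E g Z) 5<p cK cV cF (endpoint-reps A X dbl)
    left = two-three (E (-ᶻ g) A) (E (-ᶻ g) X) (E (-ᶻ g) Z) 5<p (trans (card-E-neg A g) cK) (trans (card-E-neg X g) cV)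
             (≤-trans cF (≤-reflexive (sym (card-E-neg Z g)))) (endpoint-reps A X dbl)
    key : + N *ᶻ g ≈ + 0
    key = combine₁ (+ 1) (-[1+ 2 ] ·≈ diff-of Z 2 (proj₁ right) cZ ⊹ + 3 ·≈ diff-of A 2 cK refl ⊹ + 2 ·≈ diff-of X 3 cV refl ⊹ sums)
            (lem (+ card A) (+ card X) (+ m) g (δ Z) (δ A) (δ X))
      where
      δ : PSet → ℤ
      δ S = wsum (E g S) -ᶻ wsum (E (-ᶻ g) S)
      diff-of : ∀ S c {n} → card (E g S) ≡ c → card S ≡ n → δ S ≈ (+ n -ᶻ + c) *ᶻ g
      diff-of S c refl refl = combine₁ (+ 1) (wsum-E S g) (lem₀ (wsum (E g S)) (wsum (E (-ᶻ g) S)) (+ card S) (+ c) g)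
        where lem₀ : ∀ e e′ n c g → (e -ᶻ e′) -ᶻ (n -ᶻ c) *ᶻ g ≡ + 1 *ᶻ ((e +ᶻ c *ᶻ g) -ᶻ (e′ +ᶻ n *ᶻ g))
              lem₀ = ℤR.solve-∀
      sums : + 3 *ᶻ δ Z ≈ + 3 *ᶻ δ A +ᶻ + 2 *ᶻ δ X
      sums = combine₂ (+ 1) ℤ.-1ℤ (proj₂ right) (proj₂ left) (lem₀ (wsum (E g Z)) (wsum (E (-ᶻ g) Z)) (wsum (E g A)) (wsum (E (-ᶻ g) A)) (wsum (E g X)) (wsum (E (-ᶻ g) X)))
        where lem₀ : ∀ f f′ k k′ v v′ → + 3 *ᶻ (f -ᶻ f′) -ᶻ (+ 3 *ᶻ (k -ᶻ k′) +ᶻ + 2 *ᶻ (v -ᶻ v′)) ≡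
                       + 1 *ᶻ (+ 3 *ᶻ f -ᶻ (+ 3 *ᶻ k +ᶻ + 2 *ᶻ v)) +ᶻ ℤ.-1ℤ *ᶻ (+ 3 *ᶻ f′ -ᶻ (+ 3 *ᶻ k′ +ᶻ + 2 *ᶻ v′))
              lem₀ = ℤR.solve-∀
      lem : ∀ a n m g f k v → (n +ᶻ (m +ᶻ m +ᶻ m) +ᶻ + 6) *ᶻ g -ᶻ + 0 ≡ + 1 *ᶻ
              ((-[1+ 2 ] *ᶻ f +ᶻ (+ 3 *ᶻ k +ᶻ (+ 2 *ᶻ v +ᶻ + 3 *ᶻ f)))
              -ᶻ (-[1+ 2 ] *ᶻ ((a +ᶻ n +ᶻ m -ᶻ + 2) *ᶻ g) +ᶻ (+ 3 *ᶻ ((a -ᶻ + 2) *ᶻ g) +ᶻ (+ 2 *ᶻ ((n -ᶻ + 3) *ᶻ g) +ᶻ (+ 3 *ᶻ k +ᶻ + 2 *ᶻ v)))))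
      lem = ℤR.solve-∀

  -- Pairs

  pair : ℤ → ℤ → PSet
  pair x h = ⟨ x ⟩ ⊔> h

  ≈⇒∈⟨⟩ : ∀ {x y} → y ≈ x → y ∈ ⟨ x ⟩
  ≈⇒∈⟨⟩ {x} {y} e = mem (⌊⌋-true {d = y ≈? x} e)

  ∈⟨⟩⇒≈ : ∀ {x y} → y ∈ ⟨ x ⟩ → y ≈ x
  ∈⟨⟩⇒≈ {x} {y} (mem e) = ⌊⌋-elim {d = y ≈? x} e

  shift-cancel : ∀ {x h} → x +ᶻ h ≈ x → h ≈ + 0
  shift-cancel {x} {h} e = combine₁ (+ 1) e (lem x h)
    where lem : ∀ x h → h -ᶻ + 0 ≡ + 1 *ᶻ ((x +ᶻ h) -ᶻ x)
          lem = ℤR.solve-∀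

  card-pair : ∀ x {h} → h ≉ + 0 → card (pair x h) ≡ 2
  card-pair x {h} h≉0 = trans (card-⊔> ⟨ x ⟩ h) (cong₂ _+_ (card-⟨⟩ x)
    (≤-antisym (≤-trans (card-mono (E h ⟨ x ⟩) ⟨ x ⟩ (λ m → proj₁ (E-elim ⟨ x ⟩ m))) (≤-reflexive (card-⟨⟩ x)))
               (card-pos (E h ⟨ x ⟩) {x} (E-intro ⟨ x ⟩ (≈⇒∈⟨⟩ ≈-refl) (out (member? (x +ᶻ h) ⟨ x ⟩))))))
    where
    out : x +ᶻ h ∈ ⟨ x ⟩ ⊎ x +ᶻ h ∉ ⟨ x ⟩ → x +ᶻ h ∉ ⟨ x ⟩
    out (inj₂ n) = n
    out (inj₁ m) = ⊥-elim (h≉0 (shift-cancel (∈⟨⟩⇒≈ m)))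

  ⟨⟩-⊞ : ∀ x X y → χ (⟨ x ⟩ ⊞ X) y ≡ χ (X +> x) y
  ⟨⟩-⊞ x X y = bool-ext (λ e → to (⊞-elim ⟨ x ⟩ X (mem {y} e))) (λ e → holds (⊞-intro ⟨ x ⟩ X {x} {y} (≈⇒∈⟨⟩ ≈-refl) (mem e)))
    where
    to : (∃ λ a → a ∈ ⟨ x ⟩ × y -ᶻ a ∈ X) → χ (X +> x) y ≡ true
    to (a , a∈ , m) = holds (∈-resp X {y -ᶻ a} {y -ᶻ x} (-‿cong≈ {y} {y} {a} {x} (≈-refl {y}) (∈⟨⟩⇒≈ a∈)) m)

  card-pair-⊞ : ∀ x h X → card (pair x h ⊞ X) ≡ card X + card (E h X)
  card-pair-⊞ x h X = trans (card-⊔>-⊞ ⟨ x ⟩ X h) (cong₂ _+_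
    (trans (card-≐ (⟨ x ⟩ ⊞ X) (X +> x) (⟨⟩-⊞ x X)) (card-+> X x))
    (trans (card-≐ (E h (⟨ x ⟩ ⊞ X)) (E h X +> x) (λ y → cong₂ (λ a b → a ∧ not b) (⟨⟩-⊞ x X y) (trans (⟨⟩-⊞ x X (y +ᶻ h)) (cong (χ X) (lem x h y))))) (card-+> (E h X) x)))
    where lem : ∀ x h y → (y +ᶻ h) -ᶻ x ≡ (y -ᶻ x) +ᶻ h
          lem = ℤR.solve-∀

  pair⊆ : ∀ S {x y} → x ∈ S → y ∈ S → pair x (y -ᶻ x) ⊆ S
  pair⊆ S {x} {y} x∈ y∈ {w} m = go (⊔>-elim ⟨ x ⟩ {y -ᶻ x} {w} m)
    where
    lem : ∀ w x y → y -ᶻ w ≡ ℤ.-1ℤ *ᶻ ((w -ᶻ (y -ᶻ x)) -ᶻ x)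
    lem = ℤR.solve-∀
    go : w ∈ ⟨ x ⟩ ⊎ w -ᶻ (y -ᶻ x) ∈ ⟨ x ⟩ → w ∈ S
    go (inj₁ h) = ∈-resp S {x} {w} (≈-sym (∈⟨⟩⇒≈ h)) x∈
    go (inj₂ h) = ∈-resp S {y} {w} (combine₁ ℤ.-1ℤ (∈⟨⟩⇒≈ {x} {w -ᶻ (y -ᶻ x)} h) (lem w x y)) y∈

  -- Turns lower bounds for ends into expansion of every set with two elements, and small sumsets
  -- into upper bounds for ends.
  pair-sumset : ∀ S X {x y} → x ∈ S → y ∈ S → card X + card (E (y -ᶻ x) X) ≤ card (S ⊞ X)
  pair-sumset S X {x} {y} x∈ y∈ = subst (_≤ card (S ⊞ X)) (card-pair-⊞ x (y -ᶻ x) X)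
    (card-mono (pair x (y -ᶻ x) ⊞ X) (S ⊞ X) (⊞-mono (pair x (y -ᶻ x)) S X (pair⊆ S x∈ y∈)))

  -- Existence of atoms

  -- Descent on the excess and then on the size; `measure` codes the lexicographic order, sizes
  -- being at most p. In this negative form `minimal` and `least` can be proved for T by
  -- contradiction, each failure leading to a smaller set.
  atom-exists : ∀ k X → 0 < card X → (∀ B → ¬ Atom k X B) →
                ∀ T → k ≤ card T → card (T ⊞ X) + k ≤ p → ⊥
  atom-exists k X X≠∅ none = λ T → search (suc (measure T)) T ≤-refl
    where
    excess : PSet → ℕ
    excess T = card (T ⊞ X) ∸ card T
    measure : PSet → ℕ
    measure T = excess T * suc p + card T
    excess-eq : ∀ T → card T + excess T ≡ card (T ⊞ X)
    excess-eq T = m+[n∸m]≡n (card≤⊞ T X X≠∅)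
    cross : ∀ T U → card (T ⊞ X) + card U ≡ excess T + (card T + card U)
    cross T U = trans (cong (_+ card U) (sym (excess-eq T))) (lem (card T) (excess T) (card U))
      where lem : ∀ t e u → t + e + u ≡ e + (t + u)
            lem = ℕR.solve-∀
    cross′ : ∀ T U → card (T ⊞ X) + card U ≡ excess T + (card U + card T)
    cross′ T U = trans (cross T U) (cong₂ _+_ (refl {x = excess T}) (+-comm (card T) (card U)))
    less : ∀ {T U} → excess T < excess U → measure T < measure U
    less {T} {U} h = ≤-trans (≤-trans (+-monoʳ-< (excess T * suc p) (s≤s (card≤p T)))
                               (≤-reflexive (+-comm (excess T * suc p) (suc p))))
                             (≤-trans (*-monoˡ-≤ (suc p) h) (m≤m+n (excess U * suc p) (card U)))
    search : ∀ n T → measure T < n → k ≤ card T → card (T ⊞ X) + k ≤ p → ⊥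
    search (suc n) T (s≤s bound) size room = none T record
      { size = size
      ; room = room
      ; minimal = λ U sizeU roomU → ≮⇒≥ λ h → search n U
          (≤-trans (less {U} {T} (+-cancelʳ-< (card T + card U) (excess U) (excess T) (subst₂ _<_ (cross′ U T) (cross T U) h))) bound) sizeU roomU
      ; least = λ U sizeU roomU h → ≮⇒≥ λ U<T → search n U
          (≤-trans (+-mono-≤-< (*-monoˡ-≤ (suc p) (+-cancelʳ-≤ (card T + card U) (excess U) (excess T) (subst₂ _≤_ (cross′ U T) (cross T U) h))) U<T) bound) sizeU roomU }

  overlap≤ : ∀ S h {t n} → t ≤ card (E h S) → card S ≡ n + t → card (S ⊓> h) ≤ n
  overlap≤ S h {t} {n} t≤ e = +-cancelʳ-≤ t _ _ (≤-trans (+-monoʳ-≤ (card (S ⊓> h)) t≤) (≤-reflexive (trans (card-⊓> S h) e)))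

  E≤card : ∀ S h → card (E h S) ≤ card S
  E≤card S h = card-mono (E h S) S (λ m → proj₁ (E-elim S m))

  abstract
    -- With numeral sizes both sides are closed numbers, so a contradiction is decided by
    -- evaluation, as in `from-no (63 ≤? 61)`.
    energy : ∀ S T {s t} m o w → card S ≡ s → card T ≡ t → (∀ g → g ≉ + 0 → card (T ⊓> g) ≤ o) →
             card (S ⊞ T) ≤ w → suc (2 * m) * (s * t) + s * o ≤ m * suc m * w + (s * s * o + s * t)
    energy S T m o w refl refl h w≤ = ≤-trans (sumset-bound S T m o h) (+-monoˡ-≤ _ (*-monoʳ-≤ (m * suc m) w≤))

  -- If |X| = 4, a 5-atom of X with at least six elements would make X a Sidon
  -- set; then any overlap A ∩ (A + g) with three elements is too expanding.
  module FiveAtoms (46<p : 46 < p) {X A} (atom : Atom 5 X A) (X≡4 : card X ≡ 4)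
                   (6≤A : 6 ≤ card A) (Z≤ : card (A ⊞ X) ≤ card A + 5) where

    open AtomProperties atom (s≤s z≤n) (subst (0 <_) (sym X≡4) (s≤s z≤n))
    private Z = A ⊞ X

    overlap≤4 : ∀ g → g ≉ + 0 → card (A ⊓> g) ≤ 4
    overlap≤4 g g≉0 = ≤-pred (overlap-bound g g≉0)

    -- Roles exchanged: four translates of A meet pairwise in at most four points. The bound is what
    -- lets A ∪ (A + g) fit into ℤ/p in `grow`.
    A≤9 : card A ≤ 9
    A≤9 = num (card X) (card A) (card (X ⊞ A)) X≡4 (sumset-bound X A 1 4 overlap≤4) (≤-trans (≤-reflexive (card-⊞-comm X A)) Z≤)
      where
      num : ∀ n a z → n ≡ 4 → 3 * (n * a) + n * 4 ≤ 2 * z + (n * n * 4 + n * a) → z ≤ a + 5 → a ≤ 9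
      num n a z refl h z≤ = ≮⇒≥ λ 10≤a → absurd-≤ 1 (h ⊞≤ *-monoʳ-≤ 2 z≤ ⊞≤ *-monoʳ-≤ 6 10≤a) (lem a z)
        where lem : ∀ a z → 3 * (4 * a) + 4 * 4 + 2 * z + 6 * 10 ≡ 2 + (2 * z + (4 * 4 * 4 + 4 * a) + 2 * (a + 5) + 6 * a)
              lem = ℕR.solve-∀

    grow : ∀ g → card (E g A) ≤ card (E g Z)
    grow g = growth′ g (≤-trans (+-monoˡ-≤ 5 (+-mono-≤ (≤-trans Z≤ (+-monoˡ-≤ 5 A≤9)) (≤-trans (E≤card A g) A≤9)))
               (≤-trans (m≤m+n 28 19) (≤-trans 46<p (n≤1+n p))))

    sidon : ∀ g → g ≉ + 0 → card (X ⊓> g) ≤ 1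
    sidon g g≉0 = overlap≤ X g (three-endpoints A X g g≉0 (double 6≤A) (grow g) (E-pos A g≉0 0<A A<p) (≤-<-trans (E≤card A g) A<p)) X≡4

    -- By submodularity |C + X| ≤ |A + X| - |E g A| ≤ |C| + 5, whereas the Sidon property gives |C +
    -- X| ≥ |C| + 6 when |C| is 3 or 4.
    overlap≤2 : ∀ g → g ≉ + 0 → card (A ⊓> g) ≤ 2
    overlap≤2 g g≉0 = ≮⇒≥ λ 3≤C → refute (card C) 3≤C (overlap≤4 g g≉0) refl
      where
      C = A ⊓> g
      expand : ∀ c x D → x ≡ 4 → (c ≡ 3 ⊎ c ≡ 4) → 3 * (c * x) + c * 1 ≤ 2 * D + (c * c * 1 + c * x) → c + 6 ≤ D
      expand c x D refl (inj₁ refl) h = ≮⇒≥ λ D≤8 → absurd-≤ 1 (h ⊞≤ *-monoʳ-≤ 2 D≤8) (lem D)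
        where lem : ∀ D → 3 * (3 * 4) + 3 * 1 + 2 * (1 + D) ≡ 2 + (2 * D + (3 * 3 * 1 + 3 * 4) + 2 * 9)
              lem = ℕR.solve-∀
      expand c x D refl (inj₂ refl) h = ≮⇒≥ λ D≤9 → absurd-≤ 1 (h ⊞≤ *-monoʳ-≤ 2 D≤9) (lem D)
        where lem : ∀ D → 3 * (4 * 4) + 4 * 1 + 2 * (1 + D) ≡ 2 + (2 * D + (4 * 4 * 1 + 4 * 4) + 2 * 10)
              lem = ℕR.solve-∀
      contra : card C + 6 ≤ card (C ⊞ X) → ⊥
      contra h = absurd-≤ 0 (h ⊞≤ E-⊞-bound A X g ⊞≤ grow g ⊞≤ Z≤ ⊞≤ ≤-reflexive (sym (card-⊓> A g)))
        (lem (card C) (card (C ⊞ X)) (card (E g Z)) (card (E g A)) (card Z) (card A))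
        where lem : ∀ c D u s z a → (c + 6) + (u + D) + s + z + a ≡ 1 + (D + z + u + (a + 5) + (c + s))
              lem = ℕR.solve-∀
      refute : ∀ c → 3 ≤ c → c ≤ 4 → card C ≡ c → ⊥
      refute 1 (s≤s ()) _ e
      refute 2 (s≤s (s≤s ())) _ e
      refute 3 _ _ e = contra (expand (card C) (card X) (card (C ⊞ X)) X≡4 (inj₁ e) (sumset-bound C X 1 1 sidon))
      refute 4 _ _ e = contra (expand (card C) (card X) (card (C ⊞ X)) X≡4 (inj₂ e) (sumset-bound C X 1 1 sidon))
      refute (suc (suc (suc (suc (suc c))))) _ (s≤s (s≤s (s≤s (s≤s ())))) e

    -- Overlaps of at most two and m = 2 give 10 |A| ≤ 54.
    impossible : ⊥
    impossible = num (card X) (card A) (card (X ⊞ A)) X≡4 (sumset-bound X A 2 2 overlap≤2) (≤-trans (≤-reflexive (card-⊞-comm X A)) Z≤) 6≤A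
      where
      num : ∀ n a z → n ≡ 4 → 5 * (n * a) + n * 2 ≤ 6 * z + (n * n * 2 + n * a) → z ≤ a + 5 → 6 ≤ a → ⊥
      num n a z refl h z≤ 6≤a = absurd-≤ 5 (h ⊞≤ *-monoʳ-≤ 6 z≤ ⊞≤ *-monoʳ-≤ 10 6≤a) (lem a z)
        where lem : ∀ a z → 5 * (4 * a) + 4 * 2 + 6 * z + 10 * 6 ≡ 6 + (6 * z + (4 * 4 * 2 + 4 * a) + 6 * (a + 5) + 10 * a)
              lem = ℕR.solve-∀

  -- The 2-atoms of A

  module TwoAtoms (46<p : 46 < p) {A X B} (5≤A : 5 ≤ card A)
                  (overlap≤3 : ∀ g → g ≉ + 0 → card (A ⊓> g) ≤ 3)
                  (atom : Atom 2 A B) (2≤X : 2 ≤ card X)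
                  (room : card (X ⊞ A) + 2 ≤ p) (X⊞A≤ : card (X ⊞ A) ≤ card A + card X + 1) where

    open AtomProperties atom (s≤s z≤n) (≤-trans (s≤s z≤n) 5≤A) public
    private W = B ⊞ A

    overlapB≤1 : ∀ g → g ≉ + 0 → card (B ⊓> g) ≤ 1
    overlapB≤1 g g≉0 = ≤-pred (overlap-bound g g≉0)

    -- X competes with B as a set to be added to A.
    W≤ : card W ≤ card A + card B + 1
    W≤ = Atom.minimal atom X 2≤X room ⟨≤⟩ X⊞A≤
      where
      infixl 1 _⟨≤⟩_
      _⟨≤⟩_ : card W + card X ≤ card (X ⊞ A) + card B → card (X ⊞ A) ≤ card A + card X + 1 → card W ≤ card A + card B + 1
      h ⟨≤⟩ k = ≤-shift (card X + card (X ⊞ A)) (h ⊞≤ k) (lem₁ (card W) (card X) (card (X ⊞ A))) (lem₂ (card A) (card B) (card X) (card (X ⊞ A)))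
        where
        lem₁ : ∀ w x y → w + x + y ≡ w + (x + y)
        lem₁ = ℕR.solve-∀
        lem₂ : ∀ a b x y → y + b + (a + x + 1) ≡ a + b + 1 + (x + y)
        lem₂ = ℕR.solve-∀

    ≤46⇒≤p : ∀ {n} → n ≤ 46 → n ≤ p
    ≤46⇒≤p n≤ = ≤-trans n≤ (<⇒≤ 46<p)

    module _ (3≤B : 3 ≤ card B) where

      -- Bonferroni for three translates of A with overlaps at most 3: |A + B| ≥ 3 |A| - 9.
      2A≤ : card A + card A ≤ card B + 10
      2A≤ = go (subset-of-size B 3 3≤B)
        where
        num : ∀ a b w w′ → 3 * (3 * a) + 3 * 3 ≤ 2 * w′ + (3 * 3 * 3 + 3 * a) → w′ ≤ w → w ≤ a + b + 1 → a + a ≤ b + 10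
        num a b w w′ h h₁ h₂ = ≮⇒≥ λ c → absurd-≤ 1 (h ⊞≤ *-monoʳ-≤ 2 h₁ ⊞≤ *-monoʳ-≤ 2 h₂ ⊞≤ *-monoʳ-≤ 2 c) (lem a b w w′)
          where lem : ∀ a b w w′ → 3 * (3 * a) + 3 * 3 + 2 * w′ + 2 * w + 2 * (1 + (b + 10)) ≡
                      2 + (2 * w′ + (3 * 3 * 3 + 3 * a) + 2 * w + 2 * (a + b + 1) + 2 * (a + a))
                lem = ℕR.solve-∀
        go : (∃ λ T → T ⊆ B × card T ≡ 3) → card A + card A ≤ card B + 10
        go (T , T⊆B , eq) = num (card A) (card B) (card W) (card (T ⊞ A)) (energy T A 1 3 (card (T ⊞ A)) eq refl overlap≤3 ≤-refl)
                              (card-mono (T ⊞ A) W (⊞-mono T B A T⊆B)) W≤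

      -- Bonferroni for five translates of B with overlaps at most 1: |A + B| ≥ 5 |B| - 10.
      4B≤ : 4 * card B ≤ card A + 11
      4B≤ = go (subset-of-size A 5 5≤A)
        where
        num : ∀ a b w w′ → 3 * (5 * b) + 5 * 1 ≤ 2 * w′ + (5 * 5 * 1 + 5 * b) → w′ ≤ w → w ≤ a + b + 1 → 4 * b ≤ a + 11
        num a b w w′ h h₁ h₂ = ≮⇒≥ λ c → absurd-≤ 1 (h ⊞≤ *-monoʳ-≤ 2 h₁ ⊞≤ *-monoʳ-≤ 2 h₂ ⊞≤ *-monoʳ-≤ 2 c) (lem a b w w′)
          where lem : ∀ a b w w′ → 3 * (5 * b) + 5 * 1 + 2 * w′ + 2 * w + 2 * (1 + (a + 11)) ≡
                      2 + (2 * w′ + (5 * 5 * 1 + 5 * b) + 2 * w + 2 * (a + b + 1) + 2 * (4 * b))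
                lem = ℕR.solve-∀
        go : (∃ λ T → T ⊆ A × card T ≡ 5) → 4 * card B ≤ card A + 11
        go (T , T⊆A , eq) = num (card A) (card B) (card W) (card (T ⊞ B)) (energy T B 1 1 (card (T ⊞ B)) eq refl overlapB≤1 ≤-refl)
                              (≤-trans (card-mono (T ⊞ B) (A ⊞ B) (⊞-mono T A B T⊆A)) (≤-reflexive (card-⊞-comm A B))) W≤

      B≤4 : card B ≤ 4
      B≤4 = ≮⇒≥ λ c → absurd-≤ 2 (*-monoʳ-≤ 2 4B≤ ⊞≤ 2A≤ ⊞≤ *-monoʳ-≤ 7 c) (lem (card A) (card B))
        where lem : ∀ a b → 2 * (4 * b) + (a + a) + 7 * 5 ≡ 3 + (2 * (a + 11) + (b + 10) + 7 * b)
              lem = ℕR.solve-∀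

      A≤7 : card A ≤ 7
      A≤7 = ≮⇒≥ λ c → absurd-≤ 1 (*-monoʳ-≤ 2 c ⊞≤ 2A≤ ⊞≤ B≤4) (lem (card A) (card B))
        where lem : ∀ a b → 2 * 8 + (a + a) + b ≡ 2 + (2 * a + (b + 10) + 4)
              lem = ℕR.solve-∀

      W≤12 : card W ≤ 12
      W≤12 = ≤-trans W≤ (+-monoˡ-≤ 1 (+-mono-≤ A≤7 B≤4))

      growB : ∀ h → card (E h B) ≤ card (E h W)
      growB h = growth′ h (≤-trans (+-monoˡ-≤ 2 (+-mono-≤ W≤12 (≤-trans (E≤card B h) B≤4))) (≤-trans (≤46⇒≤p (m≤m+n 18 28)) (n≤1+n p)))

      doubleB : Double B A
      doubleB = double 3≤B

      t≥3 : ∀ h → h ≉ + 0 → 3 ≤ card (E h A)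
      t≥3 h h≉0 = three-endpoints B A h h≉0 doubleB (growB h) (E-pos B h≉0 0<A A<p) (≤-<-trans (E≤card B h) A<p)

      -- A pair is smaller than the 2-atom B, so its excess |A| + |E h A| - 2 is strictly larger
      -- than that of B, here |A| + 1.
      t≥4 : card W ≡ card A + card B + 1 → ∀ h → h ≉ + 0 → 4 ≤ card (E h A)
      t≥4 eq h h≉0 = ≤-shift (card A + card B) st (trans (cong (λ w → suc (w + 2)) eq) (lem₁ (card A) (card B))) (lem₂ (card A) (card B) (card (E h A)))
        where
        lem₁ : ∀ a b → suc (a + b + 1 + 2) ≡ 4 + (a + b)
        lem₁ = ℕR.solve-∀
        lem₂ : ∀ a b t → a + t + b ≡ t + (a + b)
        lem₂ = ℕR.solve-∀
        P = pair (+ 0) h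
        st : card W + 2 < card A + card (E h A) + card B
        st = subst₂ (λ c d → card W + c < d + card B) (card-pair (+ 0) h≉0) (card-pair-⊞ (+ 0) h A)
          (strict P (≤-reflexive (sym (card-pair (+ 0) h≉0)))
            (subst (λ d → d + 2 ≤ p) (sym (card-pair-⊞ (+ 0) h A)) (≤-trans (+-monoˡ-≤ 2 (+-mono-≤ A≤7 (≤-trans (E≤card A h) A≤7))) (≤46⇒≤p (m≤m+n 16 30))))
            (subst (_< card B) (sym (card-pair (+ 0) h≉0)) 3≤B))

      o : ∀ {τ} n → card A ≡ n + τ → (∀ h → h ≉ + 0 → τ ≤ card (E h A)) → ∀ h → h ≉ + 0 → card (A ⊓> h) ≤ n
      o n eq t h h≉0 = overlap≤ A h (t h h≉0) eq

      W-split : card W ≡ card A + card B + 1 ⊎ card W ≤ card A + card B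
      W-split with m≤n⇒m<n∨m≡n W≤
      ... | inj₂ eq = inj₁ eq
      ... | inj₁ lt = inj₂ (≤-pred (≤-trans lt (≤-reflexive (+-comm (card A + card B) 1))))

      -- The one case that counting coincidences leaves open. Here B has two h-ends and A three, so
      -- the barycentre argument applies to B and A in place of A and X, with m = 0.
      special : card A ≡ 6 → card B ≡ 3 → card W ≤ 9 → ⊥
      special A≡6 B≡3 W≤9 = go (two-elements B (≤-trans (s≤s (s≤s z≤n)) 3≤B))
        where
        W≡9 : card W ≡ 9
        W≡9 = ≤-antisym W≤9 (≮⇒≥ λ c → from-no (63 ≤? 61) (energy B A 1 3 8 B≡3 A≡6 overlap≤3 (≤-pred c)))
        go : (∃ λ x → ∃ λ y → x ∈ B × y ∈ B × x ≉ y) → ⊥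
        go (x , y , x∈ , y∈ , x≉y) = two-three-impossible B A h 0 (≤-trans (m≤m+n 6 41) 46<p) h≉0 doubleB s≡2 t≡3
            (≤-trans (≤-reflexive (sym s≡2)) (growB h)) (trans W≡9 (cong₂ (λ b a → b + a + 0) (sym B≡3) (sym A≡6)))
            (subst (λ a → a + 0 + 6 < p) (sym A≡6) (≤-trans (m≤m+n 13 34) 46<p))
          where
          h = y -ᶻ x
          h≉0 : h ≉ + 0
          h≉0 = sub≉0 (≉-sym x≉y)
          t≡3 : card (E h A) ≡ 3
          t≡3 = ≤-antisym (+-cancelˡ-≤ 6 _ _ (≤-trans (subst (λ a → a + card (E h A) ≤ card W) A≡6 (pair-sumset B A x∈ y∈)) W≤9)) (t≥3 h h≉0)
          B⊓≡1 : card (B ⊓> h) ≡ 1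
          B⊓≡1 = ≤-antisym (overlapB≤1 h h≉0) (card-pos (B ⊓> h) {y} (⊓>-intro B {h} {y} y∈ (subst (_∈ B) (lem x y) x∈)))
            where lem : ∀ x y → x ≡ y -ᶻ (y -ᶻ x)
                  lem = ℤR.solve-∀
          s≡2 : card (E h B) ≡ 2
          s≡2 = +-cancelˡ-≡ 1 _ _ (trans (cong (_+ card (E h B)) (sym B⊓≡1)) (trans (card-⊓> B h) B≡3))

      AB≤ : ∀ {w} → card W ≤ w → card (A ⊞ B) ≤ w
      AB≤ h = ≤-trans (≤-reflexive (card-⊞-comm A B)) h

      -- In most rows the overlap bound for A is |A| minus its number of ends, at least 4 or 3
      -- depending on |A + B|; the numerals are the two sides of `energy`.
      refute : ∀ a b → card A ≡ a → card B ≡ b → 5 ≤ a → a ≤ 7 → 3 ≤ b → b ≤ 4 → a + a ≤ b + 10 →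
               card W ≡ a + b + 1 ⊎ card W ≤ a + b → (card W ≡ a + b + 1 → ∀ h → h ≉ + 0 → 4 ≤ card (E h A)) → ⊥
      refute 5 3 ea eb _ _ _ _ _ (inj₁ e) t = from-no (48 ≤? 42) (energy B A 1 1 9 eb ea (o 1 ea (t e)) (≤-reflexive e))
      refute 5 3 ea eb _ _ _ _ _ (inj₂ l) t = from-no (51 ≤? 49) (energy B A 1 2 8 eb ea (o 2 ea t≥3) l)
      refute 5 4 ea eb _ _ _ _ _ (inj₁ e) t = from-no (104 ≤? 96) (energy B A 2 1 10 eb ea (o 1 ea (t e)) (≤-reflexive e))
      refute 5 4 ea eb _ _ _ _ _ (inj₂ l) t = from-no (108 ≤? 106) (energy B A 2 2 9 eb ea (o 2 ea t≥3) l)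
      refute 6 3 ea eb _ _ _ _ _ (inj₁ e) t = from-no (60 ≤? 56) (energy B A 1 2 10 eb ea (o 2 ea (t e)) (≤-reflexive e))
      refute 6 3 ea eb _ _ _ _ _ (inj₂ l) t = special ea eb l
      refute 6 4 ea eb _ _ _ _ _ (inj₁ e) t = from-no (128 ≤? 122) (energy B A 2 2 11 eb ea (o 2 ea (t e)) (≤-reflexive e))
      refute 6 4 ea eb _ _ _ _ _ (inj₂ l) t = from-no (126 ≤? 120) (energy A B 2 1 10 ea eb overlapB≤1 (AB≤ l))
      refute 7 3 ea eb _ _ _ _ c _ t = from-no (14 ≤? 13) c
      refute 7 4 ea eb _ _ _ _ _ _ t = from-no (152 ≤? 148) (energy B A 2 3 12 eb ea overlap≤3 W≤12)
      refute 0 b _ _ () _ _ _ _ _ _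
      refute 1 b _ _ (s≤s ()) _ _ _ _ _ _
      refute 2 b _ _ (s≤s (s≤s ())) _ _ _ _ _ _
      refute 3 b _ _ (s≤s (s≤s (s≤s ()))) _ _ _ _ _ _
      refute 4 b _ _ (s≤s (s≤s (s≤s (s≤s ())))) _ _ _ _ _ _
      refute (suc (suc (suc (suc (suc (suc (suc (suc a)))))))) b _ _ _ (s≤s (s≤s (s≤s (s≤s (s≤s (s≤s (s≤s ()))))))) _ _ _ _ _
      refute a 0 _ _ _ _ () _ _ _ _
      refute a 1 _ _ _ _ (s≤s ()) _ _ _ _
      refute a 2 _ _ _ _ (s≤s (s≤s ())) _ _ _ _
      refute a (suc (suc (suc (suc (suc b))))) _ _ _ _ _ (s≤s (s≤s (s≤s (s≤s ())))) _ _ _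

      not-larger : ⊥
      not-larger = refute (card A) (card B) refl refl 5≤A A≤7 3≤B B≤4 2A≤ W-split t≥4

    B≡2 : card B ≡ 2
    B≡2 = ≤-antisym (≮⇒≥ not-larger) (Atom.size atom)

  -- Three elements of F with two representations each in K + V, |K| = |V| = 3

  record Skew (n : ℕ) (S : PSet) (δ : ℤ) : Set where
    field
      c      : ℤ
      c∈     : c ∈ S
      c-δ∈   : c -ᶻ δ ∈ S
      c-nδ∈  : c -ᶻ + n *ᶻ δ ∈ S
      c≉c-δ  : c ≉ c -ᶻ δ
      c≉c-nδ : c ≉ c -ᶻ + n *ᶻ δ
      c-δ≉c-nδ : c -ᶻ δ ≉ c -ᶻ + n *ᶻ δ
      only   : ∀ {w} → w ∈ S → w ≈ c ⊎ w ≈ c -ᶻ δ ⊎ w ≈ c -ᶻ + n *ᶻ δ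

  -- In the exceptional case K is an affine copy of {0, 1, 3}, V a progression with the same step,
  -- and the barycentre is off by exactly that step.
  data Shape (K V F : PSet) : Set where
    barycentric : wsum F ≈ wsum V +ᶻ wsum K → Shape K V F
    skew        : ∀ δ → Skew 3 K δ → Skew 2 V δ → wsum F ≈ wsum V +ᶻ wsum K +ᶻ δ → Shape K V F

  -- `Shape` made symmetric in K and V, keeping only the form of K: `n` is 2 when K is the
  -- progression and V the copy of {0, 1, 3}.
  data Column (K V F : PSet) : Set where
    barycentric : wsum F ≈ wsum V +ᶻ wsum K → Column K V F
    skew        : ∀ δ n → n ≡ 3 ⊎ n ≡ 2 → Skew n K δ → wsum F ≈ wsum V +ᶻ wsum K +ᶻ δ → Column K V F

  mkSkew : ∀ {n S x y z} → Enum₃ S x y z → ∀ c δ → x ≈ c → y ≈ c -ᶻ δ → z ≈ c -ᶻ + n *ᶻ δ → Skew n S δ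
  mkSkew {n} {S} {x} {y} {z} en c δ ex ey ez = record
    { c = c
    ; c∈ = ∈-resp S ex x∈
    ; c-δ∈ = ∈-resp S ey y∈
    ; c-nδ∈ = ∈-resp S ez z∈
    ; c≉c-δ = λ h → x≉y (≈-trans ex (≈-trans h (≈-sym ey)))
    ; c≉c-nδ = λ h → x≉z (≈-trans ex (≈-trans h (≈-sym ez)))
    ; c-δ≉c-nδ = λ h → y≉z (≈-trans ey (≈-trans h (≈-sym ez)))
    ; only = λ m → sub (only m) }
    where
    open Enum₃ en
    sub : ∀ {w} → w ≈ x ⊎ w ≈ y ⊎ w ≈ z → w ≈ c ⊎ w ≈ c -ᶻ δ ⊎ w ≈ c -ᶻ + n *ᶻ δ
    sub (inj₁ e) = inj₁ (≈-trans e ex)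
    sub (inj₂ (inj₁ e)) = inj₂ (inj₁ (≈-trans e ey))
    sub (inj₂ (inj₂ e)) = inj₂ (inj₂ (≈-trans e ez))

  rotate-enum : ∀ {S x y z} → Enum₃ S x y z → Enum₃ S y x z
  rotate-enum {S} {x} {y} {z} en = record
    { x∈ = y∈ ; y∈ = x∈ ; z∈ = z∈ ; x≉y = ≉-sym x≉y ; x≉z = y≉z ; y≉z = x≉z
    ; only = λ m → sub (only m)
    ; total = ≈-trans total (≡⇒≈ (lem x y z)) }
    where
    open Enum₃ en
    lem : ∀ x y z → x +ᶻ (y +ᶻ z) ≡ y +ᶻ (x +ᶻ z)
    lem = ℤR.solve-∀
    sub : ∀ {w} → w ≈ x ⊎ w ≈ y ⊎ w ≈ z → w ≈ y ⊎ w ≈ x ⊎ w ≈ z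
    sub (inj₁ e) = inj₂ (inj₁ e)
    sub (inj₂ (inj₁ e)) = inj₁ e
    sub (inj₂ (inj₂ e)) = inj₂ (inj₂ e)

  swap-enum : ∀ {S x y z} → Enum₃ S x y z → Enum₃ S x z y
  swap-enum {S} {x} {y} {z} en = record
    { x∈ = x∈ ; y∈ = z∈ ; z∈ = y∈ ; x≉y = x≉z ; x≉z = x≉y ; y≉z = ≉-sym y≉z
    ; only = λ m → sub (only m)
    ; total = ≈-trans total (≡⇒≈ (lem x y z)) }
    where
    open Enum₃ en
    lem : ∀ x y z → x +ᶻ (y +ᶻ z) ≡ x +ᶻ (z +ᶻ y)
    lem = ℤR.solve-∀
    sub : ∀ {w} → w ≈ x ⊎ w ≈ y ⊎ w ≈ z → w ≈ x ⊎ w ≈ z ⊎ w ≈ y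
    sub (inj₁ e) = inj₁ e
    sub (inj₂ (inj₁ e)) = inj₂ (inj₂ e)
    sub (inj₂ (inj₂ e)) = inj₂ (inj₁ e)

  diff-cancel : ∀ {x y} a → x -ᶻ a ≈ y -ᶻ a → x ≈ y
  diff-cancel {x} {y} a h = combine₁ (+ 1) h (lem x y a)
    where lem : ∀ x y a → x -ᶻ y ≡ + 1 *ᶻ ((x -ᶻ a) -ᶻ (y -ᶻ a))
          lem = ℤR.solve-∀

  module Classify (K V F : PSet) (5<p : 5 < p) (cK : card K ≡ 3) (cV : card V ≡ 3) (cF : card F ≡ 3)
                  (reps : ∀ {z} → z ∈ F → TwoReps K V z) where

    3≉0 : ∀ {d} → d ≉ + 0 → + 3 *ᶻ d ≉ + 0
    3≉0 n h = n (cancel≈ 3 (s≤s z≤n) (≤-trans (s≤s (s≤s (s≤s (s≤s z≤n)))) 5<p) h)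

    2≉0 : ∀ {d} → d ≉ + 0 → + 2 *ᶻ d ≉ + 0
    2≉0 n h = n (cancel≈ 2 (s≤s z≤n) (≤-trans (s≤s (s≤s (s≤s z≤n))) 5<p) h)

    -- z and z′ both use α and β, which makes V a progression with middle z - α. The third element
    -- z″ cannot use α and β together, so it uses c, and all depends on the place of z″ - c in V.
    module Ascending {z z′ α β c z″} (enF : Enum₃ F z z′ z″) (enK : Enum₃ K α β c)
                     (enV : Enum₃ V (z -ᶻ α) (z -ᶻ β) (z′ -ᶻ α)) (up : z′ -ᶻ β ≈ z -ᶻ α) where

      Inside : ℤ → Set
      Inside v = v ≈ z -ᶻ α ⊎ v ≈ z -ᶻ β ⊎ v ≈ z′ -ᶻ α

      z″≉z : z″ ≉ z
      z″≉z e = Enum₃.x≉z enF (≈-sym e)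
      z″≉z′ : z″ ≉ z′
      z″≉z′ e = Enum₃.y≉z enF (≈-sym e)

      -- The sums of ends balance precisely when z″ - c is the middle of V.
      defect : wsum F -ᶻ (wsum V +ᶻ wsum K) ≈ (z″ -ᶻ c) -ᶻ (z -ᶻ α)
      defect = combine₃ (+ 1) ℤ.-1ℤ ℤ.-1ℤ (Enum₃.total enF) (Enum₃.total enV) (Enum₃.total enK)
        (lem z z′ z″ α β c (wsum F) (wsum V) (wsum K))
        where lem : ∀ z z′ z″ α β c f v k → (f -ᶻ (v +ᶻ k)) -ᶻ ((z″ -ᶻ c) -ᶻ (z -ᶻ α)) ≡
                    + 1 *ᶻ (f -ᶻ (z +ᶻ (z′ +ᶻ z″))) +ᶻ ℤ.-1ℤ *ᶻ (v -ᶻ ((z -ᶻ α) +ᶻ ((z -ᶻ β) +ᶻ (z′ -ᶻ α)))) +ᶻ ℤ.-1ℤ *ᶻ (k -ᶻ (α +ᶻ (β +ᶻ c)))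
              lem = ℤR.solve-∀

      middle : z″ -ᶻ c ≈ z -ᶻ α → Shape K V F
      middle e = barycentric (combine₂ (+ 1) (+ 1) defect e (lem (wsum F) (wsum V +ᶻ wsum K) (z″ -ᶻ c) (z -ᶻ α)))
        where lem : ∀ f s a b → f -ᶻ s ≡ + 1 *ᶻ ((f -ᶻ s) -ᶻ (a -ᶻ b)) +ᶻ + 1 *ᶻ (a -ᶻ b)
              lem = ℤR.solve-∀

      total-skew : ∀ {δ} → (z″ -ᶻ c) -ᶻ (z -ᶻ α) ≈ δ → wsum F ≈ wsum V +ᶻ wsum K +ᶻ δ
      total-skew {δ} e = combine₂ (+ 1) (+ 1) defect e (lem (wsum F) (wsum V +ᶻ wsum K) ((z″ -ᶻ c) -ᶻ (z -ᶻ α)) δ)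
        where lem : ∀ f s a δ → f -ᶻ (s +ᶻ δ) ≡ + 1 *ᶻ ((f -ᶻ s) -ᶻ a) +ᶻ + 1 *ᶻ (a -ᶻ δ)
              lem = ℤR.solve-∀

      lower : z″ -ᶻ α ≈ z -ᶻ β → z″ -ᶻ c ≈ z′ -ᶻ α → Shape K V F
      lower e f = skew (β -ᶻ α)
          (mkSkew (rotate-enum enK) β (β -ᶻ α) ≈-refl (≡⇒≈ (l₁ α β)) (combine₃ ℤ.-1ℤ (+ 1) ℤ.-1ℤ f e up (l₂ z z′ z″ α β c)))
          (mkSkew (rotate-enum (swap-enum enV)) (z′ -ᶻ α) (β -ᶻ α) ≈-refl (combine₁ ℤ.-1ℤ up (l₃ z z′ α β)) (combine₁ ℤ.-1ℤ up (l₄ z z′ α β)))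
          (total-skew (combine₂ (+ 1) (+ 1) f up (l₅ z z′ z″ α β c)))
        where
        l₁ : ∀ α β → α ≡ β -ᶻ (β -ᶻ α)
        l₁ = ℤR.solve-∀
        l₂ : ∀ z z′ z″ α β c → c -ᶻ (β -ᶻ + 3 *ᶻ (β -ᶻ α)) ≡ ℤ.-1ℤ *ᶻ ((z″ -ᶻ c) -ᶻ (z′ -ᶻ α)) +ᶻ + 1 *ᶻ ((z″ -ᶻ α) -ᶻ (z -ᶻ β)) +ᶻ ℤ.-1ℤ *ᶻ ((z′ -ᶻ β) -ᶻ (z -ᶻ α))
        l₂ = ℤR.solve-∀
        l₃ : ∀ z z′ α β → (z -ᶻ α) -ᶻ ((z′ -ᶻ α) -ᶻ (β -ᶻ α)) ≡ ℤ.-1ℤ *ᶻ ((z′ -ᶻ β) -ᶻ (z -ᶻ α))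
        l₃ = ℤR.solve-∀
        l₄ : ∀ z z′ α β → (z -ᶻ β) -ᶻ ((z′ -ᶻ α) -ᶻ + 2 *ᶻ (β -ᶻ α)) ≡ ℤ.-1ℤ *ᶻ ((z′ -ᶻ β) -ᶻ (z -ᶻ α))
        l₄ = ℤR.solve-∀
        l₅ : ∀ z z′ z″ α β c → ((z″ -ᶻ c) -ᶻ (z -ᶻ α)) -ᶻ (β -ᶻ α) ≡ + 1 *ᶻ ((z″ -ᶻ c) -ᶻ (z′ -ᶻ α)) +ᶻ + 1 *ᶻ ((z′ -ᶻ β) -ᶻ (z -ᶻ α))
        l₅ = ℤR.solve-∀

      upper : z″ -ᶻ β ≈ z′ -ᶻ α → z″ -ᶻ c ≈ z -ᶻ β → Shape K V F
      upper e f = skew (α -ᶻ β)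
          (mkSkew enK α (α -ᶻ β) ≈-refl (≡⇒≈ (l₁ β α)) (combine₃ ℤ.-1ℤ (+ 1) (+ 1) f e up (l₂ z z′ z″ α β c)))
          (mkSkew (rotate-enum enV) (z -ᶻ β) (α -ᶻ β) ≈-refl (≡⇒≈ (l₃ z α β)) (combine₁ (+ 1) up (l₄ z z′ α β)))
          (total-skew (combine₁ (+ 1) f (l₅ z z″ α β c)))
        where
        l₁ : ∀ α β → α ≡ β -ᶻ (β -ᶻ α)
        l₁ = ℤR.solve-∀
        l₂ : ∀ z z′ z″ α β c → c -ᶻ (α -ᶻ + 3 *ᶻ (α -ᶻ β)) ≡ ℤ.-1ℤ *ᶻ ((z″ -ᶻ c) -ᶻ (z -ᶻ β)) +ᶻ + 1 *ᶻ ((z″ -ᶻ β) -ᶻ (z′ -ᶻ α)) +ᶻ + 1 *ᶻ ((z′ -ᶻ β) -ᶻ (z -ᶻ α))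
        l₂ = ℤR.solve-∀
        l₃ : ∀ z α β → (z -ᶻ α) ≡ ((z -ᶻ β) -ᶻ (α -ᶻ β))
        l₃ = ℤR.solve-∀
        l₄ : ∀ z z′ α β → (z′ -ᶻ α) -ᶻ ((z -ᶻ β) -ᶻ + 2 *ᶻ (α -ᶻ β)) ≡ + 1 *ᶻ ((z′ -ᶻ β) -ᶻ (z -ᶻ α))
        l₄ = ℤR.solve-∀
        l₅ : ∀ z z″ α β c → ((z″ -ᶻ c) -ᶻ (z -ᶻ α)) -ᶻ (α -ᶻ β) ≡ + 1 *ᶻ ((z″ -ᶻ c) -ᶻ (z -ᶻ β))
        l₅ = ℤR.solve-∀

      α-row : Inside (z″ -ᶻ α) → z″ -ᶻ α ≈ z -ᶻ β
      α-row (inj₁ e) = ⊥-elim (z″≉z (diff-cancel α e))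
      α-row (inj₂ (inj₁ e)) = e
      α-row (inj₂ (inj₂ e)) = ⊥-elim (z″≉z′ (diff-cancel α e))

      β-row : Inside (z″ -ᶻ β) → z″ -ᶻ β ≈ z′ -ᶻ α
      β-row (inj₁ e) = ⊥-elim (z″≉z′ (diff-cancel β (≈-trans e (≈-sym up))))
      β-row (inj₂ (inj₁ e)) = ⊥-elim (z″≉z (diff-cancel β e))
      β-row (inj₂ (inj₂ e)) = e

      -- z″ - α and z″ - β would be the two extremes of V, so the progression would wrap around with
      -- 3 (β - α) ≡ 0.
      αβ : Inside (z″ -ᶻ α) → Inside (z″ -ᶻ β) → Shape K V F
      αβ i j = ⊥-elim (3≉0 (sub≉0 (≉-sym (Enum₃.x≉y enK))) (combine₃ (+ 1) ℤ.-1ℤ ℤ.-1ℤ (α-row i) (β-row j) up (lem z z′ z″ α β)))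
        where lem : ∀ z z′ z″ α β → + 3 *ᶻ (β -ᶻ α) -ᶻ + 0 ≡ + 1 *ᶻ ((z″ -ᶻ α) -ᶻ (z -ᶻ β)) +ᶻ ℤ.-1ℤ *ᶻ ((z″ -ᶻ β) -ᶻ (z′ -ᶻ α)) +ᶻ ℤ.-1ℤ *ᶻ ((z′ -ᶻ β) -ᶻ (z -ᶻ α))
              lem = ℤR.solve-∀

      αc : Inside (z″ -ᶻ α) → Inside (z″ -ᶻ c) → Shape K V F
      αc i (inj₁ e) = middle e
      αc i (inj₂ (inj₁ e)) = ⊥-elim (Enum₃.x≉z enK (sub-cancel z″ (≈-trans (α-row i) (≈-sym e))))
      αc i (inj₂ (inj₂ e)) = lower (α-row i) e

      βc : Inside (z″ -ᶻ β) → Inside (z″ -ᶻ c) → Shape K V F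
      βc i (inj₁ e) = middle e
      βc i (inj₂ (inj₁ e)) = upper (β-row i) e
      βc i (inj₂ (inj₂ e)) = ⊥-elim (Enum₃.y≉z enK (sub-cancel z″ (≈-trans (β-row i) (≈-sym e))))

      shape : Shape K V F
      shape = go (Enum₃.only enK α∈) (Enum₃.only enK β∈)
        where
        open TwoReps (reps (Enum₃.z∈ enF)) renaming (α to κ₁; β to κ₂)
        at : ∀ {k k′} → k ≈ k′ → z″ -ᶻ k ∈ V → Inside (z″ -ᶻ k′)
        at {k} {k′} e m = Enum₃.only enV (∈-resp V {z″ -ᶻ k} {z″ -ᶻ k′} (-‿cong≈ (≈-refl {z″}) e) m)
        clash : ∀ {A : Set} {k} → κ₁ ≈ k → κ₂ ≈ k → A
        clash e f = ⊥-elim (α≉β (≈-trans e (≈-sym f)))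
        go : (κ₁ ≈ α ⊎ κ₁ ≈ β ⊎ κ₁ ≈ c) → (κ₂ ≈ α ⊎ κ₂ ≈ β ⊎ κ₂ ≈ c) → Shape K V F
        go (inj₁ e) (inj₁ f) = clash e f
        go (inj₁ e) (inj₂ (inj₁ f)) = αβ (at e z-α∈) (at f z-β∈)
        go (inj₁ e) (inj₂ (inj₂ f)) = αc (at e z-α∈) (at f z-β∈)
        go (inj₂ (inj₁ e)) (inj₁ f) = αβ (at f z-β∈) (at e z-α∈)
        go (inj₂ (inj₁ e)) (inj₂ (inj₁ f)) = clash e f
        go (inj₂ (inj₁ e)) (inj₂ (inj₂ f)) = βc (at e z-α∈) (at f z-β∈)
        go (inj₂ (inj₂ e)) (inj₁ f) = αc (at f z-β∈) (at e z-α∈)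
        go (inj₂ (inj₂ e)) (inj₂ (inj₁ f)) = βc (at f z-β∈) (at e z-α∈)
        go (inj₂ (inj₂ e)) (inj₂ (inj₂ f)) = clash e f

    -- The four elements z - α, z - β, z′ - α, z′ - β of V cannot be distinct; exchanging z and z′
    -- if necessary gives z′ - β = z - α.
    shared-column : ∀ {z z′ α β c} → z ∈ F → z′ ∈ F → z ≉ z′ → Enum₃ K α β c →
                    z -ᶻ α ∈ V → z -ᶻ β ∈ V → z′ -ᶻ α ∈ V → z′ -ᶻ β ∈ V → Shape K V F
    shared-column {z} {z′} {α} {β} {c} z∈ z′∈ z≉z′ enK zα zβ z′α z′β = start (enum₃ V zα zβ (zα≉zβ z) cV)
      where
      zα≉zβ : ∀ z → z -ᶻ α ≉ z -ᶻ β
      zα≉zβ z e = Enum₃.x≉y enK (sub-cancel z e)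
      from : ∀ {z z′} → z ∈ F → z′ ∈ F → z ≉ z′ → z -ᶻ α ∈ V → z -ᶻ β ∈ V → z′ -ᶻ α ∈ V → z′ -ᶻ β ≈ z -ᶻ α → Shape K V F
      from {z} {z′} z∈ z′∈ z≉z′ zα zβ z′α up = go (enum₃ F z∈ z′∈ z≉z′ cF) (enum₃ V zα zβ (zα≉zβ z) cV)
        where
        go : (∃ λ z″ → Enum₃ F z z′ z″) → (∃ λ w → Enum₃ V (z -ᶻ α) (z -ᶻ β) w) → Shape K V F
        go (z″ , enF) (w , enV) = Ascending.shape enF enK (replace (third (Enum₃.only enV z′α))) up
          where
          third : (z′ -ᶻ α ≈ z -ᶻ α ⊎ z′ -ᶻ α ≈ z -ᶻ β ⊎ z′ -ᶻ α ≈ w) → w ≈ z′ -ᶻ α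
          third (inj₁ e) = ⊥-elim (z≉z′ (≈-sym (diff-cancel α e)))
          third (inj₂ (inj₂ e)) = ≈-sym e
          third (inj₂ (inj₁ e)) = ⊥-elim (2≉0 (sub≉0 (Enum₃.x≉y enK)) (combine₂ ℤ.-1ℤ (+ 1) e up (lem z z′ α β)))
            where lem : ∀ z z′ α β → + 2 *ᶻ (α -ᶻ β) -ᶻ + 0 ≡ ℤ.-1ℤ *ᶻ ((z′ -ᶻ α) -ᶻ (z -ᶻ β)) +ᶻ + 1 *ᶻ ((z′ -ᶻ β) -ᶻ (z -ᶻ α))
                  lem = ℤR.solve-∀
          replace : w ≈ z′ -ᶻ α → Enum₃ V (z -ᶻ α) (z -ᶻ β) (z′ -ᶻ α)
          replace e = record
            { x∈ = zα ; y∈ = zβ ; z∈ = z′α ; x≉y = zα≉zβ z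
            ; x≉z = λ f → Enum₃.x≉z enV (≈-trans f (≈-sym e))
            ; y≉z = λ f → Enum₃.y≉z enV (≈-trans f (≈-sym e))
            ; only = λ m → sub (Enum₃.only enV m)
            ; total = ≈-trans (Enum₃.total enV) (+-cong≈ (≈-refl {z -ᶻ α}) (+-cong≈ (≈-refl {z -ᶻ β}) e)) }
            where
            sub : ∀ {v} → v ≈ z -ᶻ α ⊎ v ≈ z -ᶻ β ⊎ v ≈ w → v ≈ z -ᶻ α ⊎ v ≈ z -ᶻ β ⊎ v ≈ z′ -ᶻ α
            sub (inj₁ f) = inj₁ f
            sub (inj₂ (inj₁ f)) = inj₂ (inj₁ f)
            sub (inj₂ (inj₂ f)) = inj₂ (inj₂ (≈-trans f e))
      start : (∃ λ w → Enum₃ V (z -ᶻ α) (z -ᶻ β) w) → Shape K V F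
      start (w , enV) = go (Enum₃.only enV z′α) (Enum₃.only enV z′β)
        where
        go : (z′ -ᶻ α ≈ z -ᶻ α ⊎ z′ -ᶻ α ≈ z -ᶻ β ⊎ z′ -ᶻ α ≈ w) → (z′ -ᶻ β ≈ z -ᶻ α ⊎ z′ -ᶻ β ≈ z -ᶻ β ⊎ z′ -ᶻ β ≈ w) → Shape K V F
        go (inj₁ e) _ = ⊥-elim (z≉z′ (≈-sym (diff-cancel α e)))
        go _ (inj₂ (inj₁ f)) = ⊥-elim (z≉z′ (≈-sym (diff-cancel β f)))
        go _ (inj₁ f) = from z∈ z′∈ z≉z′ zα zβ z′α f
        go (inj₂ (inj₁ e)) _ = from z′∈ z∈ (≉-sym z≉z′) z′α z′β zα (≈-sym e)
        go (inj₂ (inj₂ e)) (inj₂ (inj₂ f)) = ⊥-elim (Enum₃.x≉y enK (sub-cancel z′ (≈-trans e (≈-sym f))))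

  -- `c` and `r` are the elements of K and V left over by two representations of z; `double` adds
  -- these two representations.
  record Missing (K V : PSet) (z : ℤ) : Set where
    field
      {α β c r} : ℤ
      enK : Enum₃ K α β c
      enV : Enum₃ V (z -ᶻ α) (z -ᶻ β) r
    double : + 2 *ᶻ z +ᶻ (r +ᶻ c) ≈ wsum V +ᶻ wsum K
    double = combine₂ ℤ.-1ℤ ℤ.-1ℤ (Enum₃.total enV) (Enum₃.total enK) (lem z α β c r (wsum V) (wsum K))
      where lem : ∀ z α β c r v k → (+ 2 *ᶻ z +ᶻ (r +ᶻ c)) -ᶻ (v +ᶻ k) ≡ ℤ.-1ℤ *ᶻ (v -ᶻ ((z -ᶻ α) +ᶻ ((z -ᶻ β) +ᶻ r))) +ᶻ ℤ.-1ℤ *ᶻ (k -ᶻ (α +ᶻ (β +ᶻ c)))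
            lem = ℤR.solve-∀
    column : ∀ {k} → k ∈ K → k ≉ c → z -ᶻ k ∈ V
    column {k} m n = go (Enum₃.only enK m)
      where
      go : k ≈ α ⊎ k ≈ β ⊎ k ≈ c → z -ᶻ k ∈ V
      go (inj₁ e) = ∈-resp V {z -ᶻ α} {z -ᶻ k} (-‿cong≈ (≈-refl {z}) (≈-sym e)) (Enum₃.x∈ enV)
      go (inj₂ (inj₁ e)) = ∈-resp V {z -ᶻ β} {z -ᶻ k} (-‿cong≈ (≈-refl {z}) (≈-sym e)) (Enum₃.y∈ enV)
      go (inj₂ (inj₂ e)) = ⊥-elim (n e)

  missing : ∀ K V {z} → card K ≡ 3 → card V ≡ 3 → TwoReps K V z → Missing K V z
  missing K V {z} cK cV r = go (enum₃ K α∈ β∈ α≉β cK) (enum₃ V z-α∈ z-β∈ (λ e → α≉β (sub-cancel z e)) cV)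
    where
    open TwoReps r
    go : (∃ λ c → Enum₃ K α β c) → (∃ λ r → Enum₃ V (z -ᶻ α) (z -ᶻ β) r) → Missing K V z
    go (c , enK) (r , enV) = record { enK = enK ; enV = enV }

  flip-reps : ∀ {K V z} → TwoReps K V z → TwoReps V K z
  flip-reps {K} {V} {z} r = twoReps {α = z -ᶻ α} {β = z -ᶻ β} (λ e → α≉β (sub-cancel z e)) z-α∈ z-β∈
      (subst (_∈ K) (sym (lem z α)) α∈) (subst (_∈ K) (sym (lem z β)) β∈)
    where
    open TwoReps r
    lem : ∀ z α → z -ᶻ (z -ᶻ α) ≡ α
    lem = ℤR.solve-∀

  -- If two elements of F leave over the same c, `shared-column` applies; if the same r, it applies
  -- with K and V exchanged. Otherwise the three c exhaust K and the three r exhaust V, and the sum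
  -- of the three relations `double` is twice the barycentric one.
  classify : ∀ K V F → 5 < p → card K ≡ 3 → card V ≡ 3 → card F ≡ 3 → (∀ {z} → z ∈ F → TwoReps K V z) → Column K V F
  classify K V F 5<p cK cV cF reps = start (two-elements F (subst (2 ≤_) (sym cF) (s≤s (s≤s z≤n))))
    where
    fromK : Shape K V F → Column K V F
    fromK (barycentric e) = barycentric e
    fromK (skew δ s _ e) = skew δ 3 (inj₁ refl) s e
    fromV : Shape V K F → Column K V F
    fromV (barycentric e) = barycentric (≈-trans e (≡⇒≈ (ℤP.+-comm (wsum K) (wsum V))))
    fromV (skew δ _ s e) = skew δ 2 (inj₂ refl) s (≈-trans e (≡⇒≈ (cong (_+ᶻ δ) (ℤP.+-comm (wsum K) (wsum V)))))
    row : ∀ {z} → z ∈ F → Missing K V z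
    row m = missing K V cK cV (reps m)
    same-column : ∀ {z z′} (m : z ∈ F) (m′ : z′ ∈ F) → z ≉ z′ → Missing.c (row m) ≈ Missing.c (row m′) → Column K V F
    same-column m m′ n e = fromK (Classify.shared-column K V F 5<p cK cV cF reps m m′ n (Missing.enK (row m))
        (Enum₃.x∈ (Missing.enV (row m))) (Enum₃.y∈ (Missing.enV (row m)))
        (Missing.column (row m′) (Enum₃.x∈ enK) (λ f → Enum₃.x≉z enK (≈-trans f (≈-sym e))))
        (Missing.column (row m′) (Enum₃.y∈ enK) (λ f → Enum₃.y≉z enK (≈-trans f (≈-sym e)))))
      where enK = Missing.enK (row m)
    same-row : ∀ {z z′} (m : z ∈ F) (m′ : z′ ∈ F) → z ≉ z′ → Missing.r (row m) ≈ Missing.r (row m′) → Column K V F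
    same-row {z} {z′} m m′ n e = fromV (Classify.shared-column V K F 5<p cV cK cF (λ h → flip-reps (reps h)) m m′ n enV
        (subst (_∈ K) (sym (lem z α)) (Enum₃.x∈ enK)) (subst (_∈ K) (sym (lem z β)) (Enum₃.y∈ enK))
        (in-row (Enum₃.x∈ enV) (λ f → Enum₃.x≉z enV (≈-trans f (≈-sym e))))
        (in-row (Enum₃.y∈ enV) (λ f → Enum₃.y≉z enV (≈-trans f (≈-sym e)))))
      where
      open Missing (row m)
      lem : ∀ z α → z -ᶻ (z -ᶻ α) ≡ α
      lem = ℤR.solve-∀
      module M′ = Missing (row m′)
      in-row : ∀ {v} → v ∈ V → v ≉ M′.r → z′ -ᶻ v ∈ K
      in-row {v} v∈ v≉ = go (Enum₃.only M′.enV v∈)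
        where
        go : v ≈ z′ -ᶻ M′.α ⊎ v ≈ z′ -ᶻ M′.β ⊎ v ≈ M′.r → z′ -ᶻ v ∈ K
        go (inj₁ f) = ∈-resp K {M′.α} {z′ -ᶻ v} (sub-flip z′ (≈-sym f)) (Enum₃.x∈ M′.enK)
        go (inj₂ (inj₁ f)) = ∈-resp K {M′.β} {z′ -ᶻ v} (sub-flip z′ (≈-sym f)) (Enum₃.y∈ M′.enK)
        go (inj₂ (inj₂ f)) = ⊥-elim (v≉ f)
    total-of : ∀ S {x y z} → card S ≡ 3 → x ∈ S → y ∈ S → z ∈ S → x ≉ y → x ≉ z → y ≉ z → wsum S ≈ x +ᶻ (y +ᶻ z)
    total-of S {x} {y} {z} cS x∈ y∈ z∈ x≉y x≉z y≉z = go (enum₃ S x∈ y∈ x≉y cS)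
      where
      go : (∃ λ w → Enum₃ S x y w) → wsum S ≈ x +ᶻ (y +ᶻ z)
      go (w , en) = ≈-trans (Enum₃.total en) (+-cong≈ (≈-refl {x}) (+-cong≈ (≈-refl {y}) (last (Enum₃.only en z∈))))
        where
        last : z ≈ x ⊎ z ≈ y ⊎ z ≈ w → w ≈ z
        last (inj₁ e) = ⊥-elim (x≉z (≈-sym e))
        last (inj₂ (inj₁ e)) = ⊥-elim (y≉z (≈-sym e))
        last (inj₂ (inj₂ e)) = ≈-sym e
    start : (∃ λ x → ∃ λ y → x ∈ F × y ∈ F × x ≉ y) → Column K V F
    start (x , y , x∈ , y∈ , x≉y) = next (enum₃ F x∈ y∈ x≉y cF)
      where
      next : (∃ λ z → Enum₃ F x y z) → Column K V F
      next (z , en) = columns (c₁ ≈? c₂) (c₁ ≈? c₃) (c₂ ≈? c₃)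
        where
        z∈ = Enum₃.z∈ en
        open Missing (row x∈) using () renaming (c to c₁; r to r₁; double to double₁; enK to enK₁; enV to enV₁)
        open Missing (row y∈) using () renaming (c to c₂; r to r₂; double to double₂; enK to enK₂; enV to enV₂)
        open Missing (row z∈) using () renaming (c to c₃; r to r₃; double to double₃; enK to enK₃; enV to enV₃)
        distinct : c₁ ≉ c₂ → c₁ ≉ c₃ → c₂ ≉ c₃ → r₁ ≉ r₂ → r₁ ≉ r₃ → r₂ ≉ r₃ → Column K V F
        distinct n₁ n₂ n₃ n₄ n₅ n₆ = barycentric (sub≈0 (cancel≈ 2 (s≤s z≤n) (≤-trans (s≤s (s≤s (s≤s z≤n))) 5<p)
            (combine₃ (+ 2) (+ 1) (+ 1) (Enum₃.total en) (double₁ ⊹ double₂ ⊹ double₃) (sumK ⊹ sumV)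
              (lem x y z c₁ c₂ c₃ r₁ r₂ r₃ (wsum F) (wsum V) (wsum K)))))
          where
          sumK = total-of K cK (Enum₃.z∈ enK₁) (Enum₃.z∈ enK₂) (Enum₃.z∈ enK₃) n₁ n₂ n₃
          sumV = total-of V cV (Enum₃.z∈ enV₁) (Enum₃.z∈ enV₂) (Enum₃.z∈ enV₃) n₄ n₅ n₆
          lem : ∀ x y z c₁ c₂ c₃ r₁ r₂ r₃ f v k → + 2 *ᶻ (f -ᶻ (v +ᶻ k)) -ᶻ + 0 ≡
            + 2 *ᶻ (f -ᶻ (x +ᶻ (y +ᶻ z))) +ᶻ
            + 1 *ᶻ (((+ 2 *ᶻ x +ᶻ (r₁ +ᶻ c₁)) +ᶻ ((+ 2 *ᶻ y +ᶻ (r₂ +ᶻ c₂)) +ᶻ (+ 2 *ᶻ z +ᶻ (r₃ +ᶻ c₃)))) -ᶻ ((v +ᶻ k) +ᶻ ((v +ᶻ k) +ᶻ (v +ᶻ k)))) +ᶻ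
            + 1 *ᶻ ((k +ᶻ v) -ᶻ ((c₁ +ᶻ (c₂ +ᶻ c₃)) +ᶻ (r₁ +ᶻ (r₂ +ᶻ r₃))))
          lem = ℤR.solve-∀
        rows : c₁ ≉ c₂ → c₁ ≉ c₃ → c₂ ≉ c₃ → Dec (r₁ ≈ r₂) → Dec (r₁ ≈ r₃) → Dec (r₂ ≈ r₃) → Column K V F
        rows n₁ n₂ n₃ (yes e) _ _ = same-row x∈ y∈ x≉y e
        rows n₁ n₂ n₃ _ (yes e) _ = same-row x∈ z∈ (Enum₃.x≉z en) e
        rows n₁ n₂ n₃ _ _ (yes e) = same-row y∈ z∈ (Enum₃.y≉z en) e
        rows n₁ n₂ n₃ (no a) (no b) (no c) = distinct n₁ n₂ n₃ a b c
        columns : Dec (c₁ ≈ c₂) → Dec (c₁ ≈ c₃) → Dec (c₂ ≈ c₃) → Column K V F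
        columns (yes e) _ _ = same-column x∈ y∈ x≉y e
        columns _ (yes e) _ = same-column x∈ z∈ (Enum₃.x≉z en) e
        columns _ _ (yes e) = same-column y∈ z∈ (Enum₃.y≉z en) e
        columns (no a) (no b) (no c) = rows a b c (r₁ ≈? r₂) (r₁ ≈? r₃) (r₂ ≈? r₃)

  -- A finite elimination

  every : ∀ {A : Set} → (A → Bool) → List A → Bool
  every f []       = true
  every f (x ∷ xs) = f x ∧ every f xs

  every-sound : ∀ {A : Set} (f : A → Bool) xs → every f xs ≡ true → ∀ {x} → Any (x ≡_) xs → f x ≡ true
  every-sound f (x ∷ xs) h (here refl) = proj₁ (∧-true {f x} h)
  every-sound f (x ∷ xs) h (there m)   = every-sound f xs (proj₂ (∧-true {f x} h)) m

  some : ∀ {A : Set} → (A → Bool) → List A → Bool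
  some f []       = false
  some f (x ∷ xs) = f x ∨ some f xs

  some-sound : ∀ {A : Set} (f : A → Bool) xs → some f xs ≡ true → ∃ λ x → Any (x ≡_) xs × f x ≡ true
  some-sound f (x ∷ xs) h with f x in eq
  ... | true  = x , here refl , eq
  ... | false with some-sound f xs h
  ...   | y , m , e = y , there m , e

  isZero : ℤ → Bool
  isZero (+ zero) = true
  isZero _        = false

  isZero-sound : ∀ k → isZero k ≡ true → k ≡ + 0
  isZero-sound (+ zero) _ = refl

  -- Sufficient for invertibility modulo p, since p > 46.
  small : ℤ → Bool
  small k = (0 <ᵇ ℤ.∣ k ∣) ∧ (ℤ.∣ k ∣ <ᵇ 47)

  -- For a `Skew n` set {c, c - δ, c - n δ}: the multiples of δ subtracted from c, and the
  -- differences between two of its points.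
  digits steps : ℤ → List ℤ
  digits n = + 0 ∷ + 1 ∷ n ∷ []
  steps n = + 1 ∷ n ∷ n -ᶻ + 1 ∷ []

  ends : List ℤ
  ends = + 3 ∷ + 2 ∷ []

  lengths : List ℤ
  lengths = + 0 ∷ + 1 ∷ + 2 ∷ + 3 ∷ []

  jumps : List ℤ
  jumps = + 0 ∷ + 1 ∷ + 2 ∷ + 3 ∷ + 4 ∷ + 5 ∷ + 6 ∷ + 7 ∷ + 8 ∷ + 9 ∷
          -[1+ 0 ] ∷ -[1+ 1 ] ∷ -[1+ 2 ] ∷ -[1+ 3 ] ∷ -[1+ 4 ] ∷ -[1+ 5 ] ∷ -[1+ 6 ] ∷ -[1+ 7 ] ∷ -[1+ 8 ] ∷ []

  -- When a f ≡ b g and δ ≡ f + 4 g, the number tested is the coefficient in a (d δ + j g) ≡ (a j +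
  -- (b + 4 a) d) g. If it is 0 and a is invertible, two ends of A differ by a multiple of g too
  -- small for the gaps.
  closes : ℤ → ℤ → ℤ → ℤ → Bool
  closes a b d j = isZero (a *ᶻ j +ᶻ (b +ᶻ + 4 *ᶻ a) *ᶻ d)

  gapped : ℤ → ℤ → ℤ → Bool
  gapped n a b = (isZero a ∧ small b) ∨
    (small a ∧ some (λ d → some (closes a b d) jumps) (steps n))

  -- With f and f + 4 g the steps of the (-g)-ends and the g-ends, following the
  -- progressions of A from g-ends to (-g)-ends gives a₁ f ≈ b₁ g and a₂ f ≈ b₂ g.
  refuted : ℤ → ℤ → ℤ → ℤ → ℤ → ℤ → ℤ → Bool
  refuted n q₀ q₁ q₂ e₀ e₁ e₂ = small (a₁ *ᶻ b₂ -ᶻ a₂ *ᶻ b₁) ∨ (gapped n a₁ b₁ ∨ gapped n a₂ b₂)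
    where
    a₁ = (q₁ -ᶻ q₀) -ᶻ + 1
    a₂ = (q₂ -ᶻ q₀) -ᶻ n
    b₁ = (e₁ -ᶻ e₀) +ᶻ + 4
    b₂ = (e₂ -ᶻ e₀) +ᶻ + 4 *ᶻ n

  for-all : (ℤ → ℤ → ℤ → ℤ → ℤ → ℤ → ℤ → Bool) → Bool
  for-all f = every (λ n → every (λ l →
    every (λ q₀ → every (λ q₁ → every (λ q₂ →
    every (λ e₀ → every (λ e₁ → every (λ e₂ → f n q₀ q₁ q₂ e₀ e₁ e₂)
    lengths) lengths) lengths) (digits l)) (digits l)) (digits l)) ends) ends

  -- 2 · 2 · 27 · 64 = 6912 cases, decided by evaluation.
  all-refuted : for-all refuted ≡ true
  all-refuted = refl

  for-all-sound : ∀ f → for-all f ≡ true → ∀ {n l q₀ q₁ q₂ e₀ e₁ e₂} →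
    Any (n ≡_) ends → Any (l ≡_) ends → Any (q₀ ≡_) (digits l) → Any (q₁ ≡_) (digits l) → Any (q₂ ≡_) (digits l) →
    Any (e₀ ≡_) lengths → Any (e₁ ≡_) lengths → Any (e₂ ≡_) lengths → f n q₀ q₁ q₂ e₀ e₁ e₂ ≡ true
  for-all-sound f h {n} {l} {q₀} {q₁} {q₂} {e₀} {e₁} {e₂} mn ml m₀ m₁ m₂ k₀ k₁ k₂ =
    every-sound (λ e₂ → f n q₀ q₁ q₂ e₀ e₁ e₂) lengths
    (every-sound (λ e₁ → every (λ e₂ → f n q₀ q₁ q₂ e₀ e₁ e₂) lengths) lengths
    (every-sound (λ e₀ → every (λ e₁ → every (λ e₂ → f n q₀ q₁ q₂ e₀ e₁ e₂) lengths) lengths) lengths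
    (every-sound (λ q₂ → every (λ e₀ → every (λ e₁ → every (λ e₂ → f n q₀ q₁ q₂ e₀ e₁ e₂) lengths) lengths) lengths) (digits l)
    (every-sound (λ q₁ → every (λ q₂ → every (λ e₀ → every (λ e₁ → every (λ e₂ → f n q₀ q₁ q₂ e₀ e₁ e₂) lengths) lengths) lengths) (digits l)) (digits l)
    (every-sound (λ q₀ → every (λ q₁ → every (λ q₂ → every (λ e₀ → every (λ e₁ → every (λ e₂ → f n q₀ q₁ q₂ e₀ e₁ e₂) lengths) lengths) lengths) (digits l)) (digits l)) (digits l)
    (every-sound (λ l → every (λ q₀ → every (λ q₁ → every (λ q₂ → every (λ e₀ → every (λ e₁ → every (λ e₂ → f n q₀ q₁ q₂ e₀ e₁ e₂) lengths) lengths) lengths) (digits l)) (digits l)) (digits l)) ends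
    (every-sound (λ n → every (λ l → every (λ q₀ → every (λ q₁ → every (λ q₂ → every (λ e₀ → every (λ e₁ → every (λ e₂ → f n q₀ q₁ q₂ e₀ e₁ e₂) lengths) lengths) lengths) (digits l)) (digits l)) (digits l)) ends) ends h
    mn) ml) m₀) m₁) m₂) k₀) k₁) k₂

  module Elimination (46<p : 46 < p) {f g δ : ℤ} (g≉0 : g ≉ + 0) (slope : δ ≈ f +ᶻ + 4 *ᶻ g) where

    cancel-small : ∀ k {x} → small k ≡ true → k *ᶻ x ≈ + 0 → x ≈ + 0
    cancel-small k {x} h e = go k refl (proj₁ bounds) (≤-trans (proj₂ bounds) 46<p)
      where
      bounds : 0 < ℤ.∣ k ∣ × ℤ.∣ k ∣ < 47
      bounds = let (u , v) = ∧-true {0 <ᵇ ℤ.∣ k ∣} h in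
        <ᵇ⇒< 0 ℤ.∣ k ∣ (subst T (sym u) _) , <ᵇ⇒< ℤ.∣ k ∣ 47 (subst T (sym v) _)
      lem : ∀ m x → m *ᶻ x -ᶻ + 0 ≡ ℤ.-1ℤ *ᶻ ((-ᶻ m) *ᶻ x -ᶻ + 0)
      lem = ℤR.solve-∀
      go : ∀ j → k ≡ j → 0 < ℤ.∣ k ∣ → ℤ.∣ k ∣ < p → x ≈ + 0
      go (+ m) refl l u = cancel≈ m l u e
      go -[1+ m ] refl l u = cancel≈ (suc m) l u (combine₁ ℤ.-1ℤ e (lem (+ suc m) x))

    NoGap : ℤ → Set
    NoGap n = ∀ {d j} → Any (d ≡_) (steps n) → Any (j ≡_) jumps → d *ᶻ δ +ᶻ j *ᶻ g ≉ + 0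

    gapped-sound : ∀ n a b → gapped n a b ≡ true → a *ᶻ f ≈ b *ᶻ g → NoGap n → ⊥
    gapped-sound n a b h e nogap = go (∨-true {isZero a ∧ small b} h)
      where
      lem₀ : ∀ f g a b → b *ᶻ g -ᶻ + 0 ≡ ℤ.-1ℤ *ᶻ (a *ᶻ f -ᶻ b *ᶻ g) +ᶻ f *ᶻ (a -ᶻ + 0)
      lem₀ = ℤR.solve-∀
      lem : ∀ f g δ a b d j → a *ᶻ (d *ᶻ δ +ᶻ j *ᶻ g) -ᶻ + 0 ≡
            d *ᶻ (a *ᶻ f -ᶻ b *ᶻ g) +ᶻ (a *ᶻ d) *ᶻ (δ -ᶻ (f +ᶻ + 4 *ᶻ g)) +ᶻ g *ᶻ ((a *ᶻ j +ᶻ (b +ᶻ + 4 *ᶻ a) *ᶻ d) -ᶻ + 0)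
      lem = ℤR.solve-∀
      go : isZero a ∧ small b ≡ true ⊎ small a ∧ some (λ d → some (closes a b d) jumps) (steps n) ≡ true → ⊥
      go (inj₁ z) = let (u , v) = ∧-true {isZero a} z in
        g≉0 (cancel-small b v (combine₂ ℤ.-1ℤ f e (≡⇒≈ (isZero-sound a u)) (lem₀ f g a b)))
      go (inj₂ s) with ∧-true {small a} s
      ... | u , v with some-sound (λ d → some (closes a b d) jumps) (steps n) v
      ...   | d , d∈ , w with some-sound (closes a b d) jumps w
      ...     | j , j∈ , z = nogap d∈ j∈ (cancel-small a u
                  (combine₃ d (a *ᶻ d) g e slope (≡⇒≈ (isZero-sound (a *ᶻ j +ᶻ (b +ᶻ + 4 *ᶻ a) *ᶻ d) z)) (lem f g δ a b d j)))

    -- Eliminating f from the two relations leaves (a₁ b₂ - a₂ b₁) g ≡ 0, so an invertible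
    -- determinant is absurd; in the other cases a single relation already violates g ≉ 0 or the
    -- gaps.
    refuted-sound : ∀ n q₀ q₁ q₂ e₀ e₁ e₂ → refuted n q₀ q₁ q₂ e₀ e₁ e₂ ≡ true →
      ((q₁ -ᶻ q₀) -ᶻ + 1) *ᶻ f ≈ ((e₁ -ᶻ e₀) +ᶻ + 4) *ᶻ g →
      ((q₂ -ᶻ q₀) -ᶻ n) *ᶻ f ≈ ((e₂ -ᶻ e₀) +ᶻ + 4 *ᶻ n) *ᶻ g → NoGap n → ⊥
    refuted-sound n q₀ q₁ q₂ e₀ e₁ e₂ h s₁ s₂ nogap = go (∨-true {small (a₁ *ᶻ b₂ -ᶻ a₂ *ᶻ b₁)} h)
      where
      a₁ = (q₁ -ᶻ q₀) -ᶻ + 1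
      a₂ = (q₂ -ᶻ q₀) -ᶻ n
      b₁ = (e₁ -ᶻ e₀) +ᶻ + 4
      b₂ = (e₂ -ᶻ e₀) +ᶻ + 4 *ᶻ n
      lem : ∀ f g a₁ a₂ b₁ b₂ → (a₁ *ᶻ b₂ -ᶻ a₂ *ᶻ b₁) *ᶻ g -ᶻ + 0 ≡ a₂ *ᶻ (a₁ *ᶻ f -ᶻ b₁ *ᶻ g) +ᶻ (-ᶻ a₁) *ᶻ (a₂ *ᶻ f -ᶻ b₂ *ᶻ g)
      lem = ℤR.solve-∀
      go : small (a₁ *ᶻ b₂ -ᶻ a₂ *ᶻ b₁) ≡ true ⊎ (gapped n a₁ b₁ ∨ gapped n a₂ b₂) ≡ true → ⊥
      go (inj₁ z) = g≉0 (cancel-small (a₁ *ᶻ b₂ -ᶻ a₂ *ᶻ b₁) z (combine₂ a₂ (-ᶻ a₁) s₁ s₂ (lem f g a₁ a₂ b₁ b₂)))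
      go (inj₂ y) = go′ (∨-true {gapped n a₁ b₁} y)
        where
        go′ : gapped n a₁ b₁ ≡ true ⊎ gapped n a₂ b₂ ≡ true → ⊥
        go′ (inj₁ z) = gapped-sound n a₁ b₁ z s₁ nogap
        go′ (inj₂ z) = gapped-sound n a₂ b₂ z s₂ nogap

    no-slopes : ∀ {n l q₀ q₁ q₂ e₀ e₁ e₂} →
      Any (n ≡_) ends → Any (l ≡_) ends → Any (q₀ ≡_) (digits l) → Any (q₁ ≡_) (digits l) → Any (q₂ ≡_) (digits l) →
      Any (e₀ ≡_) lengths → Any (e₁ ≡_) lengths → Any (e₂ ≡_) lengths →
      ((q₁ -ᶻ q₀) -ᶻ + 1) *ᶻ f ≈ ((e₁ -ᶻ e₀) +ᶻ + 4) *ᶻ g →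
      ((q₂ -ᶻ q₀) -ᶻ n) *ᶻ f ≈ ((e₂ -ᶻ e₀) +ᶻ + 4 *ᶻ n) *ᶻ g → NoGap n → ⊥
    no-slopes {n} {l} {q₀} {q₁} {q₂} {e₀} {e₁} {e₂} mn ml m₀ m₁ m₂ k₀ k₁ k₂ =
      refuted-sound n q₀ q₁ q₂ e₀ e₁ e₂ (for-all-sound refuted all-refuted mn ml m₀ m₁ m₂ k₀ k₁ k₂)

  -- 4-atoms with at least five elements

  E-⊞-comm : ∀ A X g → card (E g (X ⊞ A)) ≡ card (E g (A ⊞ X))
  E-⊞-comm A X g = card-≐ (E g (X ⊞ A)) (E g (A ⊞ X)) (λ z → cong₂ (λ a b → a ∧ not b) (comm z) (comm (z +ᶻ g)))
    where
    comm : ∀ z → χ (X ⊞ A) z ≡ χ (A ⊞ X) z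
    comm z = bool-ext (λ e → holds (⊞-comm X A (mem {z} e))) (λ e → holds (⊞-comm A X (mem {z} e)))

  double-⊔> : ∀ A X g → Double A X → Double (A ⊔> g) X
  double-⊔> A X g dbl {z} β m = go (⊔>-elim (A ⊞ X) {g} {z} (⊔>-⊞ A X g m))
    where
    lem₁ : ∀ z g α → (z -ᶻ g) -ᶻ α ≡ z -ᶻ (α +ᶻ g)
    lem₁ = ℤR.solve-∀
    lem₂ : ∀ α β g → α -ᶻ (β -ᶻ g) ≡ + 1 *ᶻ ((α +ᶻ g) -ᶻ β)
    lem₂ = ℤR.solve-∀
    go : z ∈ A ⊞ X ⊎ z -ᶻ g ∈ A ⊞ X → ∃ λ α → α ∈ A ⊔> g × α ≉ β × z -ᶻ α ∈ X
    go (inj₁ h) = let (α , α∈ , n , x∈) = dbl β h in α , ⊔>-introˡ A α∈ , n , x∈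
    go (inj₂ h) = let (α , α∈ , n , x∈) = dbl (β -ᶻ g) h in
      α +ᶻ g , ⊔>-introʳ A {g} {α +ᶻ g} (subst (_∈ A) (sym (x+g-g α g)) α∈) ,
      (λ e → n (combine₁ (+ 1) e (lem₂ α β g))) , subst (_∈ X) (lem₁ z g α) x∈

  -- Each progression grows by one step; an end disappears when its progression reaches the next
  -- one.
  E-⊔>⊆ : ∀ S g → E g (S ⊔> g) ⊆ E g S +> g
  E-⊔>⊆ S g {x} m = go (E-elim (S ⊔> g) m)
    where
    go : x ∈ S ⊔> g × x +ᶻ g ∉ S ⊔> g → x ∈ E g S +> g
    go (x∈ , x+g∉) = mem (holds (E-intro S (in-S (⊔>-elim S {g} {x} x∈)) (nonmem (trans (cong (χ S) (x-g+g x g)) (fails x∉)))))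
      where
      x∉ : x ∉ S
      x∉ = not-S (member? x S)
        where
        not-S : x ∈ S ⊎ x ∉ S → x ∉ S
        not-S (inj₂ n) = n
        not-S (inj₁ h) = ∈∉-⊥ (⊔>-introʳ S {g} {x +ᶻ g} (subst (_∈ S) (sym (x+g-g x g)) h)) x+g∉
      in-S : x ∈ S ⊎ x -ᶻ g ∈ S → x -ᶻ g ∈ S
      in-S (inj₁ h) = ∈∉-⊥ h x∉
      in-S (inj₂ h) = h

  four-elements : ∀ S {x y z w} → x ∈ S → y ∈ S → z ∈ S → w ∈ S →
                  x ≉ y → x ≉ z → x ≉ w → y ≉ z → y ≉ w → z ≉ w → 4 ≤ card S
  four-elements S {x} {y} {z} {w} x∈ y∈ z∈ w∈ n₁ n₂ n₃ n₄ n₅ n₆ =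
    subst (4 ≤_) (sym (trans (card-∖ S x∈) (cong suc (trans (card-∖ (S ∖ x) y∈′) (cong suc (card-∖ (S ∖ x ∖ y) z∈′))))))
      (s≤s (s≤s (s≤s (card-pos (S ∖ x ∖ y ∖ z) w∈′))))
    where
    y∈′ : y ∈ S ∖ x
    y∈′ = ∖-intro S y∈ (≉-sym n₁)
    z∈′ : z ∈ S ∖ x ∖ y
    z∈′ = ∖-intro (S ∖ x) (∖-intro S z∈ (≉-sym n₂)) (≉-sym n₄)
    w∈′ : w ∈ S ∖ x ∖ y ∖ z
    w∈′ = ∖-intro (S ∖ x ∖ y) (∖-intro (S ∖ x) (∖-intro S w∈ (≉-sym n₃)) (≉-sym n₅)) (≉-sym n₆)

  module FourAtoms (46<p : 46 < p) {X A} (atom : Atom 4 X A) (4≤X : 4 ≤ card X) (X+42<p : card X + 42 < p)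
                   (5≤A : 5 ≤ card A) (Z≤ : card (A ⊞ X) ≤ card A + card X + 1) where

    open AtomProperties atom (s≤s z≤n) (≤-trans (s≤s z≤n) 4≤X)

    private
      Z = A ⊞ X
      a = card A
      n = card X

    overlap≤3 : ∀ g → g ≉ + 0 → card (A ⊓> g) ≤ 3
    overlap≤3 g g≉0 = ≤-pred (overlap-bound g g≉0)

    dbl : Double A X
    dbl = double 5≤A

    fits : ∀ {m} → m ≤ 43 → n + m ≤ p
    fits m≤ = ≤-trans (+-monoʳ-≤ n m≤) (≤-trans (≤-reflexive (+-suc n 42)) X+42<p)

    0<X : 0 < n
    0<X = ≤-trans (s≤s z≤n) 4≤X

    X⊞A≤ : card (X ⊞ A) ≤ a + n + 1
    X⊞A≤ = subst (_≤ a + n + 1) (card-⊞-comm A X) Z≤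

    X⊞A-room : card (X ⊞ A) + 2 ≤ p
    X⊞A-room = subst (λ c → c + 2 ≤ p) (card-⊞-comm A X) (≤-trans (+-monoʳ-≤ (card Z) (s≤s (s≤s z≤n))) (Atom.room atom))

    -- `optimal` says that no competitor has a smaller excess than the pair {0, g}, whose sumset
    -- with A has |A| + |E g A| elements.
    module SmallEnds (g : ℤ) (g≉0 : g ≉ + 0)
      (optimal : ∀ T → 2 ≤ card T → card (T ⊞ A) + 2 ≤ p → a + card (E g A) + card T ≤ card (T ⊞ A) + 2) where

      s = card (E g A)
      t = card (E g X)
      u = card (E g Z)

      s≤3 : s ≤ 3
      s≤3 = ≤-shift (a + n + card (X ⊞ A)) (optimal X (≤-trans (s≤s (s≤s z≤n)) 4≤X) X⊞A-room ⊞≤ X⊞A≤)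
              (lem₁ a s n (card (X ⊞ A))) (lem₂ a n (card (X ⊞ A)))
        where
        lem₁ : ∀ a s n z → a + s + n + z ≡ s + (a + n + z)
        lem₁ = ℕR.solve-∀
        lem₂ : ∀ a n z → z + 2 + (a + n + 1) ≡ 3 + (a + n + z)
        lem₂ = ℕR.solve-∀

      c+s : card (A ⊓> g) + s ≡ a
      c+s = card-⊓> A g

      A≤6 : a ≤ 6
      A≤6 = ≤-trans (≤-reflexive (sym c+s)) (+-mono-≤ (overlap≤3 g g≉0) s≤3)

      Z≤n+7 : card Z ≤ n + 7
      Z≤n+7 = ≤-trans Z≤ (≤-trans (+-monoˡ-≤ 1 (+-monoˡ-≤ n A≤6)) (≤-reflexive (lem n)))
        where lem : ∀ n → 6 + n + 1 ≡ n + 7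
              lem = ℕR.solve-∀

      grow : ∀ h → card (E h A) ≤ card (E h Z)
      grow h = growth′ h (≤-trans (+-monoˡ-≤ 4 (+-mono-≤ Z≤n+7 (≤-trans (E≤card A h) A≤6)))
        (≤-trans (≤-reflexive (lem n)) (≤-trans (fits (m≤m+n 17 26)) (n≤1+n p))))
        where lem : ∀ n → n + 7 + 6 + 4 ≡ n + 17
              lem = ℕR.solve-∀

      three-ends : ∀ h → h ≉ + 0 → 3 ≤ card (E h X)
      three-ends h h≉0 = three-endpoints A X h h≉0 dbl (grow h) (E-pos A h≉0 0<A A<p) (≤-<-trans (E≤card A h) A<p)

      pair-expands : ∀ S {x y} → x ∈ S → y ∈ S → x ≉ y → n + 3 ≤ card (S ⊞ X)
      pair-expands S {x} {y} x∈ y∈ x≉y = ≤-trans (+-monoʳ-≤ n (three-ends (y -ᶻ x) (sub≉0 (≉-sym x≉y)))) (pair-sumset S X x∈ y∈)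

      pair-expands′ : ∀ S → 2 ≤ card S → n + 3 ≤ card (S ⊞ X)
      pair-expands′ S h = go (two-elements S h)
        where
        go : (∃ λ x → ∃ λ y → x ∈ S × y ∈ S × x ≉ y) → n + 3 ≤ card (S ⊞ X)
        go (x , y , x∈ , y∈ , x≉y) = pair-expands S x∈ y∈ x≉y

      -- If |D + X| = |X| + 3, all pairs in D generate D + X, so D + X is doubly
      -- covered, and its g-ends lie in two columns over the three g-ends of X.
      module Triple (Z≡ : card Z ≡ a + n + 1) (D : PSet) (D≡3 : card D ≡ 3) (D⊞X≤ : card (D ⊞ X) ≤ n + 3) where

        doubleD : Double D X
        doubleD {z} β m = go (⊞-elim (D ∖ β) X (full m))
          where
          2≤D∖β : 2 ≤ card (D ∖ β)
          2≤D∖β = split (member? β D)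
            where
            split : β ∈ D ⊎ β ∉ D → 2 ≤ card (D ∖ β)
            split (inj₁ h) = ≤-pred (≤-reflexive (trans (sym D≡3) (card-∖ D h)))
            split (inj₂ h) = ≤-trans (subst (2 ≤_) (sym D≡3) (s≤s (s≤s z≤n))) (card-mono D (D ∖ β) λ w∈ → ∖-intro D w∈ λ e → ∈∉-⊥ (∈-resp D e w∈) h)
          full : D ⊞ X ⊆ (D ∖ β) ⊞ X
          full = ⊆-card≥ ((D ∖ β) ⊞ X) (D ⊞ X) (⊞-mono (D ∖ β) D X λ h → proj₁ (∖-elim D h)) (≤-trans D⊞X≤ (pair-expands′ (D ∖ β) 2≤D∖β))
          go : (∃ λ α → α ∈ D ∖ β × z -ᶻ α ∈ X) → ∃ λ α → α ∈ D × α ≉ β × z -ᶻ α ∈ X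
          go (α , α∈ , x∈) = α , proj₁ (∖-elim D α∈) , proj₂ (∖-elim D α∈) , x∈

        module _ {x y} (x∈ : x ∈ D) (y∈ : y ∈ D) (x≉y : x ≉ y) where
          h = y -ᶻ x
          h≉0 : h ≉ + 0
          h≉0 = sub≉0 (≉-sym x≉y)
          K = E h D
          V = E h X
          F = E h (D ⊞ X)
          V≡3 : card V ≡ 3
          V≡3 = ≤-antisym (+-cancelˡ-≤ n _ _ (≤-trans (pair-sumset D X x∈ y∈) D⊞X≤)) (three-ends h h≉0)
          K≤2 : card K ≤ 2
          K≤2 = ≤-pred (≤-trans (+-monoˡ-≤ (card K) (card-pos (D ⊓> h) {y} (⊓>-intro D {h} {y} y∈ (subst (_∈ D) (lem x y) x∈))))
                  (≤-reflexive (trans (card-⊓> D h) D≡3)))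
            where lem : ∀ x y → x ≡ y -ᶻ (y -ᶻ x)
                  lem = ℤR.solve-∀
          0<K : 0 < card K
          0<K = E-pos D h≉0 (subst (0 <_) (sym D≡3) (s≤s z≤n)) (subst (_< p) (sym D≡3) (≤-trans (m≤m+n 4 43) 46<p))
          U = D ⊔> h
          -- D + X has excess at most |X|, but D is too small to compete. U does compete, against
          -- the excess |X| + 1 of A, so the passage from D to U must raise the excess. If U leaves
          -- no room, F has at least three elements anyway.
          K<F : suc (card K) ≤ card F
          K<F = by-room (card (U ⊞ X) + 4 ≤? p)
            where
            U-size : card U ≡ 3 + card K
            U-size = trans (card-⊔> D h) (cong (_+ card K) D≡3)
            by-room : Dec (card (U ⊞ X) + 4 ≤ p) → suc (card K) ≤ card F
            by-room (yes r) = ≤-shift (a + n + 3 + card (D ⊞ X))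
              (Atom.minimal atom U (≤-trans (+-monoʳ-≤ 3 0<K) (≤-reflexive (sym U-size))) r ⊞≤ D⊞X≤)
              (trans (cong₂ (λ z u → z + u + card (D ⊞ X)) Z≡ U-size) (lem₁ a n (card K) (card (D ⊞ X))))
              (trans (cong (λ w → w + a + (n + 3)) (card-⊔>-⊞ D X h)) (lem₂ a n (card F) (card (D ⊞ X))))
              where
              lem₁ : ∀ a n k d → a + n + 1 + (3 + k) + d ≡ suc k + (a + n + 3 + d)
              lem₁ = ℕR.solve-∀
              lem₂ : ∀ a n f d → d + f + a + (n + 3) ≡ f + (a + n + 3 + d)
              lem₂ = ℕR.solve-∀
            by-room (no ¬r) = ≤-trans (s≤s K≤2) (≤-shift (p + (n + 7 + card (D ⊞ X))) (≰⇒> ¬r ⊞≤ D⊞X≤ ⊞≤ fits (m≤m+n 9 34))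
              (lem₁ p n (card (D ⊞ X))) (trans (cong (λ w → w + 4 + (n + 3) + p) (card-⊔>-⊞ D X h)) (lem₂ p n (card F) (card (D ⊞ X)))))
              where
              lem₁ : ∀ p n d → suc p + d + (n + 9) ≡ 3 + (p + (n + 7 + d))
              lem₁ = ℕR.solve-∀
              lem₂ : ∀ p n f d → d + f + 4 + (n + 3) + p ≡ f + (p + (n + 7 + d))
              lem₂ = ℕR.solve-∀

          reps : ∀ {z} → z ∈ F → TwoReps K V z
          reps = endpoint-reps D X doubleD {h}

          F≠∅ : ∃ λ z → z ∈ F
          F≠∅ = nonempty F (≤-trans (s≤s z≤n) K<F)

          K≡2 : card K ≡ 2
          K≡2 = go F≠∅
            where
            go : (∃ λ z → z ∈ F) → card K ≡ 2
            go (z , m) = ≤-antisym K≤2 (≤-trans (s≤s (card-pos (K ∖ α) (∖-intro K β∈ (≉-sym α≉β)))) (≤-reflexive (sym (card-∖ K α∈))))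
              where open TwoReps (reps m)

          contradiction : ⊥
          contradiction = go (nonempty K 0<K)
            where
            go : (∃ λ k → k ∈ K) → ⊥
            go (k , k∈) = <⇒≱ (TwoColumns.fewer K V F (proj₂ (enum₂ K k∈ K≡2)) reps
                                 (subst (0 <_) (sym V≡3) (s≤s z≤n)) (subst (_< p) (sym V≡3) (≤-trans (m≤m+n 4 43) 46<p)))
                            (subst₂ _≤_ (sym V≡3) refl (subst (λ k → suc k ≤ card F) K≡2 K<F))

        impossible : ⊥
        impossible = go (two-elements D (subst (2 ≤_) (sym D≡3) (s≤s (s≤s z≤n))))
          where
          go : (∃ λ x → ∃ λ y → x ∈ D × y ∈ D × x ≉ y) → ⊥
          go (x , y , x∈ , y∈ , x≉y) = contradiction x∈ y∈ x≉y

      triple-expands : card Z ≡ a + n + 1 → ∀ D → card D ≡ 3 → n + 4 ≤ card (D ⊞ X)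
      triple-expands Z≡ D D≡3 = ≮⇒≥ λ h → Triple.impossible Z≡ D D≡3 (≤-pred (≤-trans h (≤-reflexive (+-suc n 3))))

      C = A ⊓> g

      2≤C : 2 ≤ card C
      2≤C = ≤-shift (3 + s + a) (5≤A ⊞≤ s≤3 ⊞≤ ≤-reflexive (sym c+s)) (lem₁ s a) (lem₂ s a (card C))
        where
        lem₁ : ∀ s a → 5 + s + a ≡ 2 + (3 + s + a)
        lem₁ = ℕR.solve-∀
        lem₂ : ∀ s a c → a + 3 + (c + s) ≡ c + (3 + s + a)
        lem₂ = ℕR.solve-∀

      2≤s : 2 ≤ s
      2≤s = ≤-shift (3 + card C + a) (5≤A ⊞≤ overlap≤3 g g≉0 ⊞≤ ≤-reflexive (sym c+s)) (lem₁ (card C) a) (lem₂ s a (card C))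
        where
        lem₁ : ∀ c a → 5 + c + a ≡ 2 + (3 + c + a)
        lem₁ = ℕR.solve-∀
        lem₂ : ∀ s a c → a + 3 + (c + s) ≡ s + (3 + c + a)
        lem₂ = ℕR.solve-∀

      -- Minimality cannot be applied to C, which has at most three elements; the inequality it
      -- would give is recovered from the expansion of pairs and triples.
      C-expands : card Z + card C ≤ card (C ⊞ X) + a
      C-expands = by-size (m≤n⇒m<n∨m≡n (overlap≤3 g g≉0))
        where
        size-two : card C ≤ 2 → card Z + card C ≤ card (C ⊞ X) + a
        size-two h = ≤-shift (n + 3) (Z≤ ⊞≤ h ⊞≤ pair-expands′ C 2≤C) refl (lem₂ (card (C ⊞ X)) a n)
          where
          lem₂ : ∀ d a n → a + n + 1 + 2 + d ≡ d + a + (n + 3)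
          lem₂ = ℕR.solve-∀
        size-three : card C ≡ 3 → card Z + card C ≤ card (C ⊞ X) + a
        size-three h = by-Z (m≤n⇒m<n∨m≡n Z≤)
          where
          lem₁ : ∀ d a n → a + n + 1 + 3 + d ≡ d + a + (n + 4)
          lem₁ = ℕR.solve-∀
          lem₂ : ∀ d a n → a + n + 1 + 3 + d ≡ suc (d + a + (n + 3))
          lem₂ = ℕR.solve-∀
          by-Z : card Z < a + n + 1 ⊎ card Z ≡ a + n + 1 → card Z + card C ≤ card (C ⊞ X) + a
          by-Z (inj₂ e) = ≤-shift (n + 4) (Z≤ ⊞≤ ≤-reflexive h ⊞≤ triple-expands e C h) refl (lem₁ (card (C ⊞ X)) a n)
          by-Z (inj₁ l) = ≤-shift (suc (n + 3)) (l ⊞≤ ≤-reflexive h ⊞≤ pair-expands′ C 2≤C)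
            (sym (+-suc (card Z + card C) (n + 3))) (trans (lem₂ (card (C ⊞ X)) a n) (sym (+-suc (card (C ⊞ X) + a) (n + 3))))
        by-size : card C < 3 ⊎ card C ≡ 3 → card Z + card C ≤ card (C ⊞ X) + a
        by-size (inj₁ l) = size-two (≤-pred l)
        by-size (inj₂ e) = size-three e

      u≤s : u ≤ s
      u≤s = ≤-shift (card (C ⊞ X) + card Z + card C + a) (E-⊞-bound A X g ⊞≤ C-expands ⊞≤ ≤-reflexive (sym c+s))
              (lem₁ u (card (C ⊞ X)) (card Z) (card C) a) (lem₂ s (card (C ⊞ X)) (card Z) (card C) a)
        where
        lem₁ : ∀ u d z c a → u + d + (z + c) + a ≡ u + (d + z + c + a)
        lem₁ = ℕR.solve-∀
        lem₂ : ∀ s d z c a → z + (d + a) + (c + s) ≡ s + (d + z + c + a)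
        lem₂ = ℕR.solve-∀

      u≡s : u ≡ s
      u≡s = ≤-antisym u≤s (grow g)

      T⊞A : card ((X ⊔> g) ⊞ A) ≡ card Z + u
      T⊞A = trans (card-⊔>-⊞ X A g) (cong₂ _+_ (card-⊞-comm X A) (E-⊞-comm A X g))

      -- X ∪ (X + g) competes with the pair {0, g}. Together with u ≤ s and the bound on |A + X|
      -- this leaves no slack, whence `t≡3` and `Z≡`.
      T-optimal : a + s + (n + t) ≤ card Z + u + 2
      T-optimal = subst₂ (λ c d → a + s + c ≤ d + 2) (card-⊔> X g) T⊞A
        (optimal (X ⊔> g) (≤-trans (≤-trans (s≤s (s≤s z≤n)) 4≤X) (card-mono X (X ⊔> g) (⊔>-introˡ X)))
          (subst (λ d → d + 2 ≤ p) (sym T⊞A) (≤-trans (+-monoˡ-≤ 2 (+-mono-≤ Z≤n+7 (≤-trans u≤s s≤3)))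
            (≤-trans (≤-reflexive (lem n)) (fits (m≤m+n 12 31))))))
        where lem : ∀ n → n + 7 + 3 + 2 ≡ n + 12
              lem = ℕR.solve-∀

      t≡3 : t ≡ 3
      t≡3 = ≤-antisym (≤-shift (a + s + n + u + card Z) (T-optimal ⊞≤ u≤s ⊞≤ Z≤) (lem₁ a s n t u (card Z)) (lem₂ a s n u (card Z))) (three-ends g g≉0)
        where
        lem₁ : ∀ a s n t u z → a + s + (n + t) + u + z ≡ t + (a + s + n + u + z)
        lem₁ = ℕR.solve-∀
        lem₂ : ∀ a s n u z → z + u + 2 + s + (a + n + 1) ≡ 3 + (a + s + n + u + z)
        lem₂ = ℕR.solve-∀

      Z≡ : card Z ≡ a + n + 1
      Z≡ = ≤-antisym Z≤ (≤-shift (s + t + u + 2) (T-optimal ⊞≤ u≤s ⊞≤ three-ends g g≉0) (lem₁ a s n t u) (lem₂ s t u (card Z)))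
        where
        lem₁ : ∀ a s n t u → a + s + (n + t) + u + 3 ≡ a + n + 1 + (s + t + u + 2)
        lem₁ = ℕR.solve-∀
        lem₂ : ∀ s t u z → z + u + 2 + s + t ≡ z + (s + t + u + 2)
        lem₂ = ℕR.solve-∀

      5<p : 5 < p
      5<p = ≤-trans (m≤m+n 6 41) 46<p

      n+9<p : n + 3 + 6 < p
      n+9<p = ≤-trans (≤-reflexive (lem n)) (fits (m≤m+n 10 33))
        where lem : ∀ n → suc (n + 3 + 6) ≡ n + 10
              lem = ℕR.solve-∀

      s≢2 : s ≡ 2 → ⊥
      s≢2 e = two-three-impossible A X g 1 5<p g≉0 dbl e t≡3 (≤-trans 2≤s (grow g)) Z≡ n+9<p

      s≡3 : s ≡ 3
      s≡3 = ≤-antisym s≤3 (≤∧≢⇒< 2≤s λ e → s≢2 (sym e))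

    -- The sets A + {0, g, …, i g} all keep three g-ends, so the gaps after the
    -- g-ends of A are long.
    module Levels (g : ℤ) (g≉0 : g ≉ + 0) (A≤6 : a ≤ 6) (Z≡ : card Z ≡ a + n + 1) (s≡3 : card (E g A) ≡ 3)
                  (t≡3 : card (E g X) ≡ 3) (u≡3 : card (E g Z) ≡ 3) where

      level : ℕ → PSet
      level zero    = A
      level (suc i) = level i ⊔> g

      record Level (i : ℕ) : Set where
        field
          size  : card (level i) ≡ a + 3 * i
          total : card (level i ⊞ X) ≡ card (level i) + n + 1
          s≡    : card (E g (level i)) ≡ 3
          u≡    : card (E g (level i ⊞ X)) ≡ 3
          doubled : Double (level i) X

      base : Level 0
      base = record { size = sym (+-identityʳ a) ; total = Z≡ ; s≡ = s≡3 ; u≡ = u≡3 ; doubled = dbl }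

      module Step {i} (i≤8 : i ≤ 8) (L : Level i) where
        open Level L
        S = level i
        S′ = level (suc i)
        Y = S′ ⊞ X
        s′ = card (E g S′)
        u′ = card (E g Y)

        S′≡ : card S′ ≡ card S + 3
        S′≡ = trans (card-⊔> S g) (cong₂ _+_ (refl {x = card S}) s≡)

        size′ : card S′ ≡ a + 3 * suc i
        size′ = trans S′≡ (trans (cong (_+ 3) size) (lem a i))
          where lem : ∀ a i → a + 3 * i + 3 ≡ a + 3 * (1 + i)
                lem = ℕR.solve-∀

        total′ : card Y ≡ card S′ + n + 1
        total′ = trans (card-⊔>-⊞ S X g) (trans (cong₂ _+_ total u≡) (trans (lem (card S) n) (cong (λ c → c + n + 1) (sym S′≡))))
          where lem : ∀ c n → c + n + 1 + 3 ≡ c + 3 + n + 1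
                lem = ℕR.solve-∀

        doubled′ : Double S′ X
        doubled′ = double-⊔> S X g doubled

        s′≤3 : s′ ≤ 3
        s′≤3 = ≤-trans (card-mono (E g S′) (E g S +> g) (E-⊔>⊆ S g)) (≤-reflexive (trans (card-+> (E g S) g) s≡))

        S′≤33 : card S′ ≤ 33
        S′≤33 = ≤-trans (≤-reflexive size′) (+-mono-≤ A≤6 (*-monoʳ-≤ 3 (s≤s i≤8)))

        Y≤n+34 : card Y ≤ n + 34
        Y≤n+34 = ≤-trans (≤-reflexive total′) (≤-trans (+-monoˡ-≤ 1 (+-monoˡ-≤ n S′≤33)) (≤-reflexive (lem n)))
          where lem : ∀ n → 33 + n + 1 ≡ n + 34
                lem = ℕR.solve-∀

        8≤S′ : 8 ≤ card S′
        8≤S′ = ≤-trans (+-mono-≤ 5≤A (≤-trans (m≤m*n 3 (suc i)) ≤-refl)) (≤-reflexive (sym size′))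

        C′ = S′ ⊓> g

        C′+s′ : card C′ + s′ ≡ card S′
        C′+s′ = card-⊓> S′ g

        -- Unlike A ∩ (A + g), the set C′ has at least four elements and competes with A; since S′
        -- and A both have excess |X| + 1, submodularity suffices.
        u′≤s′ : u′ ≤ s′
        u′≤s′ = ≤-shift (card (C′ ⊞ X) + (a + n + 1) + card C′ + card S′)
            (E-⊞-bound S′ X g ⊞≤ Atom.minimal atom C′ 4≤C′ roomC′ ⊞≤ ≤-reflexive (sym C′+s′))
            (trans (cong (λ z → u′ + card (C′ ⊞ X) + (z + card C′) + card S′) Z≡) (lem₁ u′ (card (C′ ⊞ X)) a n (card C′) (card S′)))
            (trans (cong (λ y → y + (card (C′ ⊞ X) + a) + (card C′ + s′)) total′) (lem₂ s′ (card (C′ ⊞ X)) a n (card C′) (card S′)))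
          where
          4≤C′ : 4 ≤ card C′
          4≤C′ = ≤-trans (m≤m+n 4 1) (+-cancelʳ-≤ 3 5 (card C′) (≤-trans 8≤S′ (≤-trans (≤-reflexive (sym C′+s′)) (+-monoʳ-≤ (card C′) s′≤3))))
          roomC′ : card (C′ ⊞ X) + 4 ≤ p
          roomC′ = ≤-trans (+-monoˡ-≤ 4 (≤-trans (card-mono (C′ ⊞ X) Y (⊞-mono C′ S′ X λ m → proj₁ (⊓>-elim S′ m))) Y≤n+34))
                     (≤-trans (≤-reflexive (+-assoc n 34 4)) (fits (m≤m+n 38 5)))
          lem₁ : ∀ u d a n c S → u + d + (a + n + 1 + c) + S ≡ u + (d + (a + n + 1) + c + S)
          lem₁ = ℕR.solve-∀
          lem₂ : ∀ s d a n c S → S + n + 1 + (d + a) + (c + s) ≡ s + (d + (a + n + 1) + c + S)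
          lem₂ = ℕR.solve-∀

        s′≤u′ : s′ ≤ u′
        s′≤u′ = ≤-shift (a + n + 1 + card S′) (subst₂ _≤_ (cong₂ _+_ Z≡ (card-⊔> S′ g)) (cong (_+ a) (trans (card-⊔>-⊞ S′ X g) (cong (_+ u′) total′)))
              (Atom.minimal atom (S′ ⊔> g) (≤-trans (≤-trans (m≤m+n 4 4) 8≤S′) (card-mono S′ (S′ ⊔> g) (⊔>-introˡ S′))) room))
            (lem₁ s′ a n (card S′)) (lem₂ u′ a n (card S′))
          where
          -- At most |X| + 34 for Y, 3 for its ends and 4 for the room: the tightest demand on p in
          -- terms of |X|.
          room : card ((S′ ⊔> g) ⊞ X) + 4 ≤ p
          room = subst (λ c → c + 4 ≤ p) (sym (card-⊔>-⊞ S′ X g)) (≤-trans (+-monoˡ-≤ 4 (+-mono-≤ Y≤n+34 (≤-trans u′≤s′ s′≤3)))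
                   (≤-trans (≤-reflexive (lem n)) (fits (m≤m+n 41 2))))
            where lem : ∀ n → n + 34 + 3 + 4 ≡ n + 41
                  lem = ℕR.solve-∀
          lem₁ : ∀ s a n S → a + n + 1 + (S + s) ≡ s + (a + n + 1 + S)
          lem₁ = ℕR.solve-∀
          lem₂ : ∀ u a n S → S + n + 1 + u + a ≡ u + (a + n + 1 + S)
          lem₂ = ℕR.solve-∀

        0<s′ : 0 < s′
        0<s′ = E-pos S′ g≉0 (≤-trans (s≤s z≤n) 8≤S′) (≤-trans (s≤s S′≤33) (≤-trans (m≤m+n 34 13) 46<p))

        -- A single end of S′ cannot give two representations to an end of Y, and two ends fall to
        -- the barycentre argument with m = 1.
        s′≡3 : s′ ≡ 3
        s′≡3 = go s′ refl 0<s′ s′≤3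
          where
          go : ∀ k → s′ ≡ k → 0 < k → k ≤ 3 → s′ ≡ 3
          go 1 e _ _ = ⊥-elim (one (enum₁ (E g S′) e) (nonempty (E g Y) (≤-trans 0<s′ s′≤u′)))
            where
            one : (∃ λ k → Enum₁ (E g S′) k) → (∃ λ z → z ∈ E g Y) → ⊥
            one (k , en) (z , m) = α≉β (≈-trans (Enum₁.only en α∈) (≈-sym (Enum₁.only en β∈)))
              where open TwoReps (endpoint-reps S′ X doubled′ m)
          go 2 e _ _ = ⊥-elim (two-three-impossible S′ X g 1 (≤-trans (m≤m+n 6 41) 46<p) g≉0 doubled′ e t≡3 (≤-trans (≤-reflexive (sym e)) s′≤u′) total′
                         (≤-trans (≤-reflexive (lem n)) (fits (m≤m+n 10 33))))
            where lem : ∀ n → suc (n + 3 + 6) ≡ n + 10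
                  lem = ℕR.solve-∀
          go 3 e _ _ = e
          go (suc (suc (suc (suc k)))) e _ (s≤s (s≤s (s≤s ())))

        next : Level (suc i)
        next = record { size = size′ ; total = total′ ; s≡ = s′≡3 ; u≡ = trans (≤-antisym u′≤s′ s′≤u′) s′≡3 ; doubled = doubled′ }

      reach : ∀ i → i ≤ 9 → Level i
      reach zero    _ = base
      reach (suc i) (s≤s h) = Step.next h (reach i (≤-trans h (n≤1+n 8)))

      A⊆level : ∀ i → A ⊆ level i
      A⊆level zero    m = m
      A⊆level (suc i) m = ⊔>-introˡ (level i) (A⊆level i m)

      -- The three ends of the next level lie among the three translated ends of this one, hence are
      -- all of them: no progression runs into another.
      follow : ∀ i → i ≤ 9 → ∀ {k} → k ∈ E g A → k +ᶻ + i *ᶻ g ∈ E g (level i)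
      follow zero    _ {k} m = subst (_∈ E g A) (sym (lem k g)) m
        where lem : ∀ k g → k +ᶻ + 0 *ᶻ g ≡ k
              lem = ℤR.solve-∀
      follow (suc i) (s≤s h) {k} m = all (mem (holds (subst (_∈ E g (level i)) (sym (lem k (+ i) g)) (follow i (≤-trans h (n≤1+n 8)) m))))
        where
        lem : ∀ k i g → (k +ᶻ (+ 1 +ᶻ i) *ᶻ g) -ᶻ g ≡ k +ᶻ i *ᶻ g
        lem = ℤR.solve-∀
        all : E g (level i) +> g ⊆ E g (level (suc i))
        all = ⊆-card≥ (E g (level (suc i))) (E g (level i) +> g) (E-⊔>⊆ (level i) g)
          (≤-reflexive (trans (card-+> (E g (level i)) g) (trans (Level.s≡ (reach i (≤-trans h (n≤1+n 8)))) (sym (Level.s≡ (reach (suc i) (s≤s h)))))))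

      gap : ∀ i → i ≤ 9 → ∀ {k} → k ∈ E g A → k +ᶻ + suc i *ᶻ g ∉ A
      gap i h {k} m = go (member? (k +ᶻ + suc i *ᶻ g) A)
        where
        lem : ∀ k i g → k +ᶻ (+ 1 +ᶻ i) *ᶻ g ≡ (k +ᶻ i *ᶻ g) +ᶻ g
        lem = ℤR.solve-∀
        go : k +ᶻ + suc i *ᶻ g ∈ A ⊎ k +ᶻ + suc i *ᶻ g ∉ A → k +ᶻ + suc i *ᶻ g ∉ A
        go (inj₂ x) = x
        go (inj₁ x) = ∈∉-⊥ (A⊆level i (subst (_∈ A) (lem k (+ i) g) x)) (proj₂ (E-elim (level i) (follow i h m)))

    module Ends (g : ℤ) (g≉0 : g ≉ + 0) (A≤6 : a ≤ 6) (Z≡ : card Z ≡ a + n + 1) (s≡3 : card (E g A) ≡ 3)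
                (t≡3 : card (E g X) ≡ 3) (u≡3 : card (E g Z) ≡ 3) where

      -g≉0 : -ᶻ g ≉ + 0
      -g≉0 e = g≉0 (combine₁ ℤ.-1ℤ e (lem g))
        where lem : ∀ g → g -ᶻ + 0 ≡ ℤ.-1ℤ *ᶻ ((-ᶻ g) -ᶻ + 0)
              lem = ℤR.solve-∀

      s⁻ : card (E (-ᶻ g) A) ≡ 3
      s⁻ = trans (card-E-neg A g) s≡3
      t⁻ : card (E (-ᶻ g) X) ≡ 3
      t⁻ = trans (card-E-neg X g) t≡3
      u⁻ : card (E (-ᶻ g) Z) ≡ 3
      u⁻ = trans (card-E-neg Z g) u≡3

      gap : ∀ i → i ≤ 9 → ∀ {k} → k ∈ E g A → k +ᶻ + suc i *ᶻ g ∉ A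
      gap = Levels.gap g g≉0 A≤6 Z≡ s≡3 t≡3 u≡3

      gap⁻ : ∀ i → i ≤ 9 → ∀ {k} → k ∈ E (-ᶻ g) A → k +ᶻ + suc i *ᶻ (-ᶻ g) ∉ A
      gap⁻ = Levels.gap (-ᶻ g) -g≉0 A≤6 Z≡ s⁻ t⁻ u⁻

      5<p : 5 < p
      5<p = ≤-trans (m≤m+n 6 41) 46<p

      right : Column (E g A) (E g X) (E g Z)
      right = classify (E g A) (E g X) (E g Z) 5<p s≡3 t≡3 u≡3 (endpoint-reps A X dbl {g})

      left : Column (E (-ᶻ g) A) (E (-ᶻ g) X) (E (-ᶻ g) Z)
      left = classify (E (-ᶻ g) A) (E (-ᶻ g) X) (E (-ᶻ g) Z) 5<p s⁻ t⁻ u⁻ (endpoint-reps A X dbl { -ᶻ g})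

      multiple≉0 : ∀ m → 0 < m → m ≤ 46 → + m *ᶻ g ≉ + 0
      multiple≉0 m l h e = g≉0 (cancel≈ m l (≤-trans (s≤s h) 46<p) e)

      rise : PSet → ℤ
      rise S = wsum (E g S) -ᶻ wsum (E (-ᶻ g) S)

      rise≈ : ∀ S {m} → card (E g S) ≡ 3 → card S ≡ m → rise S ≈ (+ m -ᶻ + 3) *ᶻ g
      rise≈ S e refl = combine₁ (+ 1) (subst (λ c → wsum (E g S) +ᶻ + c *ᶻ g ≈ wsum (E (-ᶻ g) S) +ᶻ + card S *ᶻ g) e (wsum-E S g))
          (lem (wsum (E g S)) (wsum (E (-ᶻ g) S)) (+ card S) g)
        where lem : ∀ e e′ n g → (e -ᶻ e′) -ᶻ (n -ᶻ + 3) *ᶻ g ≡ + 1 *ᶻ ((e +ᶻ + 3 *ᶻ g) -ᶻ (e′ +ᶻ n *ᶻ g))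
              lem = ℤR.solve-∀

      -- (|A| + |X| + 1 - 3) - (|X| - 3) - (|A| - 3) = 4, the origin of the 4 g in all slopes.
      rise-defect : rise Z -ᶻ (rise X +ᶻ rise A) ≈ + 4 *ᶻ g
      rise-defect = combine₃ (+ 1) ℤ.-1ℤ ℤ.-1ℤ (rise≈ Z u≡3 Z≡) (rise≈ X t≡3 refl) (rise≈ A s≡3 refl) (lem (rise Z) (rise X) (rise A) (+ a) (+ n) g)
        where lem : ∀ z x y a n g → (z -ᶻ (x +ᶻ y)) -ᶻ + 4 *ᶻ g ≡ + 1 *ᶻ (z -ᶻ (a +ᶻ n +ᶻ + 1 -ᶻ + 3) *ᶻ g) +ᶻ ℤ.-1ℤ *ᶻ (x -ᶻ (n -ᶻ + 3) *ᶻ g) +ᶻ ℤ.-1ℤ *ᶻ (y -ᶻ (a -ᶻ + 3) *ᶻ g)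
              lem = ℤR.solve-∀

      defects : ∀ {δ f} → wsum (E g Z) ≈ wsum (E g X) +ᶻ wsum (E g A) +ᶻ δ →
                wsum (E (-ᶻ g) Z) ≈ wsum (E (-ᶻ g) X) +ᶻ wsum (E (-ᶻ g) A) +ᶻ f → δ ≈ f +ᶻ + 4 *ᶻ g
      defects {δ} {f} e e′ = combine₃ ℤ.-1ℤ (+ 1) (+ 1) e e′ rise-defect
          (lem (wsum (E g Z)) (wsum (E g X)) (wsum (E g A)) (wsum (E (-ᶻ g) Z)) (wsum (E (-ᶻ g) X)) (wsum (E (-ᶻ g) A)) δ f g)
        where lem : ∀ z x y z′ x′ y′ δ f g → δ -ᶻ (f +ᶻ + 4 *ᶻ g) ≡ ℤ.-1ℤ *ᶻ (z -ᶻ (x +ᶻ y +ᶻ δ)) +ᶻ + 1 *ᶻ (z′ -ᶻ (x′ +ᶻ y′ +ᶻ f)) +ᶻ + 1 *ᶻ (((z -ᶻ z′) -ᶻ ((x -ᶻ x′) +ᶻ (y -ᶻ y′))) -ᶻ + 4 *ᶻ g)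
              lem = ℤR.solve-∀

      plain : ∀ {f s} → f ≈ s → f ≈ s +ᶻ + 0
      plain {f} {s} e = ≈-trans e (≡⇒≈ (sym (ℤP.+-identityʳ s)))

      -- Four consecutive steps from k would give |A ∩ (A + g)| ≥ 4.
      walk : ∀ {k} → k ∈ E g A → ∃ λ e → Any (e ≡_) lengths × k -ᶻ e *ᶻ g ∈ E (-ᶻ g) A
      walk {k} m = go₁ (member? (x 1) A)
        where
        x : ℕ → ℤ
        x i = k -ᶻ + i *ᶻ g
        Result = ∃ λ e → Any (e ≡_) lengths × k -ᶻ e *ᶻ g ∈ E (-ᶻ g) A
        x₀ : x 0 ∈ A
        x₀ = subst (_∈ A) (sym (lem k g)) (proj₁ (E-elim A m))
          where lem : ∀ k g → k -ᶻ + 0 *ᶻ g ≡ k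
                lem = ℤR.solve-∀
        down : ∀ i → x i -ᶻ g ≡ x (suc i)
        down i = lem k (+ i) g
          where lem : ∀ k i g → (k -ᶻ i *ᶻ g) -ᶻ g ≡ k -ᶻ (+ 1 +ᶻ i) *ᶻ g
                lem = ℤR.solve-∀
        stop : ∀ i → x i ∈ A → x (suc i) ∉ A → x i ∈ E (-ᶻ g) A
        stop i h h′ = E-intro A h (subst (_∉ A) (sym (down i)) h′)
        in-C : ∀ i → x i ∈ A → x (suc i) ∈ A → x i ∈ A ⊓> g
        in-C i h h′ = ⊓>-intro A {g} {x i} h (subst (_∈ A) (sym (down i)) h′)
        apart : ∀ i d → 0 < d → d ≤ 46 → x i ≉ x (i + d)
        apart i d l h e = multiple≉0 d l h (combine₁ (+ 1) e (lem k (+ i) (+ d) g))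
          where lem : ∀ k i d g → d *ᶻ g -ᶻ + 0 ≡ + 1 *ᶻ ((k -ᶻ i *ᶻ g) -ᶻ (k -ᶻ (i +ᶻ d) *ᶻ g))
                lem = ℤR.solve-∀
        go₄ : x 1 ∈ A → x 2 ∈ A → x 3 ∈ A → x 4 ∈ A ⊎ x 4 ∉ A → Result
        go₄ h₁ h₂ h₃ (inj₂ h) = + 3 , there (there (there (here refl))) , stop 3 h₃ h
        go₄ h₁ h₂ h₃ (inj₁ h) = ⊥-elim (<⇒≱ (four-elements (A ⊓> g) {x 0} {x 1} {x 2} {x 3} (in-C 0 x₀ h₁) (in-C 1 h₁ h₂) (in-C 2 h₂ h₃) (in-C 3 h₃ h)
          (apart 0 1 (s≤s z≤n) (m≤m+n 1 45)) (apart 0 2 (s≤s z≤n) (m≤m+n 2 44)) (apart 0 3 (s≤s z≤n) (m≤m+n 3 43))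
          (apart 1 1 (s≤s z≤n) (m≤m+n 1 45)) (apart 1 2 (s≤s z≤n) (m≤m+n 2 44)) (apart 2 1 (s≤s z≤n) (m≤m+n 1 45))) (overlap≤3 g g≉0))
        go₃ : x 1 ∈ A → x 2 ∈ A → x 3 ∈ A ⊎ x 3 ∉ A → Result
        go₃ h₁ h₂ (inj₁ h) = go₄ h₁ h₂ h (member? (x 4) A)
        go₃ h₁ h₂ (inj₂ h) = + 2 , there (there (here refl)) , stop 2 h₂ h
        go₂ : x 1 ∈ A → x 2 ∈ A ⊎ x 2 ∉ A → Result
        go₂ h₁ (inj₁ h) = go₃ h₁ h (member? (x 3) A)
        go₂ h₁ (inj₂ h) = + 1 , there (here refl) , stop 1 h₁ h
        go₁ : x 1 ∈ A ⊎ x 1 ∉ A → Result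
        go₁ (inj₁ h) = go₂ h (member? (x 2) A)
        go₁ (inj₂ h) = + 0 , here refl , stop 0 x₀ h

      no-jump : ∀ j → ℤ.∣ j ∣ ≤ 9 → ∀ {x y} → x ∈ E g A → y ∈ E g A → x ≉ y → (x -ᶻ y) +ᶻ j *ᶻ g ≉ + 0
      no-jump (+ zero) _ {x} {y} x∈ y∈ x≉y e = x≉y (combine₁ (+ 1) e (lem x y g))
        where lem : ∀ x y g → x -ᶻ y ≡ + 1 *ᶻ (((x -ᶻ y) +ᶻ + 0 *ᶻ g) -ᶻ + 0)
              lem = ℤR.solve-∀
      no-jump (+ suc i) h {x} {y} x∈ y∈ x≉y e = ∈∉-⊥ (∈-resp A {y} {x +ᶻ + suc i *ᶻ g} (combine₁ ℤ.-1ℤ e (lem x y (+ suc i) g)) (proj₁ (E-elim A y∈)))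
                                                       (gap i (≤-trans (n≤1+n i) h) x∈)
        where lem : ∀ x y j g → y -ᶻ (x +ᶻ j *ᶻ g) ≡ ℤ.-1ℤ *ᶻ (((x -ᶻ y) +ᶻ j *ᶻ g) -ᶻ + 0)
              lem = ℤR.solve-∀
      no-jump -[1+ i ] h {x} {y} x∈ y∈ x≉y e = ∈∉-⊥ (∈-resp A {x} {y +ᶻ + suc i *ᶻ g} (combine₁ (+ 1) e (lem x y (+ suc i) g)) (proj₁ (E-elim A x∈)))
                                                      (gap i (≤-trans (n≤1+n i) h) y∈)
        where lem : ∀ x y j g → x -ᶻ (y +ᶻ j *ᶻ g) ≡ + 1 *ᶻ (((x -ᶻ y) +ᶻ (-ᶻ j) *ᶻ g) -ᶻ + 0)
              lem = ℤR.solve-∀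

      jump≤9 : ∀ {j} → Any (j ≡_) jumps → ℤ.∣ j ∣ ≤ 9
      jump≤9 m = ≤ᵇ⇒≤ _ 9 (subst T (sym (every-sound (λ j → ℤ.∣ j ∣ ≤ᵇ 9) jumps refl m)) _)

      end∈ : ∀ {m} → m ≡ 3 ⊎ m ≡ 2 → Any (+ m ≡_) ends
      end∈ (inj₁ refl) = here refl
      end∈ (inj₂ refl) = there (here refl)

      module BothSkew {δ f m l} (slope : δ ≈ f +ᶻ + 4 *ᶻ g) (m∈ : m ≡ 3 ⊎ m ≡ 2) (l∈ : l ≡ 3 ⊎ l ≡ 2)
                      (R : Skew m (E g A) δ) (L : Skew l (E (-ᶻ g) A) f) where

        module R = Skew R
        module L = Skew L

        digit : ∀ {w} → w ∈ E (-ᶻ g) A → ∃ λ q → Any (q ≡_) (digits (+ l)) × w ≈ L.c -ᶻ q *ᶻ f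
        digit {w} w∈ = go (L.only w∈)
          where
          lem₀ : ∀ c f → c ≡ c -ᶻ + 0 *ᶻ f
          lem₀ = ℤR.solve-∀
          lem₁ : ∀ c f → c -ᶻ f ≡ c -ᶻ + 1 *ᶻ f
          lem₁ = ℤR.solve-∀
          go : w ≈ L.c ⊎ w ≈ L.c -ᶻ f ⊎ w ≈ L.c -ᶻ + l *ᶻ f → ∃ λ q → Any (q ≡_) (digits (+ l)) × w ≈ L.c -ᶻ q *ᶻ f
          go (inj₁ e) = + 0 , here refl , ≈-trans e (≡⇒≈ (lem₀ L.c f))
          go (inj₂ (inj₁ e)) = + 1 , there (here refl) , ≈-trans e (≡⇒≈ (lem₁ L.c f))
          go (inj₂ (inj₂ e)) = + l , there (there (here refl)) , e

        nogap : ∀ {d j} → Any (d ≡_) (steps (+ m)) → Any (j ≡_) jumps → d *ᶻ δ +ᶻ j *ᶻ g ≉ + 0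
        nogap {d} {j} (here refl) j∈ e = no-jump j (jump≤9 j∈) R.c∈ R.c-δ∈ R.c≉c-δ (≈-trans (≡⇒≈ (lem R.c δ j g)) e)
          where lem : ∀ c δ j g → (c -ᶻ (c -ᶻ δ)) +ᶻ j *ᶻ g ≡ + 1 *ᶻ δ +ᶻ j *ᶻ g
                lem = ℤR.solve-∀
        nogap {d} {j} (there (here refl)) j∈ e = no-jump j (jump≤9 j∈) R.c∈ R.c-nδ∈ R.c≉c-nδ (≈-trans (≡⇒≈ (lem R.c (+ m *ᶻ δ) j g)) e)
          where lem : ∀ c δ j g → (c -ᶻ (c -ᶻ δ)) +ᶻ j *ᶻ g ≡ δ +ᶻ j *ᶻ g
                lem = ℤR.solve-∀
        nogap {d} {j} (there (there (here refl))) j∈ e = no-jump j (jump≤9 j∈) R.c-δ∈ R.c-nδ∈ R.c-δ≉c-nδ (≈-trans (≡⇒≈ (lem R.c δ (+ m) j g)) e)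
          where lem : ∀ c δ m j g → ((c -ᶻ δ) -ᶻ (c -ᶻ m *ᶻ δ)) +ᶻ j *ᶻ g ≡ (m -ᶻ + 1) *ᶻ δ +ᶻ j *ᶻ g
                lem = ℤR.solve-∀

        Walk : ℤ → Set
        Walk k = ∃ λ e → ∃ λ q → Any (e ≡_) lengths × Any (q ≡_) (digits (+ l)) × k -ᶻ e *ᶻ g ≈ L.c -ᶻ q *ᶻ f

        walked : ∀ {k} → k ∈ E g A → Walk k
        walked k∈ = let (e , e∈ , w∈) = walk k∈ ; (q , q∈ , h) = digit w∈ in e , q , e∈ , q∈ , h

        -- Subtracting the equation for c from those for c - δ and c - m δ removes both base points;
        -- substituting δ ≡ f + 4 g leaves two relations between f and g alone.
        collide : Walk R.c → Walk (R.c -ᶻ δ) → Walk (R.c -ᶻ + m *ᶻ δ) → ⊥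
        collide (e₀ , q₀ , e₀∈ , q₀∈ , h₀) (e₁ , q₁ , e₁∈ , q₁∈ , h₁) (e₂ , q₂ , e₂∈ , q₂∈ , h₂) =
          Elimination.no-slopes 46<p g≉0 slope (end∈ m∈) (end∈ l∈) q₀∈ q₁∈ q₂∈ e₀∈ e₁∈ e₂∈
            (combine₃ (+ 1) ℤ.-1ℤ (+ 1) h₁ h₀ slope (lem₁ R.c δ L.c f g e₀ e₁ q₀ q₁))
            (combine₃ (+ 1) ℤ.-1ℤ (+ m) h₂ h₀ slope (lem₂ R.c δ L.c f g (+ m) e₀ e₂ q₀ q₂)) nogap
          where
          lem₁ : ∀ c δ c′ f g e₀ e₁ q₀ q₁ → ((q₁ -ᶻ q₀) -ᶻ + 1) *ᶻ f -ᶻ ((e₁ -ᶻ e₀) +ᶻ + 4) *ᶻ g ≡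
            + 1 *ᶻ (((c -ᶻ δ) -ᶻ e₁ *ᶻ g) -ᶻ (c′ -ᶻ q₁ *ᶻ f)) +ᶻ ℤ.-1ℤ *ᶻ ((c -ᶻ e₀ *ᶻ g) -ᶻ (c′ -ᶻ q₀ *ᶻ f)) +ᶻ + 1 *ᶻ (δ -ᶻ (f +ᶻ + 4 *ᶻ g))
          lem₁ = ℤR.solve-∀
          lem₂ : ∀ c δ c′ f g m e₀ e₁ q₀ q₁ → ((q₁ -ᶻ q₀) -ᶻ m) *ᶻ f -ᶻ ((e₁ -ᶻ e₀) +ᶻ + 4 *ᶻ m) *ᶻ g ≡
            + 1 *ᶻ (((c -ᶻ m *ᶻ δ) -ᶻ e₁ *ᶻ g) -ᶻ (c′ -ᶻ q₁ *ᶻ f)) +ᶻ ℤ.-1ℤ *ᶻ ((c -ᶻ e₀ *ᶻ g) -ᶻ (c′ -ᶻ q₀ *ᶻ f)) +ᶻ m *ᶻ (δ -ᶻ (f +ᶻ + 4 *ᶻ g))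
          lem₂ = ℤR.solve-∀

        absurd : ⊥
        absurd = collide (walked R.c∈) (walked R.c-δ∈) (walked R.c-nδ∈)

      -- The defects satisfy δ ≡ f + 4 g, a barycentric side counting as 0. Two zeros give 4 g ≡ 0;
      -- a single zero puts two ends of A four steps apart, inside a forbidden gap; only two skew
      -- sides need the finite check.
      compare : Column (E g A) (E g X) (E g Z) → Column (E (-ᶻ g) A) (E (-ᶻ g) X) (E (-ᶻ g) Z) → ⊥
      compare (barycentric e) (barycentric e′) = multiple≉0 4 (s≤s z≤n) (m≤m+n 4 42)
          (combine₁ ℤ.-1ℤ (defects (plain e) (plain e′)) (lem g))
        where lem : ∀ g → + 4 *ᶻ g -ᶻ + 0 ≡ ℤ.-1ℤ *ᶻ (+ 0 -ᶻ (+ 0 +ᶻ + 4 *ᶻ g))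
              lem = ℤR.solve-∀
      compare (skew δ m _ R e) (barycentric e′) = ∈∉-⊥ (∈-resp A {R.c} {(R.c -ᶻ δ) +ᶻ + 4 *ᶻ g} (combine₁ (+ 1) (defects e (plain e′)) (lem R.c δ g)) (proj₁ (E-elim A R.c∈)))
                                                       (gap 3 (m≤m+n 3 6) R.c-δ∈)
        where
        module R = Skew R
        lem : ∀ c δ g → c -ᶻ ((c -ᶻ δ) +ᶻ + 4 *ᶻ g) ≡ + 1 *ᶻ (δ -ᶻ (+ 0 +ᶻ + 4 *ᶻ g))
        lem = ℤR.solve-∀
      compare (barycentric e) (skew f l _ L e′) = ∈∉-⊥ (∈-resp A {L.c} {(L.c -ᶻ f) +ᶻ + 4 *ᶻ (-ᶻ g)} (combine₁ ℤ.-1ℤ (defects (plain e) e′) (lem L.c f g)) (proj₁ (E-elim A L.c∈)))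
                                                       (gap⁻ 3 (m≤m+n 3 6) L.c-δ∈)
        where
        module L = Skew L
        lem : ∀ c f g → c -ᶻ ((c -ᶻ f) +ᶻ + 4 *ᶻ (-ᶻ g)) ≡ ℤ.-1ℤ *ᶻ (+ 0 -ᶻ (f +ᶻ + 4 *ᶻ g))
        lem = ℤR.solve-∀
      compare (skew δ m m∈ R e) (skew f l l∈ L e′) = BothSkew.absurd (defects e e′) m∈ l∈ R L

      contradiction : ⊥
      contradiction = compare right left

    from-pair : ∀ B → Atom 2 A B → ⊥
    from-pair B atomB = go (two-elements B (Atom.size atomB))
      where
      B≡2 : card B ≡ 2
      B≡2 = TwoAtoms.B≡2 46<p {A} {X} {B} 5≤A overlap≤3 atomB (≤-trans (s≤s (s≤s z≤n)) 4≤X) X⊞A-room X⊞A≤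
      go : (∃ λ x → ∃ λ y → x ∈ B × y ∈ B × x ≉ y) → ⊥
      go (x , y , x∈ , y∈ , x≉y) = Ends.contradiction g g≉0 A≤6 Z≡ s≡3 t≡3 (trans u≡s s≡3)
        where
        g = y -ᶻ x
        g≉0 : g ≉ + 0
        g≉0 = sub≉0 (≉-sym x≉y)
        optimal : ∀ T → 2 ≤ card T → card (T ⊞ A) + 2 ≤ p → a + card (E g A) + card T ≤ card (T ⊞ A) + 2
        optimal T l r = ≤-trans (+-monoˡ-≤ (card T) (pair-sumset B A x∈ y∈)) (subst (λ b → card (B ⊞ A) + card T ≤ card (T ⊞ A) + b) B≡2 (Atom.minimal atomB T l r))
        open SmallEnds g g≉0 optimal

    -- X itself is an admissible set for A, so a 2-atom of A exists.
    impossible : ⊥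
    impossible = atom-exists 2 A 0<A from-pair X (≤-trans (s≤s (s≤s z≤n)) 4≤X) X⊞A-room

  -- Comparison with subsets of Fin p

  ≤-unique : ∀ {i j} → i ≤ j → j < p → + j ≈ + i → i ≡ j
  ≤-unique {i} {j} i≤j j<p e with m≤n⇒m<n∨m≡n i≤j
  ... | inj₂ eq = eq
  ... | inj₁ i<j = ⊥-elim (small≉0 (m<n⇒0<n∸m i<j) (≤-<-trans (m∸n≤m j i) j<p)
      (combine₁ (+ 1) (subst (λ k → + k ≈ + i) (sym (m+[n∸m]≡n i≤j)) e) (lem (+ i) (+ (j ∸ i)))))
    where lem : ∀ i d → d -ᶻ + 0 ≡ + 1 *ᶻ ((i +ᶻ d) -ᶻ i)
          lem = ℤR.solve-∀

  fin-unique : ∀ {i j : Fin p} → + toℕ i ≈ + toℕ j → i ≡ j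
  fin-unique {i} {j} e with ≤-total (toℕ i) (toℕ j)
  ... | inj₁ l = FinP.toℕ-injective (≤-unique l (FinP.toℕ<n j) (≈-sym e))
  ... | inj₂ l = FinP.toℕ-injective (sym (≤-unique l (FinP.toℕ<n i) e))

  index : ℤ → Fin p
  index x = fromℕ< (ℤD.n%ℕd<d x p)

  index≈ : ∀ x → x ≈ + toℕ (index x)
  index≈ x = subst (λ k → x ≈ + k) (sym (FinP.toℕ-fromℕ< (ℤD.n%ℕd<d x p))) (proj₂ (proj₂ (representative x)))

  index-cong : ∀ {x y} → x ≈ y → index x ≡ index y
  index-cong {x} {y} e = fin-unique (≈-trans (≈-sym (index≈ x)) (≈-trans e (index≈ y)))

  index-toℕ : ∀ i → index (+ toℕ i) ≡ i
  index-toℕ i = fin-unique (≈-sym (index≈ (+ toℕ i)))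

  periodic : Subset p → PSet
  periodic S = record { χ = λ x → lookup S (index x) ; resp = λ e → cong (lookup S) (index-cong e) }

  restrict : PSet → Subset p
  restrict T = tabulate (λ i → χ T (+ toℕ i))

  periodic-restrict : ∀ T x → χ (periodic (restrict T)) x ≡ χ T x
  periodic-restrict T x = trans (VecP.lookup∘tabulate (λ i → χ T (+ toℕ i)) (index x)) (resp T (≈-sym (index≈ x)))

  sum-card : ∀ {n} (v : Subset n) (f : ℤ → ℕ) → (∀ i → f (+ toℕ i) ≡ ind (lookup v i)) → sum n f ≡ ∣ v ∣
  sum-card Vec.[] f h = refl
  sum-card {suc n} (b Vec.∷ v) f h = trans (sum-front n f) (trans (cong₂ _+_ (h Fin.zero)
      (sum-card v (λ x → f (x +ᶻ + 1)) (λ i → trans (cong (λ k → f (+ k)) (+-comm (toℕ i) 1)) (h (Fin.suc i))))) (head b))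
    where
    head : ∀ b → ind b + ∣ v ∣ ≡ ∣ b Vec.∷ v ∣
    head true  = refl
    head false = refl

  card-periodic : ∀ S → card (periodic S) ≡ ∣ S ∣
  card-periodic S = sum-card S (λ x → ind (χ (periodic S) x)) (λ i → cong (λ j → ind (lookup S j)) (index-toℕ i))

  card-restrict : ∀ T → ∣ restrict T ∣ ≡ card T
  card-restrict T = trans (sym (card-periodic (restrict T))) (card-≐ (periodic (restrict T)) T (periodic-restrict T))

  any-elim : ∀ {A : Set} (f : A → Bool) xs → LA.any f xs ≡ true → ∃ λ x → f x ≡ true
  any-elim f (x ∷ xs) h with f x in eq
  ... | true  = x , eq
  ... | false = any-elim f xs h

  any-intro : ∀ {A : Set} (f : A → Bool) {xs x} → x LM.∈ xs → f x ≡ true → LA.any f xs ≡ true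
  any-intro f (here refl) h = ∨-introˡ h
  any-intro f {y ∷ xs} (there m) h = ∨-introʳ {f y} (any-intro f m h)

  +ₚ≈ : ∀ (s x : Fin p) → + toℕ (s +ₚ x) ≈ + toℕ s +ᶻ + toℕ x
  +ₚ≈ s x = ≈-sym (≈-trans (proj₂ (proj₂ (representative (+ (toℕ s + toℕ x))))) (≡⇒≈ (cong +_ (sym (FinP.toℕ-fromℕ< (ℕD.m%n<n (toℕ s + toℕ x) p))))))

  ∈-periodic : ∀ S {i} → i Sub.∈ S → + toℕ i ∈ periodic S
  ∈-periodic S {i} m = mem (trans (cong (lookup S) (index-toℕ i)) (VecP.[]=⇒lookup m))

  periodic-∈ : ∀ S {x} → x ∈ periodic S → index x Sub.∈ S
  periodic-∈ S {x} (mem e) = VecP.lookup⇒[]= (index x) S e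

  χ-⊕ : ∀ S X z → χ (periodic (S ⊕ X)) z ≡ χ (periodic S ⊞ periodic X) z
  χ-⊕ S X z = trans (VecP.lookup∘tabulate _ (index z)) (bool-ext to from)
    where
    hit : Fin p → Fin p → Bool
    hit s x = ⌊ s SubP.∈? S ⌋ ∧ (⌊ x SubP.∈? X ⌋ ∧ ⌊ (s +ₚ x) FinP.≟ index z ⌋)
    to : LA.any (λ s → LA.any (hit s) (allFin p)) (allFin p) ≡ true → χ (periodic S ⊞ periodic X) z ≡ true
    to h with any-elim (λ s → LA.any (hit s) (allFin p)) (allFin p) h
    ... | s , h₁ with any-elim (hit s) (allFin p) h₁
    ...   | x , h₂ with ∧-true {⌊ s SubP.∈? S ⌋} h₂
    ...     | s∈ , h₃ with ∧-true {⌊ x SubP.∈? X ⌋} h₃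
    ...       | x∈ , e = holds (⊞-intro (periodic S) (periodic X) {+ toℕ s} {z} (∈-periodic S (⌊⌋-elim s∈))
                (∈-resp (periodic X) {+ toℕ x} {z -ᶻ + toℕ s} (combine₂ (+ 1) ℤ.-1ℤ z≈ (index≈ z) (lem (+ toℕ s) (+ toℕ x) z (+ toℕ (index z)))) (∈-periodic X (⌊⌋-elim x∈))))
      where
      z≈ : + toℕ s +ᶻ + toℕ x ≈ + toℕ (index z)
      z≈ = subst (λ i → + toℕ s +ᶻ + toℕ x ≈ + toℕ i) (⌊⌋-elim e) (≈-sym (+ₚ≈ s x))
      lem : ∀ s x z i → x -ᶻ (z -ᶻ s) ≡ + 1 *ᶻ ((s +ᶻ x) -ᶻ i) +ᶻ ℤ.-1ℤ *ᶻ (z -ᶻ i)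
      lem = ℤR.solve-∀
    from : χ (periodic S ⊞ periodic X) z ≡ true → LA.any (λ s → LA.any (hit s) (allFin p)) (allFin p) ≡ true
    from h = go (⊞-elim (periodic S) (periodic X) (mem {z} h))
      where
      go : (∃ λ a → a ∈ periodic S × z -ᶻ a ∈ periodic X) → LA.any (λ s → LA.any (hit s) (allFin p)) (allFin p) ≡ true
      go (a , a∈ , x∈) = any-intro (λ s → LA.any (hit s) (allFin p)) (LMP.∈-allFin (index a))
          (any-intro (hit (index a)) (LMP.∈-allFin (index (z -ᶻ a)))
            (∧-intro (⌊⌋-true {d = index a SubP.∈? S} (periodic-∈ S a∈)) (∧-intro (⌊⌋-true {d = index (z -ᶻ a) SubP.∈? X} (periodic-∈ X x∈))
              (⌊⌋-true {d = (index a +ₚ index (z -ᶻ a)) FinP.≟ index z} (fin-unique sums)))))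
        where
        lem : ∀ s z i j a → s -ᶻ z ≡ + 1 *ᶻ (s -ᶻ (i +ᶻ j)) +ᶻ ℤ.-1ℤ *ᶻ (a -ᶻ i) +ᶻ ℤ.-1ℤ *ᶻ ((z -ᶻ a) -ᶻ j)
        lem = ℤR.solve-∀
        sums : + toℕ (index a +ₚ index (z -ᶻ a)) ≈ + toℕ (index z)
        sums = ≈-trans (combine₃ (+ 1) ℤ.-1ℤ ℤ.-1ℤ (+ₚ≈ (index a) (index (z -ᶻ a))) (index≈ a) (index≈ (z -ᶻ a))
                 (lem (+ toℕ (index a +ₚ index (z -ᶻ a))) z (+ toℕ (index a)) (+ toℕ (index (z -ᶻ a))) a)) (index≈ z)

  card-⊕ : ∀ S X → ∣ S ⊕ X ∣ ≡ card (periodic S ⊞ periodic X)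
  card-⊕ S X = trans (sym (card-periodic (S ⊕ X))) (card-≐ (periodic (S ⊕ X)) (periodic S ⊞ periodic X) (χ-⊕ S X))

  card-restrict-⊕ : ∀ T X → ∣ restrict T ⊕ X ∣ ≡ card (T ⊞ periodic X)
  card-restrict-⊕ T X = trans (card-⊕ (restrict T) X) (card-≐ (periodic (restrict T) ⊞ periodic X) (T ⊞ periodic X)
    (λ z → any<-cong p (λ a → cong (_∧ χ (periodic X) (z -ᶻ a)) (periodic-restrict T a))))

  -- Properties of κ

  all-subsets : ∀ {n} (v : Subset n) → v LM.∈ allSubsets n
  all-subsets Vec.[] = here refl
  all-subsets (true Vec.∷ v)  = LMP.∈-++⁺ˡ (LMP.∈-map⁺ (Sub.inside Vec.∷_) (all-subsets v))
  all-subsets {suc n} (false Vec.∷ v) = LMP.∈-++⁺ʳ (map (Sub.inside Vec.∷_) (allSubsets n)) (LMP.∈-map⁺ (Sub.outside Vec.∷_) (all-subsets v))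

  κ-step : ℕ → Subset p → Subset p → ℕ → ℕ
  κ-step k X S m = if admissible? k X S then (∣ S ⊕ X ∣ ∸ ∣ S ∣) ⊓ m else m

  κ-lower : ∀ k (X : Subset p) {T : Subset p} → Admissible {p} k X T → κ {p} k X ≤ ∣ T ⊕ X ∣ ∸ ∣ T ∣
  κ-lower k X {T} (h₁ , h₂) = go (allSubsets p) (all-subsets T)
    where
    drop : ∀ S m → κ-step k X S m ≤ m
    drop S m with admissible? k X S
    ... | true  = m⊓n≤n _ m
    ... | false = ≤-refl
    go : ∀ L → T LM.∈ L → foldr (κ-step k X) p L ≤ ∣ T ⊕ X ∣ ∸ ∣ T ∣
    go (S ∷ L) (here refl) rewrite ⌊⌋-true {d = k ≤? ∣ S ∣} h₁ | ⌊⌋-true {d = ∣ S ⊕ X ∣ ≤? p ∸ k} h₂ = m⊓n≤m _ _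
    go (S ∷ L) (there m) = ≤-trans (drop S (foldr (κ-step k X) p L)) (go L m)

  -- A larger index admits fewer sets; this carries the hypothesis on κ₅ over to κ₄.
  κ-mono : ∀ (X : Subset p) {k l} → k ≤ l → κ k X ≤ κ l X
  κ-mono X {k} {l} k≤l = go (allSubsets p)
    where
    weaken : ∀ S → admissible? l X S ≡ true → admissible? k X S ≡ true
    weaken S h with ∧-true {⌊ l ≤? ∣ S ∣ ⌋} h
    ... | h₁ , h₂ = ∧-intro (⌊⌋-true {d = k ≤? ∣ S ∣} (≤-trans k≤l (⌊⌋-elim {d = l ≤? ∣ S ∣} h₁)))
                            (⌊⌋-true {d = ∣ S ⊕ X ∣ ≤? p ∸ k} (≤-trans (⌊⌋-elim {d = ∣ S ⊕ X ∣ ≤? p ∸ l} h₂) (∸-monoʳ-≤ p k≤l)))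
    go : ∀ L → foldr (κ-step k X) p L ≤ foldr (κ-step l X) p L
    go [] = ≤-refl
    go (S ∷ L) with admissible? l X S in eq
    ... | true rewrite weaken S eq = ⊓-monoʳ-≤ (∣ S ⊕ X ∣ ∸ ∣ S ∣) (go L)
    ... | false with admissible? k X S
    ...   | true  = ≤-trans (m⊓n≤n _ _) (go L)
    ...   | false = go L

  -- From atoms in `Fin p` to periodic atoms

  module Transfer {k} {X A : Subset p} (k≤p : k ≤ p) (0<X : 0 < ∣ X ∣) (isAtom : IsAtom k X A) where

    0<X′ : 0 < card (periodic X)
    0<X′ = subst (0 <_) (sym (card-periodic X)) 0<X

    -- As X is nonempty, |S| ≤ |S + X|, so the truncated subtraction in κ is exact.
    excess : ∀ S → ∣ S ⊕ X ∣ ≡ (∣ S ⊕ X ∣ ∸ ∣ S ∣) + ∣ S ∣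
    excess S = sym (m∸n+n≡m (subst₂ _≤_ (card-periodic S) (sym (card-⊕ S X)) (card≤⊞ (periodic S) (periodic X) 0<X′)))

    A-excess : ∣ A ⊕ X ∣ ≡ κ k X + ∣ A ∣
    A-excess = trans (excess A) (cong (_+ ∣ A ∣) (proj₂ (proj₁ isAtom)))

    admissible : ∀ T → k ≤ card T → card (T ⊞ periodic X) + k ≤ p → Admissible k X (restrict T)
    admissible T h r = subst (k ≤_) (sym (card-restrict T)) h , subst (_≤ p ∸ k) (sym (card-restrict-⊕ T X)) (m+n≤o⇒m≤o∸n _ r)

    private
      swap : ∀ κ a t → κ + a + t ≡ κ + t + a
      swap = ℕR.solve-∀

    atom : Atom k (periodic X) (periodic A)
    atom = record
      { size = subst (k ≤_) (sym (card-periodic A)) (proj₁ (proj₁ (proj₁ isAtom)))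
      ; room = subst (λ c → c + k ≤ p) (card-⊕ A X) (≤-trans (+-monoˡ-≤ k (proj₂ (proj₁ (proj₁ isAtom)))) (≤-reflexive (m∸n+n≡m k≤p)))
      ; minimal = λ T h r → let U = restrict T in
          subst₂ _≤_ (cong₂ _+_ (card-⊕ A X) (card-restrict T)) (cong₂ _+_ (card-restrict-⊕ T X) (sym (card-periodic A)))
            (≤-trans (≤-reflexive (trans (cong (_+ ∣ U ∣) A-excess) (swap (κ k X) ∣ A ∣ ∣ U ∣)))
              (+-monoˡ-≤ ∣ A ∣ (≤-trans (+-monoˡ-≤ ∣ U ∣ (κ-lower k X (admissible T h r))) (≤-reflexive (sym (excess U))))))
      ; least = λ T h r e → let U = restrict T in
          subst₂ _≤_ (sym (card-periodic A)) (card-restrict T) (proj₂ isAtom U (admissible T h r , ≤-antisym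
            (+-cancelʳ-≤ (∣ U ∣ + ∣ A ∣) _ _ (subst₂ _≤_ (trans (cong (_+ ∣ A ∣) (excess U)) (+-assoc _ ∣ U ∣ ∣ A ∣)) (trans (cong (_+ ∣ U ∣) A-excess) (trans (swap (κ k X) ∣ A ∣ ∣ U ∣) (+-assoc _ ∣ U ∣ ∣ A ∣)))
              (subst₂ _≤_ (cong₂ _+_ (sym (card-restrict-⊕ T X)) (card-periodic A)) (cong₂ _+_ (sym (card-⊕ A X)) (sym (card-restrict T))) e)))
            (κ-lower k X (admissible T h r)))) }

    sumset≤ : ∀ m → κ k X ≤ m → card (periodic A ⊞ periodic X) ≤ card (periodic A) + m
    sumset≤ m h = subst₂ _≤_ (card-⊕ A X) (cong (_+ m) (sym (card-periodic A)))
      (≤-trans (≤-reflexive (trans A-excess (+-comm (κ k X) ∣ A ∣))) (+-monoʳ-≤ ∣ A ∣ h))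

  -- The sizes of 4-atoms and 5-atoms

  module Theorem (X : Subset p) (4≤X : 4 ≤ ∣ X ∣) (κ≤ : κ 5 X ≤ ∣ X ∣ + 1) (X+42<p : ∣ X ∣ + 42 < p) where

    46<p : 46 < p
    46<p = ≤-<-trans (+-monoˡ-≤ 42 4≤X) X+42<p

    0<X : 0 < ∣ X ∣
    0<X = ≤-trans (s≤s z≤n) 4≤X

    four-atoms : ∀ A → IsAtom 4 X A → ∣ A ∣ ≡ 4
    four-atoms A isAtom = ≤-antisym (≮⇒≥ λ 5≤A → FourAtoms.impossible 46<p T.atom
        (subst (4 ≤_) (sym (card-periodic X)) 4≤X) (subst (λ n → n + 42 < p) (sym (card-periodic X)) X+42<p)
        (subst (5 ≤_) (sym (card-periodic A)) 5≤A)
        (≤-trans (T.sumset≤ (∣ X ∣ + 1) (≤-trans (κ-mono X (n≤1+n 4)) κ≤))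
          (≤-reflexive (trans (sym (+-assoc _ ∣ X ∣ 1)) (cong (λ n → card (periodic A) + n + 1) (sym (card-periodic X)))))))
        (proj₁ (proj₁ (proj₁ isAtom)))
      where module T = Transfer {4} {X} {A} (≤-trans (m≤m+n 4 42) (<⇒≤ 46<p)) 0<X isAtom

    five-atoms : ∣ X ∣ ≡ 4 → ∀ A → IsAtom 5 X A → ∣ A ∣ ≡ 5
    five-atoms X≡4 A isAtom = ≤-antisym (≮⇒≥ λ 6≤A → FiveAtoms.impossible 46<p T.atom (trans (card-periodic X) X≡4)
        (subst (6 ≤_) (sym (card-periodic A)) 6≤A) (T.sumset≤ 5 (subst (λ n → κ 5 X ≤ n + 1) X≡4 κ≤)))
        (proj₁ (proj₁ (proj₁ isAtom)))
      where module T = Transfer {5} {X} {A} (≤-trans (m≤m+n 5 41) (<⇒≤ 46<p)) 0<X isAtom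

open import Data.Fin.Subset using (_∈_)

theorem4p1 : (p : ℕ) .{{_ : NonZero p}} → Prime p → (X : Subset p)
    → 0ₚ ∈ X → 4 ≤ ∣ X ∣ → κ 5 X ≤ ∣ X ∣ + 1 → ∣ X ∣ + 42 < p
    → ((A : Subset p) → IsAtom 4 X A → ∣ A ∣ ≡ 4)
    × (∣ X ∣ ≡ 4 → (A : Subset p) → IsAtom 5 X A → ∣ A ∣ ≡ 5)
theorem4p1 p p-prime X _ 4≤X κ≤ X+42<p = four-atoms , five-atoms
  where open Residues.Theorem p p-prime X 4≤X κ≤ X+42<p
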